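{- For every $n\ge 1$, $$\tilde{J}_{(n)}^{(\alpha)}(X) = n!\sum_{\pi \in S_n} \binom{\alpha +n-1-\mathrm{des}(\pi)}{n} F_{\mathrm{Des}(P(\pi))}(x),$$ where $P(\pi)$ is the insertion tableau of $\pi$ given by the Robinson–Schensted correspondence.
   Context: Jack polynomials: over $\mathbb{Q}(\alpha)$, with $\alpha$ an indeterminate, let $\langle p_\lambda,p_\nu\rangle_\alpha=\delta_{\lambda\nu}z_\lambda\alpha^{\ell(\lambda)}$, where $z_\lambda=\prod_i i^{m_i}m_i!$ and $m_i$ is the number of parts of $\lambda$ equal to $i$. The integral form Jack symmetric functions $J_\mu^{(\alpha)}(X)$ are the unique family, indexed by partitions $\mu$, of symmetric functions that are pairwise orthogonal for $\langle\cdot,\cdot\rangle_\alpha$, are triangular (only monomial symmetric functions $m_\lambda$ with $\lambda\le\mu$ in dominance order appear in $J_\mu^{(\alpha)}$), and are normalized so that the coefficient of $m_{1^n}$ in $J_\mu^{(\alpha)}$ is $n!$ where $n=|\mu|$. For $\mu$ a partition of $n$, define $\tilde J_\mu^{(\alpha)}(X)=\alpha^nJ_\mu^{(1/\alpha)}(X)$. Binomial coefficients in $\alpha$ are polynomials in $\alpha$. For $\pi=\pi_1\cdots\pi_n\in S_n$, $\mathrm{des}(\pi)$ is the number of $i$ with $\pi_i>\pi_{i+1}$. $P(\pi)$ is the standard Young tableau obtained by successively row-inserting $\pi_1,\ldots,\pi_n$ into the empty tableau (French notation, first row at the bottom: an inserted value replaces the leftmost larger entry in the row, which is then inserted in the next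 row up, or is appended to the end of the row if there is no larger entry). For a standard Young tableau $T$ with $n$ cells, $\mathrm{Des}(T)\subseteq\{1,\ldots,n-1\}$ is the set of entries $i$ such that $i+1$ lies above, or above and to the left of, $i$ (equivalently, $i+1$ is in a strictly higher row). For $\sigma\subseteq\{1,\ldots,n-1\}$ the fundamental quasisymmetric function is $$F_\sigma(x)=\sum_{\substack{i_1\le\cdots\le i_n\\ j\in\sigma\Rightarrow i_j<i_{j+1}}}x_{i_1}\cdots x_{i_n}.$$ -}

module Defs where

open import Algebra.Bundles.Raw using (RawRing)
import Algebra.Definitions.RawSemiring as SemiringOps
open import Data.Bool.Base using (if_then_else_)
open import Data.List.Base
  using (List; []; _∷_; [_]; _++_; map; concatMap; filter; foldl; foldr;
         length; replicate; take; applyUpTo; upTo)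
open import Data.List.Membership.DecPropositional using (_∈?_)
open import Data.List.Properties using (≡-dec)
open import Data.List.Relation.Binary.Permutation.Propositional using (_↭_)
open import Data.List.Relation.Unary.All as All using (All)
open import Data.List.Relation.Unary.Any as Any using (Any; here; there)
open import Data.List.Relation.Unary.Linked using (Linked; [-])
import Data.List.Sort.InsertionSort.Base as InsertionSort
open import Data.Maybe.Base using (Maybe; just; nothing)
open import Data.Nat.Base as ℕ using (ℕ; zero; suc; _≤_; _<_; _≥_; _∸_; _!)
open import Data.Nat.ListAction using (sum; product)
import Data.Nat.Properties as ℕ
open import Data.Product.Base using (Σ-syntax; ∃-syntax; _×_; _,_)
open import Data.Rational.Base as ℚ using (ℚ; 0ℚ; 1ℚ)
import Data.Rational.Properties as ℚ
open import Function.Base using (_∘_)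
open import Level using (0ℓ)
open import Relation.Binary.Bundles using (DecTotalOrder)
import Relation.Binary.Construct.Flip.EqAndOrd as Flip
open import Relation.Binary.PropositionalEquality
  using (_≡_; _≢_; refl; sym; trans; cong; cong₂; module ≡-Reasoning)
open import Relation.Nullary using (¬_; Dec; does; yes; no; contradiction)
open import Relation.Nullary.Decidable using (¬?; _×-dec_)

-- The list a₀ ∷ a₁ ∷ … stands for a₀ + a₁α + …; trailing zeros are
-- allowed, so polynomials are compared with _≈ₚ_ rather than _≡_.
ℚ[α] : Set
ℚ[α] = List ℚ

coeffₚ : ℚ[α] → ℕ → ℚ
coeffₚ []      _       = 0ℚ
coeffₚ (a ∷ p) zero    = a
coeffₚ (a ∷ p) (suc k) = coeffₚ p k

infix 4 _≈ₚ_
_≈ₚ_ : ℚ[α] → ℚ[α] → Set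
p ≈ₚ q = ∀ k → coeffₚ p k ≡ coeffₚ q k

infixl 6 _+ₚ_
_+ₚ_ : ℚ[α] → ℚ[α] → ℚ[α]
[]      +ₚ q       = q
(a ∷ p) +ₚ []      = a ∷ p
(a ∷ p) +ₚ (b ∷ q) = (a ℚ.+ b) ∷ (p +ₚ q)

scaleₚ : ℚ → ℚ[α] → ℚ[α]
scaleₚ a = map (a ℚ.*_)

infixl 7 _*ₚ_
_*ₚ_ : ℚ[α] → ℚ[α] → ℚ[α]
[]      *ₚ q = []
(a ∷ p) *ₚ q = scaleₚ a q +ₚ (0ℚ ∷ p *ₚ q)

Nonzeroₚ : ℚ[α] → Set
Nonzeroₚ = Any (_≢ 0ℚ)

nonzeroₚ? : (p : ℚ[α]) → Dec (Nonzeroₚ p)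
nonzeroₚ? = Any.any? (λ a → ¬? (a ℚ.≟ 0ℚ))

-- ℚ[α] is an integral domain, so that products of denominators are again
-- denominators.
private
  coeff-+ : ∀ p q k → coeffₚ (p +ₚ q) k ≡ coeffₚ p k ℚ.+ coeffₚ q k
  coeff-+ []      q       k       = sym (ℚ.+-identityˡ _)
  coeff-+ (a ∷ p) []      k       = sym (ℚ.+-identityʳ _)
  coeff-+ (a ∷ p) (b ∷ q) zero    = refl
  coeff-+ (a ∷ p) (b ∷ q) (suc k) = coeff-+ p q k

  coeff-scale : ∀ a q k → coeffₚ (scaleₚ a q) k ≡ a ℚ.* coeffₚ q k
  coeff-scale a []      k       = sym (ℚ.*-zeroʳ a)
  coeff-scale a (b ∷ q) zero    = refl
  coeff-scale a (b ∷ q) (suc k) = coeff-scale a q k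

  coeff-* : ∀ a p q k →
    coeffₚ ((a ∷ p) *ₚ q) k ≡ a ℚ.* coeffₚ q k ℚ.+ coeffₚ (0ℚ ∷ p *ₚ q) k
  coeff-* a p q k = trans (coeff-+ (scaleₚ a q) (0ℚ ∷ p *ₚ q) k)
    (cong (ℚ._+ coeffₚ (0ℚ ∷ p *ₚ q) k) (coeff-scale a q k))

  coeff-*-shift : ∀ p q k →
    coeffₚ (p *ₚ (0ℚ ∷ q)) k ≡ coeffₚ (0ℚ ∷ p *ₚ q) k
  coeff-*-shift []      q zero    = refl
  coeff-*-shift []      q (suc k) = refl
  coeff-*-shift (a ∷ p) q zero    =
    trans (coeff-* a p (0ℚ ∷ q) 0) (cong (ℚ._+ 0ℚ) (ℚ.*-zeroʳ a))
  coeff-*-shift (a ∷ p) q (suc k) =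
    trans (coeff-* a p (0ℚ ∷ q) (suc k))
      (trans (cong (a ℚ.* coeffₚ q k ℚ.+_) (coeff-*-shift p q k))
        (sym (coeff-* a p q k)))

  toCoeff : ∀ {p} → Nonzeroₚ p → ∃[ k ] coeffₚ p k ≢ 0ℚ
  toCoeff (here a≢0) = 0 , a≢0
  toCoeff (there p≢0) with toCoeff p≢0
  ... | k , eq = suc k , eq

  fromCoeff : ∀ p k → coeffₚ p k ≢ 0ℚ → Nonzeroₚ p
  fromCoeff []      k       c≢0 = contradiction refl c≢0
  fromCoeff (a ∷ p) zero    c≢0 = here c≢0
  fromCoeff (a ∷ p) (suc k) c≢0 = there (fromCoeff p k c≢0)

  nonzero-resp : ∀ {p q} → p ≈ₚ q → Nonzeroₚ p → Nonzeroₚ q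
  nonzero-resp {p} {q} p≈q p≢0 with toCoeff p≢0
  ... | k , c≢0 = fromCoeff q k (λ c≡0 → c≢0 (trans (p≈q k) c≡0))

  ℚ-domain : ∀ {a b} → a ≢ 0ℚ → b ≢ 0ℚ → a ℚ.* b ≢ 0ℚ
  ℚ-domain {a} {b} a≢0 b≢0 ab≡0 = b≢0 (begin
    b                    ≡⟨ ℚ.*-identityˡ b ⟨
    1ℚ ℚ.* b             ≡⟨ cong (ℚ._* b) (ℚ.*-inverseˡ a) ⟨
    1/a ℚ.* a ℚ.* b      ≡⟨ ℚ.*-assoc 1/a a b ⟩
    1/a ℚ.* (a ℚ.* b)    ≡⟨ cong (1/a ℚ.*_) ab≡0 ⟩
    1/a ℚ.* 0ℚ           ≡⟨ ℚ.*-zeroʳ 1/a ⟩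
    0ℚ                   ∎)
    where
    open ≡-Reasoning
    instance _ = ℚ.≢-nonZero a≢0
    1/a = ℚ.1/ a

  head-nonzero : ∀ {a} p {q} → a ≢ 0ℚ → Nonzeroₚ q → Nonzeroₚ ((a ∷ p) *ₚ q)
  head-nonzero {a} p {b ∷ q} a≢0 nz with b ℚ.≟ 0ℚ
  ... | no b≢0 = here (λ eq → ℚ-domain a≢0 b≢0 (trans (sym (ℚ.+-identityʳ _)) eq))
  ... | yes refl with nz
  ...   | here 0≢0   = contradiction refl 0≢0
  ...   | there q≢0  = nonzero-resp (λ k → sym (coeff-*-shift (a ∷ p) q k))
                         (there (head-nonzero p a≢0 q≢0))

*ₚ-nonzero : ∀ {p q} → Nonzeroₚ p → Nonzeroₚ q → Nonzeroₚ (p *ₚ q)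
*ₚ-nonzero {a ∷ p} {q} nz q≢0 with a ℚ.≟ 0ℚ
... | no a≢0 = head-nonzero p a≢0 q≢0
... | yes refl with nz
...   | here 0≢0  = contradiction refl 0≢0
...   | there p≢0 = nonzero-resp shift (there (*ₚ-nonzero p≢0 q≢0))
  where
  shift : (0ℚ ∷ p *ₚ q) ≈ₚ (0ℚ ∷ p) *ₚ q
  shift k = sym (trans (coeff-* 0ℚ p q k)
    (trans (cong (ℚ._+ coeffₚ (0ℚ ∷ p *ₚ q) k) (ℚ.*-zeroˡ (coeffₚ q k)))
      (ℚ.+-identityˡ _)))

record ℚ⟨α⟩ : Set where
  constructor frac
  field
    num   : ℚ[α]
    den   : ℚ[α]
    den≢0 : Nonzeroₚ den

open ℚ⟨α⟩ public

1≢0ₚ : Nonzeroₚ [ 1ℚ ]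
1≢0ₚ = here (λ ())

ℚ⟨α⟩-rawRing : RawRing 0ℓ 0ℓ
ℚ⟨α⟩-rawRing = record
  { Carrier = ℚ⟨α⟩
  ; _≈_     = λ f g → num f *ₚ den g ≈ₚ num g *ₚ den f
  ; _+_     = λ f g → frac (num f *ₚ den g +ₚ num g *ₚ den f)
                           (den f *ₚ den g) (*ₚ-nonzero (den≢0 f) (den≢0 g))
  ; _*_     = λ f g → frac (num f *ₚ num g)
                           (den f *ₚ den g) (*ₚ-nonzero (den≢0 f) (den≢0 g))
  ; -_      = λ f → frac (scaleₚ (ℚ.- 1ℚ) (num f)) (den f) (den≢0 f)
  ; 0#      = frac [] [ 1ℚ ] 1≢0ₚ
  ; 1#      = frac [ 1ℚ ] [ 1ℚ ] 1≢0ₚ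
  }

open RawRing ℚ⟨α⟩-rawRing public using (_≈_; _+_; _*_; -_; 0#; 1#)
open SemiringOps (RawRing.rawSemiring ℚ⟨α⟩-rawRing) public
  using (_^_) renaming (_×_ to _·_)

infixl 6 _-_
_-_ : ℚ⟨α⟩ → ℚ⟨α⟩ → ℚ⟨α⟩
f - g = f + (- g)

-- Total inverse, with the convention 0⁻¹ = 0.
infix 9 _⁻¹
_⁻¹ : ℚ⟨α⟩ → ℚ⟨α⟩
f ⁻¹ with nonzeroₚ? (num f)
... | yes num≢0 = frac (den f) (num f) num≢0
... | no  _     = 0#

constant : ℚ → ℚ⟨α⟩
constant a = frac [ a ] [ 1ℚ ] 1≢0ₚ

fromℕ : ℕ → ℚ⟨α⟩
fromℕ n = n · 1#

α : ℚ⟨α⟩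
α = frac (0ℚ ∷ 1ℚ ∷ []) [ 1ℚ ] 1≢0ₚ

evaluate : ℚ[α] → ℚ⟨α⟩ → ℚ⟨α⟩
evaluate p t = foldr (λ a r → constant a + t * r) 0# p

-- f(1/α).  The convention for 0⁻¹ plays no role here: a nonzero
-- polynomial does not vanish at 1/α.
infix 9 _[1/α]
_[1/α] : ℚ⟨α⟩ → ℚ⟨α⟩
f [1/α] = evaluate (num f) (α ⁻¹) * (evaluate (den f) (α ⁻¹)) ⁻¹

∑ ∏ : {A : Set} → List A → (A → ℚ⟨α⟩) → ℚ⟨α⟩
∑ xs f = foldr (λ x r → f x + r) 0# xs
∏ xs f = foldr (λ x r → f x * r) 1# xs

binomial : ℚ⟨α⟩ → ℕ → ℚ⟨α⟩
binomial f k = ∏ (upTo k) (λ i → f - fromℕ i) * (fromℕ (k !)) ⁻¹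

indicator : {P : Set} → Dec P → ℚ⟨α⟩
indicator P? = if does P? then 1# else 0#

δ : List ℕ → List ℕ → ℚ⟨α⟩
δ xs ys = indicator (≡-dec ℕ._≟_ xs ys)

record Partition : Set where
  field
    parts      : List ℕ
    decreasing : Linked _≥_ parts
    positive   : All (0 <_) parts

open Partition public

size : Partition → ℕ
size λ′ = sum (parts λ′)

row : (n : ℕ) → 1 ≤ n → Partition
row n 1≤n = record
  { parts = [ n ] ; decreasing = [-] ; positive = 1≤n All.∷ All.[] }

infix 4 _⊴_
_⊴_ : Partition → Partition → Set
λ′ ⊴ μ = size λ′ ≡ size μ ×
         (∀ k → sum (take k (parts λ′)) ≤ sum (take k (parts μ)))

multiplicity : ℕ → Partition → ℕ
multiplicity i λ′ = length (filter (ℕ._≟ i) (parts λ′))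

-- The parts of a partition of n lie in {1,…,n}; other i contribute 1.
z : Partition → ℕ
z λ′ = product (applyUpTo (λ i → factor (suc i)) (size λ′))
  where
  factor : ℕ → ℕ
  factor i = i ℕ.^ multiplicity i λ′ ℕ.* (multiplicity i λ′) !

-- The list e₁ ∷ … ∷ eₖ ∷ [] stands for the monomial x₁^e₁⋯xₖ^eₖ, and a
-- series is the function giving its coefficients.  Lists which differ by
-- trailing zeros denote the same monomial.
Monomial : Set
Monomial = List ℕ

PowerSeries : Set
PowerSeries = Monomial → ℚ⟨α⟩

infix 4 _≈ₛ_
_≈ₛ_ : PowerSeries → PowerSeries → Set
f ≈ₛ g = ∀ e → f e ≈ g e

infixr 7 _•_
_•_ : ℚ⟨α⟩ → PowerSeries → PowerSeries
(c • f) e = c * f e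

∑ₛ : {A : Set} → List A → (A → PowerSeries) → PowerSeries
∑ₛ xs f e = ∑ xs (λ x → f x e)

nonzeroExponents : Monomial → List ℕ
nonzeroExponents = filter (λ k → ¬? (k ℕ.≟ 0))

-- All ways of writing a monomial as a product of two monomials.
factorisations : Monomial → List (Monomial × Monomial)
factorisations []      = [ [] , [] ]
factorisations (k ∷ e) =
  concatMap (λ i → map (λ (a , b) → i ∷ a , (k ∸ i) ∷ b) (factorisations e))
            (upTo (suc k))

1ₛ : PowerSeries
1ₛ e = δ (nonzeroExponents e) []

infixl 7 _*ₛ_
_*ₛ_ : PowerSeries → PowerSeries → PowerSeries
(f *ₛ g) e = ∑ (factorisations e) (λ (a , b) → f a * g b)

powerSum : ℕ → PowerSeries
powerSum k e = δ (nonzeroExponents e) [ k ]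

p[_] : Partition → PowerSeries
p[ λ′ ] = foldr (λ k f → powerSum k *ₛ f) 1ₛ (parts λ′)

private
  ≥-decTotalOrder : DecTotalOrder 0ℓ 0ℓ 0ℓ
  ≥-decTotalOrder = Flip.decTotalOrder ℕ.≤-decTotalOrder

open InsertionSort ≥-decTotalOrder public using () renaming (sort to sort↓)

-- mλ is the sum of all distinct monomials whose exponents rearrange to λ.
m[_] : Partition → PowerSeries
m[ λ′ ] e = δ (sort↓ (nonzeroExponents e)) (parts λ′)

record SymmetricFunction : Set where
  field
    series        : PowerSeries
    trailing-zero : ∀ e → series (e ++ [ 0 ]) ≈ series e
    symmetric     : ∀ {e e′} → e ↭ e′ → series e ≈ series e′
    bounded       : ∃[ d ] (∀ e → d < sum e → series e ≈ 0#)

open SymmetricFunction public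

-- A finite formal sum of terms aλ, in which a partition may be repeated.
Combination : Set
Combination = List (ℚ⟨α⟩ × Partition)

coefficient : Combination → List ℕ → ℚ⟨α⟩
coefficient c xs = ∑ c (λ (a , λ′) → a * δ (parts λ′) xs)

expand : (Partition → PowerSeries) → Combination → PowerSeries
expand basis c = ∑ₛ c (λ (a , λ′) → a • basis λ′)

⟨p[_],p[_]⟩ : Partition → Partition → ℚ⟨α⟩
⟨p[ λ′ ],p[ ν ]⟩ =
  δ (parts λ′) (parts ν) * (fromℕ (z λ′) * α ^ length (parts λ′))

-- ⟨ f , g ⟩α≈ v states that ⟨f,g⟩_α = v, where the form is extended
-- bilinearly from the basis of power sums.
⟨_,_⟩α≈_ : SymmetricFunction → SymmetricFunction → ℚ⟨α⟩ → Set
⟨ f , g ⟩α≈ v =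
  Σ[ a ∈ Combination ] Σ[ b ∈ Combination ]
    series f ≈ₛ expand p[_] a ×
    series g ≈ₛ expand p[_] b ×
    ∑ a (λ (s , λ′) → ∑ b (λ (t , ν) → s * t * ⟨p[ λ′ ],p[ ν ]⟩)) ≈ v

-- These properties characterise the integral forms J_μ^(α) uniquely.
record IsJackFamily (J : Partition → SymmetricFunction) : Set where
  field
    orthogonal        : ∀ μ ν → parts μ ≢ parts ν → ⟨ J μ , J ν ⟩α≈ 0#
    monomialExpansion : Partition → Combination
    expands           : ∀ μ →
      series (J μ) ≈ₛ expand m[_] (monomialExpansion μ)
    triangular        : ∀ μ λ′ →
      ¬ coefficient (monomialExpansion μ) (parts λ′) ≈ 0# → λ′ ⊴ μ
    normalised        : ∀ μ →
      coefficient (monomialExpansion μ) (replicate (size μ) 1)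
        ≈ fromℕ (size μ !)

J̃ : (Partition → SymmetricFunction) → Partition → PowerSeries
J̃ J μ = α ^ size μ • (λ e → series (J μ) e [1/α])

-- A permutation π ∈ Sₙ is the word π₁ ∷ … ∷ πₙ ∷ [] in the letters 1,…,n.
Word : Set
Word = List ℕ

insertions : ℕ → Word → List Word
insertions x []      = [ [ x ] ]
insertions x (y ∷ w) = (x ∷ y ∷ w) ∷ map (y ∷_) (insertions x w)

S : ℕ → List Word
S zero    = [ [] ]
S (suc n) = concatMap (insertions (suc n)) (S n)

des : Word → ℕ
des []          = 0
des (x ∷ [])    = 0
des (x ∷ y ∷ w) = (if does (y ℕ.<? x) then 1 else 0) ℕ.+ des (y ∷ w)

-- Rows are listed from the bottom one upwards.
Tableau : Set
Tableau = List (List ℕ)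

-- The new row, together with the entry bumped out of it, if any.
rowInsert : ℕ → List ℕ → List ℕ × Maybe ℕ
rowInsert x []      = [ x ] , nothing
rowInsert x (y ∷ r) with x ℕ.<? y | rowInsert x r
... | yes _ | _      = x ∷ r , just y
... | no  _ | r′ , b = y ∷ r′ , b

insert : Tableau → ℕ → Tableau
insert []      x = [ [ x ] ]
insert (r ∷ T) x with rowInsert x r
... | r′ , nothing = r′ ∷ T
... | r′ , just y  = r′ ∷ insert T y

P : Word → Tableau
P = foldl insert []

-- The height of the row containing i (the number of rows if there is
-- none).
rowOf : ℕ → Tableau → ℕ
rowOf i []      = 0
rowOf i (r ∷ T) = if does (_∈?_ ℕ._≟_ i r) then 0 else suc (rowOf i T)

-- The descents of a standard Young tableau with n cells, all of which
-- lie in {1,…,n-1}.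
Des : ℕ → Tableau → List ℕ
Des n T = filter (λ i → rowOf i T ℕ.<? rowOf (suc i) T)
                 (applyUpTo suc (n ∸ 1))

-- The weakly increasing sequence i₁ ≤ ⋯ ≤ iₙ with x^e = x_{i₁}⋯x_{iₙ}.
indices : Monomial → List ℕ
indices = go 1
  where
  go : ℕ → Monomial → List ℕ
  go i []      = []
  go i (k ∷ e) = replicate k i ++ go (suc i) e

-- The j-th entry of a list, counting from 1 (0 if out of range).
entry : List ℕ → ℕ → ℕ
entry []      _             = 0
entry (x ∷ _) zero          = 0
entry (x ∷ _) (suc zero)    = x
entry (_ ∷ w) (suc (suc j)) = entry w (suc j)

-- F n σ, for σ ⊆ {1,…,n-1} given by the list of its elements.
F : ℕ → List ℕ → PowerSeries
F n σ e = indicator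
  ((sum e ℕ.≟ n) ×-dec
   All.all? (λ j → entry (indices e) j ℕ.<? entry (indices e) (suc j)) σ)

{-# OPTIONS --safe #-}
module Submission where

-- Write g_n for the series with coefficients ∏ᵢ (1 + α)⋯(1 + (eᵢ - 1)α) / eᵢ!
-- at the monomials x^e of degree n, so that ⟨g_n , f⟩ is α^n times the
-- coefficient of x₁^n in f.  By triangularity that coefficient vanishes in all
-- J_μ with μ ≠ (n), while the J_μ, being orthogonal and nonzero, span all m_μ
-- by induction along the dominance order.  Hence J_(n) is a multiple of g_n,
-- namely n! g_n, and J̃_(n) has the coefficients n! ∏ᵢ binom(α + eᵢ - 1 , eᵢ).
--
-- On the other side, i is a descent of P(π) exactly when i + 1 comes before i
-- in π.  So the permutations π contributing to the coefficient of x^e are the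
-- standardisations of the words w with eᵢ letters i, and des π = des w.  The
-- sum of binom(α + n - 1 - des w , n) over these words is computed by inserting
-- the letters one at a time, the largest last: inserting the largest letter,
-- present m times, in all n + 1 places multiplies the sum by α + m and produces
-- each word m + 1 times.

open import Algebra.Bundles using (CommutativeRing; Semiring)
import Algebra.Definitions.RawSemiring as SemiringOps
import Algebra.Properties.Ring as RingProperties
import Algebra.Properties.Semiring.Exp as Exp
import Algebra.Properties.Semiring.Mult as Mult
import Algebra.Solver.Ring.NaturalCoefficients.Default as RingSolver
open import Data.Bool.Base using (true; false; if_then_else_)
open import Data.List.Base hiding (sum; product; head; tail)
open import Data.List.Membership.Propositional using (_∈_; _∉_)
open import Data.List.Membership.Propositional.Properties
open import Data.List.Properties hiding (sum-++)
open import Data.List.Relation.Binary.Permutation.Propositional as ↭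
  using (_↭_; ↭-sym; ↭-trans; ↭-refl; ↭-reflexive; prep; swap; ↭⇒↭ₛ)
open import Data.List.Relation.Binary.Permutation.Propositional.Properties
  using (All-resp-↭; ↭-length; filter-↭; shift; ++⁺ˡ; ∈-resp-↭; ∷↭∷ʳ; drop-∷)
import Data.List.Relation.Binary.Permutation.Setoid.Properties as PermSetoid
open import Data.List.Relation.Binary.Pointwise using (Pointwise-≡⇒≡)
open import Data.List.Relation.Unary.All as All using (All; []; _∷_)
import Data.List.Relation.Unary.All.Properties as All
open import Data.List.Relation.Unary.AllPairs as AllPairs using (AllPairs; []; _∷_)
import Data.List.Relation.Unary.AllPairs.Properties as AllPairs
open import Data.List.Relation.Unary.Any using (Any; here; there)
import Data.List.Relation.Unary.Any.Properties as Any
open import Data.List.Relation.Unary.Linked as Linked using (Linked; []; [-]; _∷_)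
import Data.List.Relation.Unary.Sorted.TotalOrder.Properties as Sorted
open import Data.List.Relation.Unary.Unique.Propositional using (Unique)
import Data.List.Relation.Unary.Unique.DecPropositional.Properties as UniqueDec
import Data.List.Relation.Unary.Unique.Propositional.Properties as Unique
import Data.List.Sort.InsertionSort.Properties as InsertionSort
open import Data.Maybe.Base using (Maybe; just; nothing)
open import Data.Nat.Base as ℕ using (ℕ; zero; suc; _≤_; _<_; _≥_; _∸_; _!; s≤s; z≤n)
open import Data.Nat.Induction using (<-rec)
open import Data.Nat.ListAction using (sum; product)
open import Data.Nat.ListAction.Properties using (sum-++; product-++; sum-↭)
import Data.Nat.Properties as ℕ
open import Data.List.Membership.DecPropositional ℕ._≟_ using () renaming (_∈?_ to _∈ℕ?_)
open import Data.Nat.Tactic.RingSolver using (solve-∀)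
open import Data.Product.Base using (Σ-syntax; ∃; _×_; _,_; proj₁; proj₂)
open import Data.Rational.Base as ℚ using (ℚ; 0ℚ; 1ℚ)
import Data.Rational.Properties as ℚ
open import Data.Rational.Solver using (module +-*-Solver)
open import Data.Sum.Base as Sum using (_⊎_; inj₁; inj₂)
open import Function.Base using (_∘_; id; case_of_)
open import Level using (0ℓ)
open import Relation.Binary.Bundles using (DecTotalOrder)
import Relation.Binary.Construct.Flip.EqAndOrd as Flip
open import Relation.Binary.Definitions using (tri<; tri≈; tri>)
open import Relation.Binary.PropositionalEquality as ≡ using (_≡_; _≢_; cong; cong₂; subst)
import Relation.Binary.Reasoning.Setoid as SetoidReasoning
open import Relation.Nullary using (¬_; Dec; does; yes; no; ofʸ; ofⁿ; contradiction; ¬?)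
open import Relation.Nullary.Decidable using (dec-true; dec-false; map′; _×-dec_; _→-dec_)

open import Defs using
  ( ℚ[α]; coeffₚ; _≈ₚ_; _+ₚ_; scaleₚ; _*ₚ_; Nonzeroₚ; nonzeroₚ?; *ₚ-nonzero; 1≢0ₚ
  ; Partition; parts; decreasing; positive; size; row; _⊴_; z
  ; Monomial; nonzeroExponents; factorisations; sort↓
  ; Word; insertions; S; des; Tableau; rowInsert; insert; P; rowOf; Des; indices; entry )


-- Orthogonality determines coefficients only if no `J μ` is isotropic. This is why ℚ(α) is ordered,
-- with α a positive infinitesimal: a polynomial has the sign of its lowest nonzero coefficient.
-- Then ⟨p_κ , p_κ⟩ = z_κ α^ℓ(κ) is positive, and the form vanishes on no nonzero combination. The
-- form is given on power-sum expansions, and each pair μ, ν may bring its own expansions of `J μ`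
-- and `J ν`. Comparing them takes the linear independence of the power sums. The pairing with g_n
-- rests on g_n = Σ α^(n - ℓ(κ)) p_κ / z_κ over the partitions κ of n: against p_κ it gives α^n, and
-- p_κ has coefficient 1 at x₁^n. This expansion comes from the differential equation of (1 - α
-- t)^(-1/α), read as a Newton recursion. Both sides meet in the numbers binom(α + m - 1 , m), one
-- for each variable, since replacing α by 1/α turns 1 + jα into (α + j)/α. No bijection between
-- words and permutations is set up: the two are generated side by side, one largest letter at a
-- time, and an indicator selects the standardisations.

-- The part of an ordered field that makes the scalar product of power sums
-- anisotropic.  Over an abstract such field unification need not look through
-- the cross-multiplied equality of ℚ⟨α⟩; the sums and series defined over it
-- agree definitionally with those of Defs once it is ℚ⟨α⟩.
record PositiveField : Set₁ where
  infix 9 _⁻¹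
  field
    commutativeRing : CommutativeRing 0ℓ 0ℓ
  open CommutativeRing commutativeRing public
  field
    _⁻¹         : Carrier → Carrier
    ⁻¹-inverseˡ : ∀ x → ¬ x ≈ 0# → x ⁻¹ * x ≈ 1#
    zero?       : ∀ x → Dec (x ≈ 0#)
    Positive    : Carrier → Set
    positive-resp   : ∀ {x y} → x ≈ y → Positive x → Positive y
    positive-+      : ∀ {x y} → Positive x → Positive y → Positive (x + y)
    positive-*      : ∀ {x y} → Positive x → Positive y → Positive (x * y)
    positive-square : ∀ {x} → ¬ x ≈ 0# → Positive (x * x)
    positive⇒≉0     : ∀ {x} → Positive x → ¬ x ≈ 0#
    1≉0             : ¬ 1# ≈ 0#

-- Arithmetic, finite sums and signs over an abstract positive field.

module FieldTheory (K : PositiveField) where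

  open PositiveField K hiding (zero) public
  open RingProperties ring public using (-‿distribˡ-*; -0#≈0#; -‿+-comm; x+x≈x⇒x≈0)
  open SemiringOps (Semiring.rawSemiring semiring) public
    using (_^_) renaming (_×_ to _·_)
  open Exp semiring public using (^-homo-*)
  open SetoidReasoning setoid public
  open RingSolver commutativeSemiring public using (solve; _:+_; _:*_; _:=_; con)

  fromℕ : ℕ → Carrier
  fromℕ n = n · 1#

  fromℕ-+ : ∀ m n → fromℕ (m ℕ.+ n) ≈ fromℕ m + fromℕ n
  fromℕ-+ m n = Mult.×-homo-+ semiring 1# m n

  fromℕ-* : ∀ m n → fromℕ (m ℕ.* n) ≈ fromℕ m * fromℕ n
  fromℕ-* m n = Mult.×1-homo-* semiring m n

  fromℕ-1 : fromℕ 1 ≈ 1#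
  fromℕ-1 = +-identityʳ 1#

  fromℕ-cong : ∀ {m n} → m ≡ n → fromℕ m ≈ fromℕ n
  fromℕ-cong ≡.refl = refl

  positive-1 : Positive 1#
  positive-1 = positive-resp (*-identityˡ 1#) (positive-square 1≉0)

  positive-fromℕ : ∀ n → Positive (fromℕ (suc n))
  positive-fromℕ zero    = positive-resp (sym fromℕ-1) positive-1
  positive-fromℕ (suc n) = positive-+ positive-1 (positive-fromℕ n)

  fromℕ≉0 : ∀ n → 0 < n → ¬ fromℕ n ≈ 0#
  fromℕ≉0 (suc n) _ = positive⇒≉0 (positive-fromℕ n)

  positive-^ : ∀ {x} n → Positive x → Positive (x ^ n)
  positive-^ zero    x>0 = positive-1
  positive-^ (suc n) x>0 = positive-* x>0 (positive-^ n x>0)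

  ⁻¹-inverseʳ : ∀ x → ¬ x ≈ 0# → x * x ⁻¹ ≈ 1#
  ⁻¹-inverseʳ x x≉0 = trans (*-comm x (x ⁻¹)) (⁻¹-inverseˡ x x≉0)

  *-cancelˡ : ∀ x {y z} → ¬ x ≈ 0# → x * y ≈ x * z → y ≈ z
  *-cancelˡ x {y} {z} x≉0 eq = begin
    y                ≈⟨ *-identityˡ y ⟨
    1# * y           ≈⟨ *-congʳ (⁻¹-inverseˡ x x≉0) ⟨
    x ⁻¹ * x * y     ≈⟨ *-assoc _ _ _ ⟩
    x ⁻¹ * (x * y)   ≈⟨ *-congˡ eq ⟩
    x ⁻¹ * (x * z)   ≈⟨ *-assoc _ _ _ ⟨
    x ⁻¹ * x * z     ≈⟨ *-congʳ (⁻¹-inverseˡ x x≉0) ⟩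
    1# * z           ≈⟨ *-identityˡ z ⟩
    z                ∎

  x*y≈0⇒y≈0 : ∀ x {y} → ¬ x ≈ 0# → x * y ≈ 0# → y ≈ 0#
  x*y≈0⇒y≈0 x x≉0 eq = *-cancelˡ x x≉0 (trans eq (sym (zeroʳ x)))

  -- Finite sums and products

  private
    variable
      A B : Set

  ∑ ∏ : List A → (A → Carrier) → Carrier
  ∑ xs f = foldr (λ x r → f x + r) 0# xs
  ∏ xs f = foldr (λ x r → f x * r) 1# xs

  ∑-cong-∈ : ∀ (xs : List A) {f g} → (∀ x → x ∈ xs → f x ≈ g x) → ∑ xs f ≈ ∑ xs g
  ∑-cong-∈ []       f≈g = refl
  ∑-cong-∈ (x ∷ xs) f≈g = +-cong (f≈g x (here ≡.refl)) (∑-cong-∈ xs (λ y y∈ → f≈g y (there y∈)))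

  ∑-cong : ∀ (xs : List A) {f g} → (∀ x → f x ≈ g x) → ∑ xs f ≈ ∑ xs g
  ∑-cong xs f≈g = ∑-cong-∈ xs (λ x _ → f≈g x)

  ∑-0 : ∀ (xs : List A) {f} → (∀ x → x ∈ xs → f x ≈ 0#) → ∑ xs f ≈ 0#
  ∑-0 []       f≈0 = refl
  ∑-0 (x ∷ xs) f≈0 = trans (+-cong (f≈0 x (here ≡.refl)) (∑-0 xs (λ y y∈ → f≈0 y (there y∈)))) (+-identityˡ 0#)

  ∑-++ : ∀ (xs ys : List A) f → ∑ (xs ++ ys) f ≈ ∑ xs f + ∑ ys f
  ∑-++ []       ys f = sym (+-identityˡ _)
  ∑-++ (x ∷ xs) ys f = trans (+-congˡ (∑-++ xs ys f)) (sym (+-assoc _ _ _))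

  ∑-map : ∀ (g : A → B) xs f → ∑ (map g xs) f ≡ ∑ xs (f ∘ g)
  ∑-map g []       f = ≡.refl
  ∑-map g (x ∷ xs) f = cong (f (g x) +_) (∑-map g xs f)

  ∑-concatMap : ∀ (g : A → List B) xs f → ∑ (concatMap g xs) f ≈ ∑ xs (λ x → ∑ (g x) f)
  ∑-concatMap g []       f = refl
  ∑-concatMap g (x ∷ xs) f = trans (∑-++ (g x) (concatMap g xs) f) (+-congˡ (∑-concatMap g xs f))

  ∑-+ : ∀ (xs : List A) f g → ∑ xs (λ x → f x + g x) ≈ ∑ xs f + ∑ xs g
  ∑-+ []       f g = sym (+-identityˡ 0#)
  ∑-+ (x ∷ xs) f g = trans (+-congˡ (∑-+ xs f g))
    (solve 4 (λ a b c d → (a :+ b) :+ (c :+ d) := (a :+ c) :+ (b :+ d)) refl (f x) (g x) (∑ xs f) (∑ xs g))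

  ∑-*ˡ : ∀ c (xs : List A) f → ∑ xs (λ x → c * f x) ≈ c * ∑ xs f
  ∑-*ˡ c []       f = sym (zeroʳ c)
  ∑-*ˡ c (x ∷ xs) f = trans (+-congˡ (∑-*ˡ c xs f)) (sym (distribˡ c (f x) (∑ xs f)))

  ∑-*ʳ : ∀ c (xs : List A) f → ∑ xs (λ x → f x * c) ≈ ∑ xs f * c
  ∑-*ʳ c xs f = trans (∑-cong xs (λ x → *-comm (f x) c)) (trans (∑-*ˡ c xs f) (*-comm c _))

  ∑-swap : ∀ (xs : List A) (ys : List B) (f : A → B → Carrier) →
    ∑ xs (λ x → ∑ ys (λ y → f x y)) ≈ ∑ ys (λ y → ∑ xs (λ x → f x y))
  ∑-swap []       ys f = sym (∑-0 ys (λ _ _ → refl))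
  ∑-swap (x ∷ xs) ys f = trans (+-congˡ (∑-swap xs ys f)) (sym (∑-+ ys (f x) (λ y → ∑ xs (λ x → f x y))))

  ∏-cong : ∀ (xs : List A) {f g} → (∀ x → f x ≈ g x) → ∏ xs f ≈ ∏ xs g
  ∏-cong []       f≈g = refl
  ∏-cong (x ∷ xs) f≈g = *-cong (f≈g x) (∏-cong xs f≈g)

  ∏-++ : ∀ (xs ys : List A) f → ∏ (xs ++ ys) f ≈ ∏ xs f * ∏ ys f
  ∏-++ []       ys f = sym (*-identityˡ _)
  ∏-++ (x ∷ xs) ys f = trans (*-congˡ (∏-++ xs ys f)) (sym (*-assoc _ _ _))

  ∏-↭ : ∀ {xs ys : List A} f → xs ↭ ys → ∏ xs f ≈ ∏ ys f
  ∏-↭ f ↭.refl          = refl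
  ∏-↭ f (↭.prep x p)    = *-congˡ (∏-↭ f p)
  ∏-↭ f (↭.swap x y p)  = trans (*-congˡ (*-congˡ (∏-↭ f p)))
    (solve 3 (λ a b c → a :* (b :* c) := b :* (a :* c)) refl (f x) (f y) _)
  ∏-↭ f (↭.trans p q)   = trans (∏-↭ f p) (∏-↭ f q)

  indicator : {P : Set} → Dec P → Carrier
  indicator P? = if does P? then 1# else 0#

  indicator-yes : {P : Set} (P? : Dec P) → P → indicator P? ≈ 1#
  indicator-yes (yes _) p = refl
  indicator-yes (no ¬p) p = contradiction p ¬p

  indicator-no : {P : Set} (P? : Dec P) → ¬ P → indicator P? ≈ 0#
  indicator-no (yes p) ¬p = contradiction p ¬p
  indicator-no (no _)  ¬p = refl

  indicator-⇔ : {P Q : Set} (P? : Dec P) (Q? : Dec Q) → (P → Q) → (Q → P) → indicator P? ≈ indicator Q?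
  indicator-⇔ (yes p) Q? f g = sym (indicator-yes Q? (f p))
  indicator-⇔ (no ¬p) Q? f g = sym (indicator-no Q? (¬p ∘ g))

  indicator-* : {P Q R : Set} (P? : Dec P) (Q? : Dec Q) (R? : Dec R) →
    (P → Q × R) → (Q → R → P) → indicator P? ≈ indicator Q? * indicator R?
  indicator-* P? (yes q) R? f g = trans (indicator-⇔ P? R? (proj₂ ∘ f) (g q)) (sym (*-identityˡ _))
  indicator-* P? (no ¬q) R? f g = trans (indicator-no P? (¬q ∘ proj₁ ∘ f)) (sym (zeroˡ _))

  indicator-*-cong : {P : Set} (P? : Dec P) {x y : Carrier} → (P → x ≈ y) → indicator P? * x ≈ indicator P? * y
  indicator-*-cong (yes p) x≈y = *-congˡ (x≈y p)
  indicator-*-cong (no _)  x≈y = trans (zeroˡ _) (sym (zeroˡ _))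

  indicator-*-no : {P : Set} (P? : Dec P) {x : Carrier} → ¬ P → indicator P? * x ≈ 0#
  indicator-*-no P? ¬p = trans (*-congʳ (indicator-no P? ¬p)) (zeroˡ _)

  indicator-*-yes : {P : Set} (P? : Dec P) {x : Carrier} → P → indicator P? * x ≈ x
  indicator-*-yes P? p = trans (*-congʳ (indicator-yes P? p)) (*-identityˡ _)

  ∑-indicator-∉ : ∀ (_≟_ : ∀ x y → Dec (x ≡ y)) (xs : List A) (k : A) (f : A → Carrier) →
    k ∉ xs → ∑ xs (λ x → indicator (k ≟ x) * f x) ≈ 0#
  ∑-indicator-∉ _≟_ xs k f k∉xs = ∑-0 xs (λ x x∈xs →
    trans (*-congʳ (indicator-no (k ≟ x) (λ eq → k∉xs (subst (_∈ xs) (≡.sym eq) x∈xs)))) (zeroˡ _))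

  ∑-indicator-∈ : ∀ (_≟_ : ∀ x y → Dec (x ≡ y)) {xs : List A} {k : A} (f : A → Carrier) →
    Unique xs → k ∈ xs → ∑ xs (λ x → indicator (k ≟ x) * f x) ≈ f k
  ∑-indicator-∈ _≟_ {x ∷ xs} {k} f (x∉ ∷ u) (here ≡.refl) = trans
    (+-cong (trans (*-congʳ (indicator-yes (k ≟ k) ≡.refl)) (*-identityˡ _))
            (∑-indicator-∉ _≟_ xs k f (λ k∈ → All.lookup x∉ k∈ ≡.refl)))
    (+-identityʳ _)
  ∑-indicator-∈ _≟_ {x ∷ xs} {k} f (x∉ ∷ u) (there k∈) = trans
    (+-cong (trans (*-congʳ (indicator-no (k ≟ x) (λ eq → All.lookup x∉ k∈ (≡.sym eq)))) (zeroˡ _))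
            (∑-indicator-∈ _≟_ f u k∈))
    (+-identityˡ _)

  NonNegative : Carrier → Set
  NonNegative x = x ≈ 0# ⊎ Positive x

  nonNegative-+ : ∀ {x y} → NonNegative x → NonNegative y → NonNegative (x + y)
  nonNegative-+ (inj₁ x≈0) (inj₁ y≈0) = inj₁ (trans (+-cong x≈0 y≈0) (+-identityˡ 0#))
  nonNegative-+ (inj₁ x≈0) (inj₂ y>0) = inj₂ (positive-resp (trans (sym (+-identityˡ _)) (+-congʳ (sym x≈0))) y>0)
  nonNegative-+ (inj₂ x>0) (inj₁ y≈0) = inj₂ (positive-resp (trans (sym (+-identityʳ _)) (+-congˡ (sym y≈0))) x>0)
  nonNegative-+ (inj₂ x>0) (inj₂ y>0) = inj₂ (positive-+ x>0 y>0)

  positive-+-nonNegative : ∀ {x y} → Positive x → NonNegative y → Positive (x + y)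
  positive-+-nonNegative x>0 (inj₁ y≈0) = positive-resp (trans (sym (+-identityʳ _)) (+-congˡ (sym y≈0))) x>0
  positive-+-nonNegative x>0 (inj₂ y>0) = positive-+ x>0 y>0

  ∑-nonNegative : ∀ (xs : List A) {f} → (∀ x → NonNegative (f x)) → NonNegative (∑ xs f)
  ∑-nonNegative []       f≥0 = inj₁ refl
  ∑-nonNegative (x ∷ xs) f≥0 = nonNegative-+ (f≥0 x) (∑-nonNegative xs f≥0)

  -- A positive summand would make the whole sum positive, as the others are nonnegative. This is
  -- how a vanishing sum of squares yields vanishing coefficients.
  ∑-nonNegative-≈0 : ∀ (xs : List A) {f} → (∀ x → NonNegative (f x)) →
    ∑ xs f ≈ 0# → ∀ {x} → x ∈ xs → f x ≈ 0#
  ∑-nonNegative-≈0 (y ∷ xs) {f} f≥0 ∑≈0 x∈ with f≥0 y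
  ... | inj₂ fy>0 = contradiction ∑≈0 (positive⇒≉0 (positive-+-nonNegative fy>0 (∑-nonNegative xs f≥0)))
  ... | inj₁ fy≈0 with x∈
  ...   | here ≡.refl = fy≈0
  ...   | there x∈xs  = ∑-nonNegative-≈0 xs f≥0
          (trans (trans (sym (+-identityˡ _)) (+-congʳ (sym fy≈0))) ∑≈0) x∈xs

  -- Serves for supports: a coefficient given as a sum either vanishes or has a summand that forces
  -- `Q`, with no decision procedure for `Q`.
  ∑-≈0-or : ∀ {Q : Set} (xs : List A) {f} → (∀ x → x ∈ xs → f x ≈ 0# ⊎ Q) → ∑ xs f ≈ 0# ⊎ Q
  ∑-≈0-or []       h = inj₁ refl
  ∑-≈0-or (x ∷ xs) h with h x (here ≡.refl) | ∑-≈0-or xs (λ y y∈ → h y (there y∈))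
  ... | inj₂ q | _      = inj₂ q
  ... | _      | inj₂ q = inj₂ q
  ... | inj₁ a | inj₁ b = inj₁ (trans (+-cong a b) (+-identityˡ 0#))

-- Multiplicities and descents in words.

occurrences : ℕ → Word → ℕ
occurrences M w = length (filter (ℕ._≟ M) w)

occurrences-∷-≡ : ∀ M w → occurrences M (M ∷ w) ≡ suc (occurrences M w)
occurrences-∷-≡ M w = cong length (filter-accept (ℕ._≟ M) {xs = w} ≡.refl)

occurrences-∷-≢ : ∀ {M x} w → x ≢ M → occurrences M (x ∷ w) ≡ occurrences M w
occurrences-∷-≢ {M} w x≢M = cong length (filter-reject (ℕ._≟ M) {xs = w} x≢M)

occurrences-↭ : ∀ M {v w} → v ↭ w → occurrences M v ≡ occurrences M w
occurrences-↭ M p = ↭-length (filter-↭ (ℕ._≟ M) p)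

spread : ℕ → Monomial → Word
spread i []      = []
spread i (k ∷ e) = replicate k i ++ spread (suc i) e

des-∷-< : ∀ {x y} w → y < x → des (x ∷ y ∷ w) ≡ suc (des (y ∷ w))
des-∷-< {x} {y} w y<x = cong (λ b → (if b then 1 else 0) ℕ.+ des (y ∷ w)) (dec-true (y ℕ.<? x) y<x)

des-∷-≮ : ∀ {x y} w → ¬ y < x → des (x ∷ y ∷ w) ≡ des (y ∷ w)
des-∷-≮ {x} {y} w y≮x = cong (λ b → (if b then 1 else 0) ℕ.+ des (y ∷ w)) (dec-false (y ℕ.<? x) y≮x)

-- Sums over words of given content, and Worpitzky's recursion.

module WordSums (K : PositiveField) (α : PositiveField.Carrier K) where

  open FieldTheory K

  x+y-y≈x : ∀ x y → x + y - y ≈ x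
  x+y-y≈x x y = trans (+-assoc x y (- y)) (trans (+-congˡ (-‿inverseʳ y)) (+-identityʳ x))

  x-y+y≈x : ∀ x y → x - y + y ≈ x
  x-y+y≈x x y = trans (+-assoc x (- y) y) (trans (+-congˡ (-‿inverseˡ y)) (+-identityʳ x))

  -‿unique : ∀ x y z → x + y ≈ z → x ≈ z - y
  -‿unique x y z eq = trans (sym (x+y-y≈x x y)) (+-congʳ eq)

  falling : Carrier → ℕ → Carrier
  falling x k = ∏ (upTo k) (λ i → x - fromℕ i)

  falling-cong : ∀ {x y} k → x ≈ y → falling x k ≈ falling y k
  falling-cong k x≈y = ∏-cong (upTo k) (λ i → +-congʳ x≈y)

  falling-last : ∀ x k → falling x (suc k) ≈ falling x k * (x - fromℕ k)
  falling-last x k = begin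
    falling x (suc k)                                      ≈⟨ reflexive (cong (λ l → ∏ l (λ i → x - fromℕ i)) (upTo-∷ʳ k)) ⟨
    ∏ (upTo k ++ [ k ]) (λ i → x - fromℕ i)                ≈⟨ ∏-++ (upTo k) [ k ] _ ⟩
    falling x k * ((x - fromℕ k) * 1#)                     ≈⟨ *-congˡ (*-identityʳ _) ⟩
    falling x k * (x - fromℕ k)                            ∎

  -- Raising the argument by one shifts the factors: after the first they are those of `x`. With
  -- `falling-last` this exhibits `falling x n` as a common factor of `falling (x + 1#) (suc n)` and
  -- `falling x (suc n)`, as used in `worpitzky`.
  falling-first : ∀ x k → falling (x + 1#) (suc k) ≈ (x + 1#) * falling x k
  falling-first x k = *-cong (trans (+-congˡ -0#≈0#) (+-identityʳ _)) (begin
    ∏ (applyUpTo suc k) (λ i → x + 1# - fromℕ i)   ≈⟨ reflexive (cong (λ l → ∏ l (λ i → x + 1# - fromℕ i)) (map-upTo suc k)) ⟨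
    ∏ (map suc (upTo k)) (λ i → x + 1# - fromℕ i)  ≈⟨ ∏-map (upTo k) ⟩
    ∏ (upTo k) (λ i → x + 1# - fromℕ (suc i))      ≈⟨ ∏-cong (upTo k) (λ i → -‿unique _ _ _ (cancel i)) ⟩
    falling x k                                    ∎)
    where
    ∏-map : ∀ l → ∏ (map suc l) (λ i → x + 1# - fromℕ i) ≈ ∏ l (λ i → x + 1# - fromℕ (suc i))
    ∏-map []      = refl
    ∏-map (i ∷ l) = *-congˡ (∏-map l)
    cancel : ∀ i → x + 1# - fromℕ (suc i) + fromℕ i ≈ x
    cancel i = begin
      x + 1# - fromℕ (suc i) + fromℕ i         ≈⟨ x+y-y≈x _ 1# ⟨
      x + 1# - fromℕ (suc i) + fromℕ i + 1# - 1#
        ≈⟨ +-congʳ (solve 4 (λ a b c d → a :+ b :+ c :+ d := a :+ (b :+ (d :+ c))) refl (x + 1#) (- fromℕ (suc i))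
          (fromℕ i) 1#) ⟩
      x + 1# + (- fromℕ (suc i) + fromℕ (suc i)) - 1#  ≈⟨ +-congʳ (trans (+-congˡ (-‿inverseˡ _)) (+-identityʳ _)) ⟩
      x + 1# - 1#                              ≈⟨ x+y-y≈x x 1# ⟩
      x                                        ∎

  binomial : Carrier → ℕ → Carrier
  binomial x k = falling x k * (fromℕ (k !)) ⁻¹

  fromℕ-!≉0 : ∀ n → ¬ fromℕ (n !) ≈ 0#
  fromℕ-!≉0 n = fromℕ≉0 (n !) (ℕ.1≤n! n)

  !-inverse-suc : ∀ n → fromℕ (suc n) * (fromℕ (suc n !)) ⁻¹ ≈ (fromℕ (n !)) ⁻¹
  !-inverse-suc n = *-cancelˡ (fromℕ (n !)) (fromℕ-!≉0 n) (begin
    fromℕ (n !) * (fromℕ (suc n) * (fromℕ (suc n !)) ⁻¹)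
      ≈⟨ solve 3 (λ a b c → a :* (b :* c) := (b :* a) :* c) refl (fromℕ (n !)) (fromℕ (suc n)) _ ⟩
    fromℕ (suc n) * fromℕ (n !) * (fromℕ (suc n !)) ⁻¹
      ≈⟨ *-congʳ (fromℕ-* (suc n) (n !)) ⟨
    fromℕ (suc n !) * (fromℕ (suc n !)) ⁻¹   ≈⟨ ⁻¹-inverseʳ _ (fromℕ-!≉0 (suc n)) ⟩
    1#                                        ≈⟨ ⁻¹-inverseʳ _ (fromℕ-!≉0 n) ⟨
    fromℕ (n !) * (fromℕ (n !)) ⁻¹            ∎)

  binomial-cong : ∀ {x y} k → x ≈ y → binomial x k ≈ binomial y k
  binomial-cong k x≈y = *-congʳ (falling-cong k x≈y)

  -- The coefficient of t^m in (1 - t)^(-α).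
  rising : ℕ → Carrier
  rising m = binomial (α + fromℕ m - 1#) m

  rising-0 : rising 0 ≈ 1#
  rising-0 = trans (*-identityˡ _) (*-cancelˡ (fromℕ 1) (fromℕ-!≉0 0)
    (trans (⁻¹-inverseʳ _ (fromℕ-!≉0 0)) (sym (trans (*-identityʳ _) fromℕ-1))))

  -- The sums over words and the transformed coefficients of `J` are both identified with `rising`
  -- through this recursion and its initial value `rising-0`.
  rising-suc : ∀ m → fromℕ (suc m) * rising (suc m) ≈ (α + fromℕ m) * rising m
  rising-suc m = begin
    fromℕ (suc m) * (falling (α + fromℕ (suc m) - 1#) (suc m) * (fromℕ (suc m !)) ⁻¹)
      ≈⟨ *-congˡ (*-congʳ (trans (falling-cong (suc m) arg) (falling-first _ m))) ⟩
    fromℕ (suc m) * ((α + fromℕ m - 1# + 1#) * falling (α + fromℕ m - 1#) m * (fromℕ (suc m !)) ⁻¹)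
      ≈⟨ solve 4 (λ a b c d → a :* (b :* c :* d) := b :* (c :* (a :* d))) refl (fromℕ (suc m)) _ _ _ ⟩
    (α + fromℕ m - 1# + 1#) * (falling (α + fromℕ m - 1#) m * (fromℕ (suc m) * (fromℕ (suc m !)) ⁻¹))
      ≈⟨ *-cong (x-y+y≈x _ _) (*-congˡ (!-inverse-suc m)) ⟩
    (α + fromℕ m) * rising m ∎
    where
    arg : α + fromℕ (suc m) - 1# ≈ α + fromℕ m - 1# + 1#
    arg = solve 4 (λ a b m c → a :+ (b :+ m) :+ c := a :+ m :+ c :+ b) refl α 1# (fromℕ m) (- 1#)

  weight : Word → Carrier
  weight w = binomial (α + fromℕ (length w) - 1# - fromℕ (des w)) (length w)

  weight-[] : weight [] ≈ 1#
  weight-[] = rising-0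

  -- Worpitzky's recursion, refined by the number m of copies of the largest
  -- letter.  Here x = q + n and α = q + 1 + d, so that q = α - 1 - d.
  worpitzky : ∀ q d m c → let n = c ℕ.+ d ℕ.+ m ; x = q + fromℕ n in
    fromℕ (d ℕ.+ 1 ℕ.+ m) * binomial (x + 1#) (suc n) + fromℕ c * binomial x (suc n) ≈
    (q + 1# + fromℕ d + fromℕ m) * binomial x n
  worpitzky q d m c = begin
    fromℕ (d ℕ.+ 1 ℕ.+ m) * binomial (x + 1#) (suc n) + fromℕ c * binomial x (suc n)
      ≈⟨ +-cong (*-cong d+1+m (*-congʳ (falling-first x n)))
          (*-congˡ (*-congʳ (trans (falling-last x n) (*-congˡ (x+y-y≈x q _))))) ⟩
    (D + 1# + M) * ((x + 1#) * f * i) + C * (f * q * i)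
      ≈⟨ +-congʳ (*-congˡ (*-congʳ (*-congʳ (+-congʳ (+-congˡ c+d+m))))) ⟩
    (D + 1# + M) * ((q + (C + D + M) + 1#) * f * i) + C * (f * q * i)
      -- With N = C + D + M this is (D + 1 + M)(q + N + 1) + C q = (q + 1 + D + M)(N + 1),
      -- multiplied by f i.
      ≈⟨ solve 6 (λ q D M C f i → (D :+ con 1 :+ M) :* ((q :+ (C :+ D :+ M) :+ con 1) :* f :* i) :+ C :* (f :* q :* i)
                  := (q :+ con 1 :+ D :+ M) :* (f :* ((con 1 :+ (C :+ D :+ M)) :* i)))
               refl q D M C f i ⟩
    (q + 1# + D + M) * (f * ((1# + (C + D + M)) * i))
      ≈⟨ *-congˡ (*-congˡ (*-congʳ (+-congˡ (sym c+d+m)))) ⟩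
    (q + 1# + D + M) * (f * (fromℕ (suc n) * i))
      ≈⟨ *-congˡ (*-congˡ (!-inverse-suc n)) ⟩
    (q + 1# + D + M) * binomial x n ∎
    where
    n = c ℕ.+ d ℕ.+ m
    x = q + fromℕ n
    D = fromℕ d
    M = fromℕ m
    C = fromℕ c
    f = falling x n
    i = (fromℕ (suc n !)) ⁻¹
    d+1+m : fromℕ (d ℕ.+ 1 ℕ.+ m) ≈ D + 1# + M
    d+1+m = trans (fromℕ-+ (d ℕ.+ 1) m) (+-congʳ (trans (fromℕ-+ d 1) (+-congˡ fromℕ-1)))
    c+d+m : fromℕ n ≈ C + D + M
    c+d+m = trans (fromℕ-+ (c ℕ.+ d) m) (+-congʳ (fromℕ-+ c d))

  -- I M φ w sums φ over all ways of inserting the letter M into w, and T M φ w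
  -- over those with only smaller letters after the inserted one.
  I T : ℕ → (Word → Carrier) → Word → Carrier
  I M φ []      = φ [ M ]
  I M φ (y ∷ w) = φ (M ∷ y ∷ w) + I M (φ ∘ (y ∷_)) w
  T M φ []      = φ [ M ]
  T M φ (y ∷ w) = indicator (All.all? (ℕ._<? M) (y ∷ w)) * φ (M ∷ y ∷ w) + T M (φ ∘ (y ∷_)) w

  ∑-insertions : ∀ M w φ → ∑ (insertions M w) φ ≈ I M φ w
  ∑-insertions M []      φ = +-identityʳ _
  ∑-insertions M (y ∷ w) φ = +-congˡ (trans (reflexive (∑-map (y ∷_) (insertions M w) φ)) (∑-insertions M w (φ ∘ (y ∷_))))

  insert-↭ : ∀ {M y} {w w′ : Word} → w′ ↭ M ∷ w → y ∷ w′ ↭ M ∷ y ∷ w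
  insert-↭ {M} {y} p = ↭-trans (prep y p) (swap y M ↭-refl)

  I-cong : ∀ M w {φ ψ} → (∀ w′ → w′ ↭ M ∷ w → φ w′ ≈ ψ w′) → I M φ w ≈ I M ψ w
  I-cong M []      φ≈ψ = φ≈ψ _ ↭-refl
  I-cong M (y ∷ w) φ≈ψ = +-cong (φ≈ψ _ ↭-refl) (I-cong M w (λ w′ p → φ≈ψ (y ∷ w′) (insert-↭ p)))

  T-cong : ∀ M w {φ ψ} → (∀ w′ → w′ ↭ M ∷ w → φ w′ ≈ ψ w′) → T M φ w ≈ T M ψ w
  T-cong M []      φ≈ψ = φ≈ψ _ ↭-refl
  T-cong M (y ∷ w) φ≈ψ = +-cong (*-congˡ (φ≈ψ _ ↭-refl)) (T-cong M w (λ w′ p → φ≈ψ (y ∷ w′) (insert-↭ p)))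

  T-+ : ∀ M w φ ψ → T M (λ u → φ u + ψ u) w ≈ T M φ w + T M ψ w
  T-+ M []      φ ψ = refl
  T-+ M (y ∷ w) φ ψ = trans (+-congˡ (T-+ M w _ _))
    (solve 5 (λ i a b c d → i :* (a :+ b) :+ (c :+ d) := i :* a :+ c :+ (i :* b :+ d)) refl _ _ _ _ _)

  T-* : ∀ M w c φ → T M (λ u → c * φ u) w ≈ c * T M φ w
  T-* M []      c φ = refl
  T-* M (y ∷ w) c φ = trans (+-congˡ (T-* M w c _))
    (solve 4 (λ i c a b → i :* (c :* a) :+ c :* b := c :* (i :* a :+ b)) refl _ _ _ _)

  T≈I : ∀ M w φ → All (_< M) w → T M φ w ≈ I M φ w
  T≈I M []      φ w<M            = refl
  T≈I M (y ∷ w) φ w<M@(_ ∷ w<M′) = +-cong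
    (indicator-*-yes (All.all? (ℕ._<? M) (y ∷ w)) w<M)
    (T≈I M w _ w<M′)

  ¬All< : ∀ {M y w w′} → w′ ↭ M ∷ w → ¬ All (_< M) (y ∷ w′)
  ¬All< p (_ ∷ w′<M) = ℕ.<-irrefl ≡.refl (All.lookup w′<M (∈-resp-↭ (↭-sym p) (here ≡.refl)))

  -- Two copies of M are inserted, the first of them with only smaller letters
  -- of w after it.  The second copy then comes before the first or after it.
  T-I-commute : ∀ M w φ → T M (I M φ) w ≈ I M (T M φ) w + T M (T M φ) w
  T-I-commute M []      φ = +-cong
    (sym (trans (+-congʳ (indicator-*-no (All.all? (ℕ._<? M) [ M ]) ¬All<M)) (+-identityˡ _)))
    (sym (trans (+-congʳ (indicator-*-no (All.all? (ℕ._<? M) [ M ]) ¬All<M)) (+-identityˡ _)))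
    where
    ¬All<M : ¬ All (_< M) [ M ]
    ¬All<M (M<M ∷ _) = ℕ.<-irrefl ≡.refl M<M
  T-I-commute M (y ∷ w) φ = begin
    c * (φ (M ∷ M ∷ y ∷ w) + I M (φ ∘ (M ∷_)) (y ∷ w)) + T M (λ u → φ (M ∷ y ∷ u) + I M (φ ∘ (y ∷_)) u) w
      ≈⟨ +-cong (trans (distribˡ _ _ _) (+-congˡ c*I≈c*T))
                (trans (T-+ M w _ _) (+-congˡ (T-I-commute M w (φ ∘ (y ∷_))))) ⟩
    c * φ (M ∷ M ∷ y ∷ w) + c * T M (φ ∘ (M ∷_)) (y ∷ w) +
      (T M (λ u → φ (M ∷ y ∷ u)) w + (I M (T M (φ ∘ (y ∷_))) w + T M (T M (φ ∘ (y ∷_))) w))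
      ≈⟨ solve 5 (λ a b d e f → a :+ b :+ (d :+ (e :+ f)) := (a :+ d :+ e) :+ (b :+ f)) refl _ _ _ _ _ ⟩
    (T M (φ ∘ (M ∷_)) (y ∷ w) + I M (T M (φ ∘ (y ∷_))) w) +
      (c * T M (φ ∘ (M ∷_)) (y ∷ w) + T M (T M (φ ∘ (y ∷_))) w)
      ≈⟨ +-cong (+-cong first (I-cong M w drop-first)) (+-cong (*-congˡ first) (T-cong M w drop-first)) ⟨
    I M (T M φ) (y ∷ w) + T M (T M φ) (y ∷ w) ∎
    where
    c = indicator (All.all? (ℕ._<? M) (y ∷ w))
    c*I≈c*T : c * I M (φ ∘ (M ∷_)) (y ∷ w) ≈ c * T M (φ ∘ (M ∷_)) (y ∷ w)
    c*I≈c*T = indicator-*-cong (All.all? (ℕ._<? M) (y ∷ w)) (λ w<M → sym (T≈I M (y ∷ w) (φ ∘ (M ∷_)) w<M))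
    first : T M φ (M ∷ y ∷ w) ≈ T M (φ ∘ (M ∷_)) (y ∷ w)
    first = trans (+-congʳ (indicator-*-no (All.all? (ℕ._<? M) (M ∷ y ∷ w))
      (λ { (M<M ∷ _) → ℕ.<-irrefl ≡.refl M<M }))) (+-identityˡ _)
    -- The word `w′` already contains `M`, so `T` cannot insert another `M` in front of it.
    drop-first : ∀ w′ → w′ ↭ M ∷ w → T M φ (y ∷ w′) ≈ T M (φ ∘ (y ∷_)) w′
    drop-first w′ p = trans (+-congʳ (indicator-*-no (All.all? (ℕ._<? M) (y ∷ w′)) (¬All< p)))
      (+-identityˡ _)

  -- The letters of `L` are inserted from left to right. If `L` increases weakly and the initial
  -- word is empty, each rearrangement of `L` arises exactly once, since a new copy of a letter has
  -- to go behind the copies already present.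
  T* : Word → (Word → Carrier) → Word → Carrier
  T* L φ = foldr T φ L

  T*-cong : ∀ L w {φ ψ} → (∀ w′ → w′ ↭ L ++ w → φ w′ ≈ ψ w′) → T* L φ w ≈ T* L ψ w
  T*-cong []      w φ≈ψ = φ≈ψ w ↭-refl
  T*-cong (M ∷ L) w φ≈ψ = T-cong M w (λ w′ p → T*-cong L w′ (λ w″ q →
    φ≈ψ w″ (↭-trans q (↭-trans (++⁺ˡ L p) (shift M L w)))))

  T*-+ : ∀ L w φ ψ → T* L (λ u → φ u + ψ u) w ≈ T* L φ w + T* L ψ w
  T*-+ []      w φ ψ = refl
  T*-+ (M ∷ L) w φ ψ = trans (T-cong M w (λ w′ _ → T*-+ L w′ φ ψ)) (T-+ M w _ _)

  T*-* : ∀ L w c φ → T* L (λ u → c * φ u) w ≈ c * T* L φ w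
  T*-* []      w c φ = refl
  T*-* (M ∷ L) w c φ = trans (T-cong M w (λ w′ _ → T*-* L w′ c φ)) (T-* M w c _)

  -- `foldr` exposes the first insertion, whereas `T*-I` commutes the last one; with equal letters
  -- the list can be peeled off at either end.
  T*-replicate-suc : ∀ m M φ → T* (replicate (suc m) M) φ ≡ T* (replicate m M) (T M φ)
  T*-replicate-suc zero    M φ = ≡.refl
  T*-replicate-suc (suc m) M φ = cong (T M) (T*-replicate-suc m M φ)

  -- Marking one of m + 1 copies of M amounts to inserting it.
  T*-I : ∀ m M w φ → All (_< M) w →
    T* (replicate m M) (I M φ) w ≈ fromℕ (suc m) * T* (replicate (suc m) M) φ w
  T*-I zero    M w φ w<M = sym (trans (*-congʳ fromℕ-1) (trans (*-identityˡ _) (T≈I M w φ w<M)))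
  T*-I (suc m) M w φ w<M = begin
    T* (replicate (suc m) M) (I M φ) w
      ≈⟨ reflexive (cong (λ f → f w) (T*-replicate-suc m M (I M φ))) ⟩
    T* (replicate m M) (T M (I M φ)) w
      ≈⟨ T*-cong (replicate m M) w (λ w′ _ → T-I-commute M w′ φ) ⟩
    T* (replicate m M) (λ u → I M (T M φ) u + T M (T M φ) u) w
      ≈⟨ T*-+ (replicate m M) w _ _ ⟩
    T* (replicate m M) (I M (T M φ)) w + T* (replicate m M) (T M (T M φ)) w
      ≈⟨ +-cong (T*-I m M w (T M φ) w<M) (reflexive (cong (λ f → f w) (≡.sym (T*-replicate-suc m M (T M φ))))) ⟩
    fromℕ (suc m) * T* (replicate (suc m) M) (T M φ) w + T* (replicate (suc m) M) (T M φ) w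
      ≈⟨ trans (+-congˡ (sym (*-identityˡ _))) (trans (sym (distribʳ _ _ _)) (*-congʳ (+-comm _ _))) ⟩
    fromℕ (suc (suc m)) * T* (replicate (suc m) M) (T M φ) w
      ≈⟨ *-congˡ (reflexive (cong (λ f → f w) (≡.sym (T*-replicate-suc (suc m) M φ)))) ⟩
    fromℕ (suc (suc m)) * T* (replicate (suc (suc m)) M) φ w ∎

  -- A letter `M` that no other letter exceeds leaves the number of descents unchanged when put into
  -- a descent, at the end, or directly before another `M`: these are the d + 1 + m places. At each
  -- of the c remaining places it adds one descent. The letter `y` in front makes the first place
  -- like all others, and c comes with an equation instead of a subtraction.
  I-des-after : ∀ M y w → y ≤ M → All (_≤ M) w →
    let d = des (y ∷ w) ; m = occurrences M w in
    Σ[ c ∈ ℕ ] (c ℕ.+ d ℕ.+ m ≡ length w ×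
      (∀ (ψ : ℕ → Carrier) → I M (λ u → ψ (des (y ∷ u))) w ≈ fromℕ (d ℕ.+ 1 ℕ.+ m) * ψ d + fromℕ c * ψ (suc d)))
  I-des-after M y []      y≤M w≤M = 0 , ≡.refl , λ ψ →
    trans (reflexive (cong ψ (des-∷-≮ [] (ℕ.≤⇒≯ y≤M))))
      (sym (trans (+-cong (trans (*-congʳ fromℕ-1) (*-identityˡ _)) (zeroˡ _)) (+-identityʳ _)))
  I-des-after M y (h ∷ t) y≤M (h≤M ∷ t≤M) with I-des-after M h t h≤M t≤M
  ... | c , len , sum with h ℕ.<ᵇ y | ℕ.<ᵇ-reflects-< h y
  ...   | true | ofʸ h<y rewrite occurrences-∷-≢ t (ℕ.<⇒≢ (ℕ.<-≤-trans h<y y≤M)) =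
    c , ≡.trans (cong (ℕ._+ occurrences M t) (ℕ.+-suc c (des (h ∷ t)))) (cong suc len) , λ ψ → begin
      ψ (des (y ∷ M ∷ h ∷ t)) + I M (λ u → ψ (suc (des (h ∷ u)))) t
        ≈⟨ +-cong (reflexive (cong ψ (≡.trans (des-∷-≮ (h ∷ t) (ℕ.≤⇒≯ y≤M)) (des-∷-< t (ℕ.<-≤-trans h<y y≤M)))))
            (sum (ψ ∘ suc)) ⟩
      ψ (suc d) + (fromℕ (d ℕ.+ 1 ℕ.+ m) * ψ (suc d) + fromℕ c * ψ (suc (suc d)))
        ≈⟨ trans (+-congʳ (sym (*-identityˡ _))) (trans (sym (+-assoc _ _ _)) (+-congʳ (sym (distribʳ _ _ _)))) ⟩
      fromℕ (suc d ℕ.+ 1 ℕ.+ m) * ψ (suc d) + fromℕ c * ψ (suc (suc d)) ∎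
    where
    d = des (h ∷ t)
    m = occurrences M t
  ...   | false | ofⁿ h≮y with h ℕ.≟ M
  ...     | yes ≡.refl rewrite occurrences-∷-≡ h t =
    c , ≡.trans (ℕ.+-suc (c ℕ.+ des (h ∷ t)) (occurrences h t)) (cong suc len) , λ ψ → begin
      ψ (des (y ∷ h ∷ h ∷ t)) + I h (λ u → ψ (des (h ∷ u))) t
        ≈⟨ +-cong (reflexive (cong ψ (≡.trans (des-∷-≮ (h ∷ t) h≮y) (des-∷-≮ t (ℕ.<-irrefl ≡.refl))))) (sum ψ) ⟩
      ψ d + (fromℕ (d ℕ.+ 1 ℕ.+ m) * ψ d + fromℕ c * ψ (suc d))
        ≈⟨ trans (+-congʳ (sym (*-identityˡ _))) (trans (sym (+-assoc _ _ _)) (+-congʳ (sym (distribʳ _ _ _)))) ⟩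
      fromℕ (suc (d ℕ.+ 1 ℕ.+ m)) * ψ d + fromℕ c * ψ (suc d)
        ≈⟨ +-congʳ (*-congʳ (fromℕ-cong (≡.sym (ℕ.+-suc (d ℕ.+ 1) m)))) ⟩
      fromℕ (d ℕ.+ 1 ℕ.+ suc m) * ψ d + fromℕ c * ψ (suc d) ∎
    where
    d = des (h ∷ t)
    m = occurrences h t
  ...     | no h≢M rewrite occurrences-∷-≢ t h≢M =
    suc c , cong suc len , λ ψ → begin
      ψ (des (y ∷ M ∷ h ∷ t)) + I M (λ u → ψ (des (h ∷ u))) t
        ≈⟨ +-cong (reflexive (cong ψ (≡.trans (des-∷-≮ (h ∷ t) (ℕ.≤⇒≯ y≤M)) (des-∷-< t (ℕ.≤∧≢⇒< h≤M h≢M))))) (sum ψ) ⟩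
      ψ (suc d) + (fromℕ (d ℕ.+ 1 ℕ.+ m) * ψ d + fromℕ c * ψ (suc d))
        ≈⟨ trans (+-congʳ (sym (*-identityˡ _))) (solve 4 (λ u a b c → u :* a :+ (b :+ c :* a) := b :+ (u :+ c) :* a) refl 1#
            (ψ (suc d)) _ (fromℕ c)) ⟩
      fromℕ (d ℕ.+ 1 ℕ.+ m) * ψ d + fromℕ (suc c) * ψ (suc d) ∎
    where
    d = des (h ∷ t)
    m = occurrences M t

  des-0∷ : ∀ w → des (0 ∷ w) ≡ des w
  des-0∷ []      = ≡.refl
  des-0∷ (x ∷ w) = ≡.refl

  -- A leading 0 creates no descent, so `I-des-after` also covers insertion at the front. It
  -- supplies the two terms of `worpitzky` for q = α - 1 - d.
  I-weight : ∀ M w → All (_≤ M) w → I M weight w ≈ (α + fromℕ (occurrences M w)) * weight w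
  I-weight M w w≤M with I-des-after M 0 w z≤n w≤M
  ... | c , len , sum = begin
    I M weight w
      ≈⟨ I-cong M w (λ w′ p → reflexive (cong₂ (λ l d′ → binomial (α + fromℕ l - 1# - fromℕ d′) l) (↭-length p)
          (≡.sym (des-0∷ w′)))) ⟩
    I M (λ u → ψ (des (0 ∷ u))) w
      ≈⟨ sum ψ ⟩
    fromℕ (d ℕ.+ 1 ℕ.+ m) * ψ d + fromℕ c * ψ (suc d)
      ≈⟨ +-cong (*-congˡ (binomial-cong (suc n) arg₁)) (*-congˡ (binomial-cong (suc n) arg₂)) ⟩
    fromℕ (d ℕ.+ 1 ℕ.+ m) * binomial (q + fromℕ n + 1#) (suc n) + fromℕ c * binomial (q + fromℕ n) (suc n)
      ≈⟨ ≡.subst (λ n → fromℕ (d ℕ.+ 1 ℕ.+ m) * binomial (q + fromℕ n + 1#) (suc n) + fromℕ c * binomial (q + fromℕ n) (suc n)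
                   ≈ (q + 1# + fromℕ d + fromℕ m) * binomial (q + fromℕ n) n) len (worpitzky q d m c) ⟩
    (q + 1# + fromℕ d + fromℕ m) * binomial (q + fromℕ n) n
      ≈⟨ *-cong (+-congʳ α≈) (trans (binomial-cong n arg₃) (reflexive (cong (λ d → binomial (α + fromℕ n - 1# - fromℕ d) n)
          (des-0∷ w)))) ⟩
    (α + fromℕ m) * weight w ∎
    where
    d = des (0 ∷ w)
    m = occurrences M w
    n = length w
    q = α - 1# - fromℕ d
    ψ : ℕ → Carrier
    ψ e = binomial (α + fromℕ (suc n) - 1# - fromℕ e) (suc n)
    arg₁ : α + fromℕ (suc n) - 1# - fromℕ d ≈ q + fromℕ n + 1#
    arg₁ = solve 5 (λ a u n v e → a :+ (u :+ n) :+ v :+ e := a :+ v :+ e :+ n :+ u) refl α 1# (fromℕ n) (- 1#) (- fromℕ d)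
    arg₂ : α + fromℕ (suc n) - 1# - fromℕ (suc d) ≈ q + fromℕ n
    arg₂ = begin
      α + (1# + fromℕ n) - 1# - fromℕ (suc d)
        ≈⟨ +-congˡ (-‿+-comm 1# (fromℕ d)) ⟨
      α + (1# + fromℕ n) - 1# + (- 1# - fromℕ d)
        ≈⟨ solve 5 (λ a u n v e → a :+ (u :+ n) :+ v :+ (v :+ e) := a :+ v :+ e :+ n :+ (u :+ v)) refl α 1# (fromℕ n) (- 1#)
            (- fromℕ d) ⟩
      q + fromℕ n + (1# - 1#)
        ≈⟨ trans (+-congˡ (-‿inverseʳ 1#)) (+-identityʳ _) ⟩
      q + fromℕ n ∎
    arg₃ : q + fromℕ n ≈ α + fromℕ n - 1# - fromℕ d
    arg₃ = solve 4 (λ a n v e → a :+ v :+ e :+ n := a :+ n :+ v :+ e) refl α (fromℕ n) (- 1#) (- fromℕ d)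
    α≈ : q + 1# + fromℕ d ≈ α
    α≈ = begin
      q + 1# + fromℕ d
        ≈⟨ solve 5 (λ a v e u d → a :+ v :+ e :+ u :+ d := a :+ v :+ u :+ e :+ d) refl α (- 1#) (- fromℕ d) 1# (fromℕ d) ⟩
      α - 1# + 1# - fromℕ d + fromℕ d ≈⟨ x-y+y≈x _ _ ⟩
      α - 1# + 1#                 ≈⟨ x-y+y≈x _ _ ⟩
      α                           ∎

  occurrences-replicate-++ : ∀ m M w → All (_< M) w → occurrences M (replicate m M ++ w) ≡ m
  occurrences-replicate-++ zero    M w w<M = cong length (filter-none (ℕ._≟ M) (All.map ℕ.<⇒≢ w<M))
  occurrences-replicate-++ (suc m) M w w<M = ≡.trans (occurrences-∷-≡ M _) (cong suc (occurrences-replicate-++ m M w w<M))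

  T*-replicate-weight : ∀ m M w → All (_< M) w → T* (replicate m M) weight w ≈ rising m * weight w
  T*-replicate-weight zero    M w w<M = sym (trans (*-congʳ rising-0) (*-identityˡ _))
  T*-replicate-weight (suc m) M w w<M = *-cancelˡ (fromℕ (suc m)) (fromℕ≉0 (suc m) (s≤s z≤n)) (begin
    fromℕ (suc m) * T* (replicate (suc m) M) weight w
      ≈⟨ T*-I m M w weight w<M ⟨
    T* (replicate m M) (I M weight) w
      ≈⟨ T*-cong (replicate m M) w (λ w′ p → trans (I-weight M w′ (w′≤M w′ p))
          (*-congʳ (+-congˡ (fromℕ-cong (≡.trans (occurrences-↭ M p) (occurrences-replicate-++ m M w w<M)))))) ⟩
    T* (replicate m M) (λ u → (α + fromℕ m) * weight u) w
      ≈⟨ T*-* (replicate m M) w _ _ ⟩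
    (α + fromℕ m) * T* (replicate m M) weight w
      ≈⟨ *-congˡ (T*-replicate-weight m M w w<M) ⟩
    (α + fromℕ m) * (rising m * weight w)
      ≈⟨ trans (sym (*-assoc _ _ _)) (trans (*-congʳ (sym (rising-suc m))) (*-assoc _ _ _)) ⟩
    fromℕ (suc m) * (rising (suc m) * weight w) ∎)
    where
    w′≤M : ∀ w′ → w′ ↭ replicate m M ++ w → All (_≤ M) w′
    w′≤M w′ p = All-resp-↭ (↭-sym p) (All.++⁺ (All.replicate⁺ m ℕ.≤-refl) (All.map ℕ.<⇒≤ w<M))

  T*-spread-weight : ∀ i e w → All (_< i) w → T* (spread i e) weight w ≈ ∏ e rising * weight w
  T*-spread-weight i []      w w<i = sym (*-identityˡ _)
  T*-spread-weight i (k ∷ e) w w<i = begin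
    T* (replicate k i ++ spread (suc i) e) weight w
      ≈⟨ reflexive (cong (λ f → f w) (foldr-++ T weight (replicate k i) _)) ⟩
    T* (replicate k i) (T* (spread (suc i) e) weight) w
      ≈⟨ T*-cong (replicate k i) w (λ w′ p → T*-spread-weight (suc i) e w′
           (All-resp-↭ (↭-sym p) (All.++⁺ (All.replicate⁺ k (ℕ.n<1+n i)) (All.map ℕ.m<n⇒m<1+n w<i)))) ⟩
    T* (replicate k i) (λ u → ∏ e rising * weight u) w
      ≈⟨ T*-* (replicate k i) w _ _ ⟩
    ∏ e rising * T* (replicate k i) weight w
      ≈⟨ *-congˡ (T*-replicate-weight k i w w<i) ⟩
    ∏ e rising * (rising k * weight w)
      ≈⟨ solve 3 (λ a b c → a :* (b :* c) := b :* a :* c) refl _ _ _ ⟩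
    ∏ (k ∷ e) rising * weight w ∎

-- Permutations: letters, positions and inversions.

insertions-↭ : ∀ x w {w′} → w′ ∈ insertions x w → w′ ↭ x ∷ w
insertions-↭ x []      (here ≡.refl) = ↭-refl
insertions-↭ x (y ∷ w) (here ≡.refl) = ↭-refl
insertions-↭ x (y ∷ w) (there w′∈) with ∈-map⁻ (y ∷_) w′∈
... | u , u∈ , ≡.refl = ↭-trans (prep y (insertions-↭ x w u∈)) (swap y x ↭-refl)

S-↭ : ∀ n {π} → π ∈ S n → π ↭ applyUpTo suc n
S-↭ zero    (here ≡.refl) = ↭-refl
S-↭ (suc n) π∈ with ∈-concatMap⁻′ (insertions (suc n)) (S n) π∈
  where
  ∈-concatMap⁻′ : ∀ (f : Word → List Word) xs {y} → y ∈ concatMap f xs → ∃ λ x → x ∈ xs × y ∈ f x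
  ∈-concatMap⁻′ f (x ∷ xs) y∈ with ∈-++⁻ (f x) y∈
  ... | inj₁ y∈fx = x , here ≡.refl , y∈fx
  ... | inj₂ y∈′ with ∈-concatMap⁻′ f xs y∈′
  ...   | z , z∈ , y∈fz = z , there z∈ , y∈fz
... | σ , σ∈ , π∈σ = ↭-trans (insertions-↭ (suc n) σ π∈σ) (↭-trans (prep (suc n) (S-↭ n σ∈))
  (↭-trans (∷↭∷ʳ (suc n) (applyUpTo suc n)) (↭-reflexive (applyUpTo-∷ʳ suc n))))

module _ {n π} (π∈S : π ∈ S n) where

  S-unique : Unique π
  S-unique = PermSetoid.Unique-resp-↭ (≡.setoid ℕ) (↭⇒↭ₛ (↭-sym (S-↭ n π∈S)))
    (Unique.applyUpTo⁺₁ suc n (λ i<j _ → ℕ.<⇒≢ i<j ∘ ℕ.suc-injective))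

  S-∈ : ∀ {j} → 1 ≤ j → j ≤ n → j ∈ π
  S-∈ {suc j} _ j<n = ∈-resp-↭ (↭-sym (S-↭ n π∈S)) (∈-applyUpTo⁺ suc j<n)

  S-bounded : All (λ j → 1 ≤ j × j ≤ n) π
  S-bounded = All-resp-↭ (↭-sym (S-↭ n π∈S)) (All.applyUpTo⁺₁ suc n (λ i<n → s≤s z≤n , i<n))

  S-length : length π ≡ n
  S-length = ≡.trans (↭-length (S-↭ n π∈S)) (length-applyUpTo′ suc n)
    where
    length-applyUpTo′ : ∀ (f : ℕ → ℕ) n → length (applyUpTo f n) ≡ n
    length-applyUpTo′ f zero    = ≡.refl
    length-applyUpTo′ f (suc n) = cong suc (length-applyUpTo′ (f ∘ suc) n)

-- On a permutation this is the inverse permutation, with places counted from 0.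
position : ℕ → Word → ℕ
position a []      = 0
position a (x ∷ w) = if does (a ℕ.≟ x) then 0 else suc (position a w)

position-head : ∀ a w → position a (a ∷ w) ≡ 0
position-head a w = cong (if_then 0 else suc (position a w)) (dec-true (a ℕ.≟ a) ≡.refl)

position-tail : ∀ {a x} w → a ≢ x → position a (x ∷ w) ≡ suc (position a w)
position-tail {a} {x} w a≢x = cong (if_then 0 else suc (position a w)) (dec-false (a ℕ.≟ x) a≢x)

module _ {R : ℕ → ℕ → Set} where

  -- `AllPairs` runs through the places of a word, whereas the descents of `P π` compare the places
  -- of given values. This lemma and its converse translate; the converse asks for distinct letters
  -- because `position` finds only the first occurrence.
  AllPairs⇒position : ∀ {w} → AllPairs R w → ∀ {a b} → a ∈ w → b ∈ w → position a w < position b w → R a b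
  AllPairs⇒position {x ∷ w} (Rx ∷ Rw) {a} {b} a∈ b∈ a<b with b ℕ.≟ x
  ... | yes ≡.refl = contradiction (subst (position a (b ∷ w) <_) (position-head b w) a<b) ℕ.n≮0
  ... | no b≢x with b∈
  ...   | here ≡.refl = contradiction ≡.refl b≢x
  ...   | there b∈w with a ℕ.≟ x
  ...     | yes ≡.refl = All.lookup Rx b∈w
  ...     | no a≢x with a∈
  ...       | here ≡.refl = contradiction ≡.refl a≢x
  ...       | there a∈w   = AllPairs⇒position Rw a∈w b∈w
    (ℕ.≤-pred (≡.subst₂ _<_ (position-tail w a≢x) (position-tail w b≢x) a<b))

  position⇒AllPairs : ∀ {w} → Unique w → (∀ {a b} → a ∈ w → b ∈ w → position a w < position b w → R a b) → AllPairs R w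
  position⇒AllPairs {[]}    []        h = []
  position⇒AllPairs {x ∷ w} (x∉ ∷ u) h =
    All.tabulate (λ {b} b∈ → h (here ≡.refl) (there b∈)
      (≡.subst₂ _<_ (≡.sym (position-head x w)) (≡.sym (position-tail w (x≢ b∈ ∘ ≡.sym))) (s≤s z≤n))) ∷
    position⇒AllPairs u (λ a∈ b∈ a<b → h (there a∈) (there b∈)
      (≡.subst₂ _<_ (≡.sym (position-tail w (x≢ a∈ ∘ ≡.sym))) (≡.sym (position-tail w (x≢ b∈ ∘ ≡.sym))) (s≤s a<b)))
    where
    x≢ : ∀ {b} → b ∈ w → x ≢ b
    x≢ = All.lookup x∉

-- A discrete intermediate value argument: if x > y but x comes before y,
-- then some j + 1 comes before j with y ≤ j < x.
adjacent-inversion : ∀ (π : Word) (ι : ℕ → ℕ) n →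
  (∀ j → 1 ≤ j → suc j ≤ n → ι j ≤ ι (suc j)) →
  (∀ j → 1 ≤ j → suc j ≤ n → position (suc j) π < position j π → ι j < ι (suc j)) →
  ∀ x y → 1 ≤ y → y < x → x ≤ n → position x π < position y π → ι y < ι x
adjacent-inversion π ι n mono adj (suc x) y 1≤y (s≤s y≤x) x<n x<y with ℕ.m≤n⇒m<n∨m≡n y≤x
... | inj₂ ≡.refl = adj y 1≤y x<n x<y
-- If `suc x` does not precede `x`, then `x` stands before `y` just as `suc x` does, and the
-- induction hypothesis applies to `x`.
... | inj₁ y<x with position (suc x) π ℕ.<? position x π
...   | yes p = ℕ.≤-<-trans (ι-mono y<x (ℕ.<⇒≤ x<n)) (adj x (ℕ.≤-trans 1≤y y≤x) x<n p)
  where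
  ι-mono : ∀ {z} → y < z → z ≤ n → ι y ≤ ι z
  ι-mono {suc z} (s≤s y≤z) z<n with ℕ.m≤n⇒m<n∨m≡n y≤z
  ... | inj₂ ≡.refl = mono y 1≤y z<n
  ... | inj₁ y<z    = ℕ.≤-trans (ι-mono y<z (ℕ.<⇒≤ z<n)) (mono z (ℕ.≤-trans 1≤y y≤z) z<n)
...   | no ¬p = ℕ.<-≤-trans
  (adjacent-inversion π ι n mono adj x y 1≤y y<x (ℕ.<⇒≤ x<n) (ℕ.≤-<-trans (ℕ.≮⇒≥ ¬p) x<y))
  (mono x (ℕ.≤-trans 1≤y y≤x) x<n)

-- Row insertion

-- The graph of `rowInsert` on rows without `x`, exposing the split of the row that the recursion
-- hides. That `y` is the smallest entry above `x` follows from the sortedness of the row, in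
-- `Bump`.
data RowInsertion (x : ℕ) : List ℕ → List ℕ × Maybe ℕ → Set where
  appended : ∀ {r} → All (_< x) r → RowInsertion x r (r ++ [ x ] , nothing)
  bumped   : ∀ p {y} q → All (_< x) p → x < y → RowInsertion x (p ++ y ∷ q) (p ++ x ∷ q , just y)

rowInsertion : ∀ x r → x ∉ r → RowInsertion x r (rowInsert x r)
rowInsertion x []      x∉ = appended []
rowInsertion x (y ∷ r) x∉ with x ℕ.<? y | rowInsert x r | rowInsertion x r (x∉ ∘ there)
... | yes x<y | _ | _               = bumped [] r [] x<y
... | no x≮y  | _ | appended r<x    = appended (ℕ.≤∧≢⇒< (ℕ.≮⇒≥ x≮y) (λ y≡x → x∉ (here (≡.sym y≡x))) ∷ r<x)
... | no x≮y  | _ | bumped p q p<x x<z =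
  bumped (y ∷ p) q (ℕ.≤∧≢⇒< (ℕ.≮⇒≥ x≮y) (λ y≡x → x∉ (here (≡.sym y≡x))) ∷ p<x) x<z

Sorted : List ℕ → Set
Sorted = AllPairs _<_

sorted-∷ʳ : ∀ {r x} → Sorted r → All (_< x) r → Sorted (r ++ [ x ])
sorted-∷ʳ sr r<x = AllPairs.++⁺ sr ([] ∷ []) (All.map (_∷ []) r<x)

module Bump {p x y q} (sorted : Sorted (p ++ y ∷ q)) (p<x : All (_< x) p) (x<y : x < y) where

  private
    split : ∀ p {y q} → Sorted (p ++ y ∷ q) → Sorted p × All (_< y) p × Sorted q × All (y <_) q × All (λ a → All (a <_) q) p
    split []      (y< ∷ sq) = [] , [] , sq , y< , []
    split (a ∷ p) (a< ∷ s) with split p s | All.++⁻ʳ p a<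
    ... | sp , p<y , sq , y<q , p<q | a<y ∷ a<q = (All.++⁻ˡ p a< ∷ sp) , a<y ∷ p<y , sq , y<q , a<q ∷ p<q

  p<y : All (_< y) p
  p<y = proj₁ (proj₂ (split p sorted))

  y<q : All (y <_) q
  y<q = proj₁ (proj₂ (proj₂ (proj₂ (split p sorted))))

  new-sorted : Sorted (p ++ x ∷ q)
  new-sorted with split p sorted
  ... | sp , _ , sq , y<q , p<q = AllPairs.++⁺ sp (All.map (ℕ.<-trans x<y) y<q ∷ sq)
    (All.zipWith (λ (a<x , a<q) → a<x ∷ a<q) (p<x , p<q))

  new∋x : x ∈ p ++ x ∷ q
  new∋x = ∈-++⁺ʳ p (here ≡.refl)

  old∋y : y ∈ p ++ y ∷ q
  old∋y = ∈-++⁺ʳ p (here ≡.refl)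

  new∌y : y ∉ p ++ x ∷ q
  new∌y y∈ with ∈-++⁻ p y∈
  ... | inj₁ y∈p         = ℕ.<-irrefl ≡.refl (All.lookup p<y y∈p)
  ... | inj₂ (here y≡x)  = ℕ.<⇒≢ x<y (≡.sym y≡x)
  ... | inj₂ (there y∈q) = ℕ.<-irrefl ≡.refl (All.lookup y<q y∈q)

  old⇒new : ∀ {z} → z ≢ y → z ∈ p ++ y ∷ q → z ∈ p ++ x ∷ q
  old⇒new z≢y z∈ with ∈-++⁻ p z∈
  ... | inj₁ z∈p         = ∈-++⁺ˡ z∈p
  ... | inj₂ (here z≡y)  = contradiction z≡y z≢y
  ... | inj₂ (there z∈q) = ∈-++⁺ʳ p (there z∈q)

  new⇒old : ∀ {z} → z ≢ x → z ∈ p ++ x ∷ q → z ∈ p ++ y ∷ q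
  new⇒old z≢x z∈ with ∈-++⁻ p z∈
  ... | inj₁ z∈p         = ∈-++⁺ˡ z∈p
  ... | inj₂ (here z≡x)  = contradiction z≡x z≢x
  ... | inj₂ (there z∈q) = ∈-++⁺ʳ p (there z∈q)

  -- In an increasing row the entries below `y` stand in `p`, which the insertion passed over
  -- because they are smaller than `x`.
  <y⇒<x : ∀ {z} → z ∈ p ++ y ∷ q → z < y → z < x
  <y⇒<x z∈ z<y with ∈-++⁻ p z∈
  ... | inj₁ z∈p         = All.lookup p<x z∈p
  ... | inj₂ (here z≡y)  = contradiction z≡y (ℕ.<⇒≢ z<y)
  ... | inj₂ (there z∈q) = contradiction (All.lookup y<q z∈q) (ℕ.<⇒≯ z<y)

  x<new⇒y<new : ∀ {z} → z ∈ p ++ x ∷ q → x < z → y < z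
  x<new⇒y<new z∈ x<z with ∈-++⁻ p z∈
  ... | inj₁ z∈p         = contradiction (All.lookup p<x z∈p) (ℕ.<⇒≯ x<z)
  ... | inj₂ (here z≡x)  = contradiction (≡.sym z≡x) (ℕ.<⇒≢ x<z)
  ... | inj₂ (there z∈q) = All.lookup y<q z∈q

infix 4 _∈ₜ_ _∉ₜ_
_∈ₜ_ _∉ₜ_ : ℕ → Tableau → Set
z ∈ₜ T = z ∈ concat T
z ∉ₜ T = ¬ z ∈ₜ T

-- An invariant weaker than being a standard tableau: rows increase and no entry repeats. It
-- survives each insertion and suffices to follow descents.
data Wellformed : Tableau → Set where
  []  : Wellformed []
  row∷ : ∀ {r T} → Sorted r → (∀ {z} → z ∈ r → z ∉ₜ T) → Wellformed T → Wellformed (r ∷ T)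

rowOf-∈ : ∀ {i r} T → i ∈ r → rowOf i (r ∷ T) ≡ 0
rowOf-∈ {i} {r} T i∈ = cong (if_then 0 else suc (rowOf i T)) (dec-true (i ∈ℕ? r) i∈)

rowOf-∉ : ∀ {i r} T → i ∉ r → rowOf i (r ∷ T) ≡ suc (rowOf i T)
rowOf-∉ {i} {r} T i∉ = cong (if_then 0 else suc (rowOf i T)) (dec-false (i ∈ℕ? r) i∉)

∈-or-∉ : ∀ z (r : List ℕ) → z ∈ r ⊎ z ∉ r
∈-or-∉ z r with z ∈ℕ? r
... | yes z∈r = inj₁ z∈r
... | no z∉r  = inj₂ z∉r

∈-∷ʳ⁻ : ∀ {z x : ℕ} r → z ≢ x → z ∈ r ++ [ x ] → z ∈ r
∈-∷ʳ⁻ r z≢x z∈ with ∈-++⁻ r z∈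
... | inj₁ z∈r        = z∈r
... | inj₂ (here z≡x) = contradiction z≡x z≢x

insert-∈⁻ : ∀ T x {z} → Wellformed T → x ∉ₜ T → z ∈ₜ insert T x → z ≡ x ⊎ z ∈ₜ T
insert-∈⁻ []      x wf x∉ (here z≡x) = inj₁ z≡x
insert-∈⁻ (r ∷ T) x {z} (row∷ sr disj wf) x∉ z∈ with rowInsert x r | rowInsertion x r (x∉ ∘ ∈-++⁺ˡ)
... | _ | appended r<x with z ℕ.≟ x | ∈-++⁻ (r ++ [ x ]) z∈
...   | yes z≡x | _         = inj₁ z≡x
...   | no z≢x  | inj₁ z∈r′ = inj₂ (∈-++⁺ˡ (∈-∷ʳ⁻ r z≢x z∈r′))
...   | no _    | inj₂ z∈T  = inj₂ (∈-++⁺ʳ r z∈T)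
insert-∈⁻ (r ∷ T) x {z} (row∷ sr disj wf) x∉ z∈ | _ | bumped p {y} q p<x x<y with z ℕ.≟ x | ∈-++⁻ (p ++ x ∷ q) z∈
...   | yes z≡x | _         = inj₁ z≡x
...   | no z≢x  | inj₁ z∈r′ = inj₂ (∈-++⁺ˡ (Bump.new⇒old sr p<x x<y z≢x z∈r′))
...   | no _    | inj₂ z∈T′ with insert-∈⁻ T y wf (disj (Bump.old∋y sr p<x x<y)) z∈T′
...     | inj₁ ≡.refl = inj₂ (∈-++⁺ˡ (Bump.old∋y sr p<x x<y))
...     | inj₂ z∈T    = inj₂ (∈-++⁺ʳ (p ++ y ∷ q) z∈T)

insert-∋ : ∀ T x → Wellformed T → x ∉ₜ T → x ∈ₜ insert T x
insert-∋ []      x wf x∉ = here ≡.refl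
insert-∋ (r ∷ T) x (row∷ sr disj wf) x∉ with rowInsert x r | rowInsertion x r (x∉ ∘ ∈-++⁺ˡ)
... | _ | appended r<x        = ∈-++⁺ˡ (∈-++⁺ʳ r (here ≡.refl))
... | _ | bumped p q p<x x<y  = ∈-++⁺ˡ (Bump.new∋x sr p<x x<y)

insert-∈⁺ : ∀ T x {z} → Wellformed T → x ∉ₜ T → z ∈ₜ T → z ∈ₜ insert T x
insert-∈⁺ (r ∷ T) x {z} (row∷ sr disj wf) x∉ z∈ with rowInsert x r | rowInsertion x r (x∉ ∘ ∈-++⁺ˡ)
... | _ | appended r<x with ∈-++⁻ r z∈
...   | inj₁ z∈r = ∈-++⁺ˡ (∈-++⁺ˡ z∈r)
...   | inj₂ z∈T = ∈-++⁺ʳ (r ++ [ x ]) z∈T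
insert-∈⁺ (r ∷ T) x {z} (row∷ sr disj wf) x∉ z∈ | _ | bumped p {y} q p<x x<y with z ℕ.≟ y | ∈-++⁻ (p ++ y ∷ q) z∈
...   | yes ≡.refl | _ = ∈-++⁺ʳ (p ++ x ∷ q) (insert-∋ T y wf (disj (Bump.old∋y sr p<x x<y)))
...   | no z≢y | inj₁ z∈r = ∈-++⁺ˡ (Bump.old⇒new sr p<x x<y z≢y z∈r)
...   | no _   | inj₂ z∈T = ∈-++⁺ʳ (p ++ x ∷ q) (insert-∈⁺ T y wf (disj (Bump.old∋y sr p<x x<y)) z∈T)

insert-wellformed : ∀ T x → Wellformed T → x ∉ₜ T → Wellformed (insert T x)
insert-wellformed []      x wf x∉ = row∷ ([] ∷ []) (λ _ ()) []
insert-wellformed (r ∷ T) x (row∷ sr disj wf) x∉ with rowInsert x r | rowInsertion x r (x∉ ∘ ∈-++⁺ˡ)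
... | _ | appended r<x = row∷ (sorted-∷ʳ sr r<x) disj′ wf
  where
  disj′ : ∀ {z} → z ∈ r ++ [ x ] → z ∉ₜ T
  disj′ z∈ with ∈-++⁻ r z∈
  ... | inj₁ z∈r          = disj z∈r
  ... | inj₂ (here ≡.refl) = x∉ ∘ ∈-++⁺ʳ r
... | _ | bumped p {y} q p<x x<y = row∷ (Bump.new-sorted sr p<x x<y) disj′ (insert-wellformed T y wf y∉T)
  where
  y∉T = disj (Bump.old∋y sr p<x x<y)
  disj′ : ∀ {z} → z ∈ p ++ x ∷ q → z ∉ₜ insert T y
  disj′ {z} z∈ z∈T′ with insert-∈⁻ T y wf y∉T z∈T′
  ... | inj₁ ≡.refl = Bump.new∌y sr p<x x<y z∈
  ... | inj₂ z∈T with z ℕ.≟ x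
  ...   | yes ≡.refl = x∉ (∈-++⁺ʳ (p ++ y ∷ q) z∈T)
  ...   | no z≢x     = disj (Bump.new⇒old sr p<x x<y z≢x z∈) z∈T

Descent : ℕ → Tableau → Set
Descent i T = rowOf i T < rowOf (suc i) T

rowOf-insert : ∀ T x → Wellformed T → x ∉ₜ T → rowOf x (insert T x) ≡ 0
rowOf-insert []      x wf x∉ = rowOf-∈ {x} {[ x ]} [] (here ≡.refl)
rowOf-insert (r ∷ T) x (row∷ sr disj wf) x∉ with rowInsert x r | rowInsertion x r (x∉ ∘ ∈-++⁺ˡ)
... | _ | appended r<x           = rowOf-∈ T (∈-++⁺ʳ r (here ≡.refl))
... | _ | bumped p {y} q p<x x<y = rowOf-∈ (insert T y) (Bump.new∋x sr p<x x<y)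

-- The new `i` ends up in the bottom row, and `suc i` is not beside it. If `i` is appended, the
-- other entries of the row are smaller; if it bumps and `suc i` was in the row, then `suc i`, the
-- least possible entry above `i`, is the one bumped.
insert-smaller : ∀ T i → Wellformed T → i ∉ₜ T → suc i ∈ₜ T → Descent i (insert T i)
insert-smaller T i wf i∉ si∈ rewrite rowOf-insert T i wf i∉ = raised T wf i∉ si∈
  where
  raised : ∀ T → Wellformed T → i ∉ₜ T → suc i ∈ₜ T → 0 < rowOf (suc i) (insert T i)
  raised (r ∷ T) (row∷ sr disj wf) i∉ si∈ with rowInsert i r | rowInsertion i r (i∉ ∘ ∈-++⁺ˡ)
  ... | _ | appended r<i rewrite rowOf-∉ {suc i} {r ++ [ i ]} T
              (λ si∈r′ → ℕ.<⇒≯ (All.lookup r<i (∈-∷ʳ⁻ r (ℕ.>⇒≢ (ℕ.n<1+n i)) si∈r′)) (ℕ.n<1+n i)) = s≤s z≤n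
  ... | _ | bumped p {y} q p<i i<y rewrite rowOf-∉ {suc i} {p ++ i ∷ q} (insert T y)
              (λ si∈r′ → ℕ.<⇒≱ (Bump.x<new⇒y<new sr p<i i<y si∈r′ (ℕ.n<1+n i)) i<y) = s≤s z≤n

insert-larger : ∀ T i → Wellformed T → suc i ∉ₜ T → ¬ Descent i (insert T (suc i))
insert-larger T i wf si∉ rewrite rowOf-insert T (suc i) wf si∉ = λ ()

-- Induction along the bumping route. While `i` and `suc i` share the row, `suc i` stays, so there
-- is no descent before or after. If just one of them is in the row and gets bumped,
-- `insert-smaller` or `insert-larger` applies to the rows above; if neither is, the bumped `y`
-- differs from both or the row is plainly extended.
insert-descent : ∀ T x i → Wellformed T → x ∉ₜ T → i ∈ₜ T → suc i ∈ₜ T →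
  (Descent i (insert T x) → Descent i T) × (Descent i T → Descent i (insert T x))
insert-descent (r ∷ T) x i (row∷ sr disj wf) x∉ i∈ si∈ with i ℕ.≟ x | suc i ℕ.≟ x | rowInsert x r | rowInsertion x r
    (x∉ ∘ ∈-++⁺ˡ)
... | yes ≡.refl | _ | _ | _ = contradiction i∈ x∉
... | no _ | yes ≡.refl | _ | _ = contradiction si∈ x∉
... | no i≢x | no si≢x | _ | appended r<x =
  ≡.subst₂ _<_ (same i≢x) (same si≢x) , ≡.subst₂ _<_ (≡.sym (same i≢x)) (≡.sym (same si≢x))
  where
  same : ∀ {z} → z ≢ x → rowOf z ((r ++ [ x ]) ∷ T) ≡ rowOf z (r ∷ T)
  same {z} z≢x with ∈-or-∉ z r
  ... | inj₁ z∈r = ≡.trans (rowOf-∈ T (∈-++⁺ˡ z∈r)) (≡.sym (rowOf-∈ T z∈r))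
  ... | inj₂ z∉r = ≡.trans (rowOf-∉ T (z∉r ∘ ∈-∷ʳ⁻ r z≢x)) (≡.sym (rowOf-∉ T z∉r))
... | no i≢x | no si≢x | _ | bumped p {y} q p<x x<y with ∈-or-∉ i (p ++ y ∷ q) | ∈-or-∉ (suc i) (p ++ y ∷ q)
-- Bumping `suc i` would require i < x < suc i.
...   | inj₁ i∈r | inj₁ si∈r
  rewrite rowOf-∈ {suc i} T si∈r | rowOf-∈ {suc i} (insert T y) (Bump.old⇒new sr p<x x<y
      (λ si≡y → ℕ.<⇒≱ (subst (x <_) (≡.sym si≡y) x<y) (Bump.<y⇒<x sr p<x x<y i∈r (ℕ.≤-reflexive si≡y))) si∈r) = (λ ()) , (λ ())
...   | inj₁ i∈r | inj₂ si∉r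
  rewrite rowOf-∈ {i} T i∈r | rowOf-∉ {suc i} T si∉r | rowOf-∉ {suc i} (insert T y) (si∉r ∘ Bump.new⇒old sr p<x x<y si≢x) =
  (λ _ → s≤s z≤n) , λ _ → descent
  where
  descent : rowOf i ((p ++ x ∷ q) ∷ insert T y) < suc (rowOf (suc i) (insert T y))
  descent with i ℕ.≟ y
  ... | no i≢y     rewrite rowOf-∈ {i} (insert T y) (Bump.old⇒new sr p<x x<y i≢y i∈r) = s≤s z≤n
  ... | yes ≡.refl rewrite rowOf-∉ {i} (insert T i) (Bump.new∌y sr p<x x<y) =
    s≤s (insert-smaller T i wf (disj i∈r) (case ∈-++⁻ (p ++ i ∷ q) si∈ of λ where
      (inj₁ si∈r) → contradiction si∈r si∉r
      (inj₂ si∈T) → si∈T))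
...   | inj₂ i∉r | inj₁ si∈r
  rewrite rowOf-∉ {i} T i∉r | rowOf-∈ {suc i} T si∈r | rowOf-∉ {i} (insert T y) (i∉r ∘ Bump.new⇒old sr p<x x<y i≢x) =
  (λ d → contradiction d ¬descent) , (λ ())
  where
  ¬descent : ¬ suc (rowOf i (insert T y)) < rowOf (suc i) ((p ++ x ∷ q) ∷ insert T y)
  ¬descent with suc i ℕ.≟ y
  ... | no si≢y    rewrite rowOf-∈ {suc i} (insert T y) (Bump.old⇒new sr p<x x<y si≢y si∈r) = λ ()
  ... | yes ≡.refl rewrite rowOf-∉ {suc i} (insert T y) (Bump.new∌y sr p<x x<y) =
    insert-larger T i wf (disj si∈r) ∘ ℕ.≤-pred
...   | inj₂ i∉r | inj₂ si∉r
  rewrite rowOf-∉ {i} T i∉r | rowOf-∉ {suc i} T si∉r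
        | rowOf-∉ {i} (insert T y) (i∉r ∘ Bump.new⇒old sr p<x x<y i≢x)
        | rowOf-∉ {suc i} (insert T y) (si∉r ∘ Bump.new⇒old sr p<x x<y si≢x) =
  s≤s ∘ proj₁ ih ∘ ℕ.≤-pred , s≤s ∘ proj₂ ih ∘ ℕ.≤-pred
  where
  in-T : ∀ {z} → z ∉ p ++ y ∷ q → z ∈ₜ ((p ++ y ∷ q) ∷ T) → z ∈ₜ T
  in-T z∉r z∈ with ∈-++⁻ (p ++ y ∷ q) z∈
  ... | inj₁ z∈r = contradiction z∈r z∉r
  ... | inj₂ z∈T = z∈T
  ih = insert-descent T y i wf (disj (Bump.old∋y sr p<x x<y)) (in-T i∉r i∈) (in-T si∉r si∈)

record Insertable (w : Word) (T : Tableau) : Set where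
  constructor insertable
  field
    wellformed : Wellformed T
    distinct   : Unique w
    fresh      : ∀ {z} → z ∈ w → z ∉ₜ T

module _ {x w T} (ready : Insertable (x ∷ w) T) where

  open Insertable ready

  x∉T : x ∉ₜ T
  x∉T = fresh (here ≡.refl)

  insert-head : Insertable w (insert T x)
  insert-head with distinct
  ... | x∉w ∷ unique = insertable (insert-wellformed T x wellformed x∉T) unique λ z∈ z∈T′ →
    case insert-∈⁻ T x wellformed x∉T z∈T′ of λ where
      (inj₁ z≡x) → All.lookup x∉w z∈ (≡.sym z≡x)
      (inj₂ z∈T) → fresh (there z∈) z∈T

  head-∈ : x ∈ₜ insert T x
  head-∈ = insert-∋ T x wellformed x∉T

  insert-mono : ∀ {z} → z ∈ₜ T → z ∈ₜ insert T x
  insert-mono = insert-∈⁺ T x wellformed x∉T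

module _ (i : ℕ) where

  private
    Descends : Tableau → Word → Set
    Descends T w = Descent i (foldl insert T w)

    both : ∀ w T → Insertable w T → i ∈ₜ T → suc i ∈ₜ T →
      (Descends T w → Descent i T) × (Descent i T → Descends T w)
    both []      T ready i∈ si∈ = id , id
    both (x ∷ w) T ready i∈ si∈
      with insert-descent T x i (Insertable.wellformed ready) (x∉T ready) i∈ si∈
         | both w (insert T x) (insert-head ready) (insert-mono ready i∈) (insert-mono ready si∈)
    ... | f , g | f′ , g′ = f ∘ f′ , g′ ∘ g

    larger-later : ∀ w T → Insertable w T → i ∈ₜ T → suc i ∈ w → ¬ Descends T w
    larger-later (x ∷ w) T ready i∈ (here ≡.refl) d = insert-larger T i (Insertable.wellformed ready) (x∉T ready)
      (proj₁ (both w (insert T x) (insert-head ready) (insert-mono ready i∈) (head-∈ ready)) d)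
    larger-later (x ∷ w) T ready i∈ (there si∈) = larger-later w (insert T x) (insert-head ready) (insert-mono ready i∈) si∈

    smaller-later : ∀ w T → Insertable w T → suc i ∈ₜ T → i ∈ w → Descends T w
    smaller-later (x ∷ w) T ready si∈ (here ≡.refl) =
      proj₂ (both w (insert T x) (insert-head ready) (head-∈ ready) (insert-mono ready si∈))
        (insert-smaller T i (Insertable.wellformed ready) (x∉T ready) si∈)
    smaller-later (x ∷ w) T ready si∈ (there i∈) = smaller-later w (insert T x) (insert-head ready) (insert-mono ready si∈) i∈

    neither : ∀ w T → Insertable w T → i ∈ w → suc i ∈ w →
      (Descends T w → position (suc i) w < position i w) × (position (suc i) w < position i w → Descends T w)
    neither (x ∷ w) T ready i∈ si∈ with i ℕ.≟ x | suc i ℕ.≟ x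
    ... | yes ≡.refl | _ with si∈
    ...   | here ()
    ...   | there si∈w =
      (λ d → contradiction d (larger-later w (insert T x) (insert-head ready) (head-∈ ready) si∈w)) ,
      λ lt → contradiction (subst (position (suc i) (i ∷ w) <_) (position-head i w) lt) ℕ.n≮0
    neither (x ∷ w) T ready i∈ si∈ | no i≢x | yes ≡.refl with i∈
    ...   | here i≡x   = contradiction i≡x i≢x
    ...   | there i∈w =
      (λ _ → ≡.subst₂ _<_ (≡.sym (position-head x w)) (≡.sym (position-tail w i≢x)) (s≤s z≤n)) ,
      λ _ → smaller-later w (insert T x) (insert-head ready) (head-∈ ready) i∈w
    neither (x ∷ w) T ready i∈ si∈ | no i≢x | no si≢x with i∈ | si∈
    ...   | here i≡x | _ = contradiction i≡x i≢x
    ...   | _ | here si≡x = contradiction si≡x si≢x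
    ...   | there i∈w | there si∈w with neither w (insert T x) (insert-head ready) i∈w si∈w
    ...     | f , g =
      (λ d → ≡.subst₂ _<_ (≡.sym (position-tail w si≢x)) (≡.sym (position-tail w i≢x)) (s≤s (f d))) ,
      λ lt → g (ℕ.≤-pred (≡.subst₂ _<_ (position-tail w si≢x) (position-tail w i≢x) lt))

  -- Whether `i` is a descent is settled when the later one of `i` and `suc i` is inserted, by
  -- `insert-smaller` or `insert-larger`; by `insert-descent` no further insertion changes it. The
  -- private lemmas follow the word through these stages.
  P-descent : ∀ {π} → Unique π → i ∈ π → suc i ∈ π →
    (Descent i (P π) → position (suc i) π < position i π) × (position (suc i) π < position i π → Descent i (P π))
  P-descent {π} u i∈ si∈ = neither π [] (insertable [] u (λ _ ())) i∈ si∈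

-- Monomials as weakly increasing words, and standardisation.

spread-unique : (go : ℕ → Monomial → Word) → (∀ i → go i [] ≡ []) →
  (∀ i k e → go i (k ∷ e) ≡ replicate k i ++ go (suc i) e) → ∀ i e → go i e ≡ spread i e
spread-unique go nil cons i []      = nil i
spread-unique go nil cons i (k ∷ e) = ≡.trans (cons i k e) (cong (replicate k i ++_) (spread-unique go nil cons (suc i) e))

-- The auxiliary function of indices has no name in scope; abstracting over
-- its first argument lets unification find it.
mutual
  indicesFrom : ℕ → Monomial → Word
  indicesFrom = _

  indices≡spread : ∀ e → indices e ≡ spread 1 e
  indices≡spread e with 1
  ... | i = spread-unique indicesFrom (λ _ → ≡.refl) (λ _ _ _ → ≡.refl) i e

length-spread : ∀ i e → length (spread i e) ≡ sum e
length-spread i []      = ≡.refl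
length-spread i (k ∷ e) = ≡.trans (length-++ (replicate k i)) (cong₂ ℕ._+_ (length-replicate k) (length-spread (suc i) e))

spread-≥ : ∀ i e → All (i ≤_) (spread i e)
spread-≥ i []      = []
spread-≥ i (k ∷ e) = All.++⁺ (All.replicate⁺ k ℕ.≤-refl) (All.map ℕ.<⇒≤ (spread-≥ (suc i) e))

spread-sorted : ∀ i e → AllPairs _≤_ (spread i e)
spread-sorted i []      = []
spread-sorted i (k ∷ e) = AllPairs.++⁺ (replicate-sorted k) (spread-sorted (suc i) e)
  (All.replicate⁺ k (All.map ℕ.<⇒≤ (spread-≥ (suc i) e)))
  where
  replicate-sorted : ∀ k → AllPairs _≤_ (replicate k i)
  replicate-sorted zero    = []
  replicate-sorted (suc k) = All.replicate⁺ k ℕ.≤-refl ∷ replicate-sorted k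

applyUpTo-entry : ∀ w → applyUpTo (entry w ∘ suc) (length w) ≡ w
applyUpTo-entry []      = ≡.refl
applyUpTo-entry (x ∷ w) = cong (x ∷_) (applyUpTo-entry w)

entry-mono : ∀ {w} → AllPairs _≤_ w → ∀ j → 1 ≤ j → suc j ≤ length w → entry w j ≤ entry w (suc j)
entry-mono {x ∷ y ∷ w} ((x≤y ∷ _) ∷ _) (suc zero)    _ _         = x≤y
entry-mono {x ∷ w}     (_ ∷ sorted)    (suc (suc j)) _ (s≤s j<w) = entry-mono sorted (suc j) (s≤s z≤n) j<w

monotone : ∀ {n} (ι : ℕ → ℕ) → (∀ j → 1 ≤ j → suc j ≤ n → ι j ≤ ι (suc j)) →
  ∀ {x y} → 1 ≤ x → x ≤ y → y ≤ n → ι x ≤ ι y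
monotone ι mono {x} {y} 1≤x x≤y y≤n with ℕ.m≤n⇒m<n∨m≡n x≤y
monotone ι mono {x} {y}     1≤x x≤y y≤n | inj₂ ≡.refl     = ℕ.≤-refl
monotone ι mono {x} {suc y} 1≤x x≤y y≤n | inj₁ (s≤s x≤y′) =
  ℕ.≤-trans (monotone ι mono 1≤x x≤y′ (ℕ.<⇒≤ y≤n)) (mono y (ℕ.≤-trans 1≤x x≤y′) y≤n)

-- π is the standardisation of the word map ι π, for weakly increasing ι.
Standard : (ℕ → ℕ) → Word → Set
Standard ι = AllPairs (λ x y → y < x → ι y < ι x)

standard? : ∀ ι π → Dec (Standard ι π)
standard? ι = AllPairs.allPairs? (λ x y → (y ℕ.<? x) →-dec (ι y ℕ.<? ι x))

-- `Standard` keeps each descent of `π` strict under `ι`; elsewhere the weak monotonicity of `ι`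
-- prevents a new one.
des-map : ∀ ι {n} → (∀ {x y} → 1 ≤ x → x ≤ y → y ≤ n → ι x ≤ ι y) →
  ∀ {π} → All (λ j → 1 ≤ j × j ≤ n) π → Standard ι π → des (map ι π) ≡ des π
des-map ι mono {[]}        bounds std = ≡.refl
des-map ι mono {x ∷ []}    bounds std = ≡.refl
des-map ι mono {x ∷ y ∷ π} ((1≤x , x≤n) ∷ bounds@((1≤y , y≤n) ∷ _)) ((y<x⇒ ∷ _) ∷ std) with y ℕ.<? x
... | yes y<x = ≡.trans (des-∷-< (map ι π) (y<x⇒ y<x)) (≡.trans (cong suc (des-map ι mono bounds std)) (≡.sym (des-∷-< π y<x)))
... | no y≮x  = ≡.trans (des-∷-≮ (map ι π) (ℕ.≤⇒≯ (mono 1≤x (ℕ.≮⇒≥ y≮x) y≤n)))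
  (≡.trans (des-map ι mono bounds std) (≡.sym (des-∷-≮ π y≮x)))

descent? : ∀ i T → Dec (Descent i T)
descent? i T = rowOf i T ℕ.<? rowOf (suc i) T

module _ {n π} (π∈S : π ∈ S n) (ι : ℕ → ℕ) (mono : ∀ j → 1 ≤ j → suc j ≤ n → ι j ≤ ι (suc j)) where

  -- By `P-descent` a descent j is an inversion between the neighbouring values j + 1 and j, to
  -- which `Standard` applies.
  standard⇒Des : Standard ι π → All (λ j → ι j < ι (suc j)) (Des n (P π))
  standard⇒Des std = All.tabulate λ j∈Des →
    let j∈ , descent = ∈-filter⁻ (λ i → descent? i (P π)) j∈Des in in-range j∈ descent
    where
    in-range : ∀ {j} → j ∈ applyUpTo suc (n ∸ 1) → Descent j (P π) → ι j < ι (suc j)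
    in-range j∈ descent with ∈-applyUpTo⁻ suc j∈
    ... | i , i<n-1 , ≡.refl = AllPairs⇒position std si∈ i∈ (proj₁ (P-descent (suc i) (S-unique {n} π∈S) i∈ si∈) descent)
        ℕ.≤-refl
      where
      2+i≤n : suc (suc i) ≤ n
      2+i≤n = ℕ.≤-trans (s≤s i<n-1) (suc-pred i<n-1)
        where
        suc-pred : ∀ {i n} → i < n ∸ 1 → suc (n ∸ 1) ≤ n
        suc-pred {n = suc n} _ = ℕ.≤-refl
      i∈ = S-∈ {n} π∈S (s≤s z≤n) (ℕ.<⇒≤ 2+i≤n)
      si∈ = S-∈ {n} π∈S (s≤s z≤n) 2+i≤n

  -- The descents of `P π` give strictness for inversions between neighbouring values only;
  -- `adjacent-inversion` reaches all others.
  Des⇒standard : All (λ j → ι j < ι (suc j)) (Des n (P π)) → Standard ι π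
  Des⇒standard compat = position⇒AllPairs (S-unique {n} π∈S) (λ {x} {y} x∈ y∈ x-before-y y<x →
    adjacent-inversion π ι n mono adjacent x y (proj₁ (All.lookup (S-bounded {n} π∈S) y∈)) y<x
      (proj₂ (All.lookup (S-bounded {n} π∈S) x∈)) x-before-y)
    where
    adjacent : ∀ j → 1 ≤ j → suc j ≤ n → position (suc j) π < position j π → ι j < ι (suc j)
    adjacent (suc j) 1≤j j<n lt = All.lookup compat (∈-filter⁺ (λ i → descent? i (P π)) (∈-applyUpTo⁺ suc (ℕ.∸-monoˡ-≤ 1 j<n))
      (proj₂ (P-descent (suc j) (S-unique {n} π∈S) (S-∈ {n} π∈S 1≤j (ℕ.<⇒≤ j<n)) (S-∈ {n} π∈S (s≤s z≤n) j<n)) lt))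

-- From sums over permutations to sums over words.

module PermutationSums (K : PositiveField) (α : PositiveField.Carrier K) where

  open FieldTheory K
  open WordSums K α

  F : ℕ → List ℕ → Monomial → Carrier
  F n σ e = indicator
    ((sum e ℕ.≟ n) ×-dec All.all? (λ j → entry (indices e) j ℕ.<? entry (indices e) (suc j)) σ)

  I-* : ∀ M w c φ → I M (λ u → c * φ u) w ≈ c * I M φ w
  I-* M []      c φ = refl
  I-* M (y ∷ w) c φ = trans (+-congˡ (I-* M w c _)) (sym (distribˡ c _ _))

  -- The new largest letter x must come after all letters y with ι y = ι x.
  I-standard : ∀ ι x π φ → All (λ y → y < x × ι y ≤ ι x) π →
    I x (λ σ → indicator (standard? ι σ) * φ (map ι σ)) π ≈ indicator (standard? ι π) * T (ι x) φ (map ι π)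
  I-standard ι x []      φ bounds = trans (indicator-*-yes (standard? ι [ x ]) ([] ∷ []))
      (sym (indicator-*-yes (standard? ι []) []))
  I-standard ι x (y ∷ π) φ bounds@((y<x , _) ∷ π<x) = begin
    indicator (standard? ι (x ∷ y ∷ π)) * φ (map ι (x ∷ y ∷ π)) + I x (λ σ → indicator (standard? ι (y ∷ σ)) * φ
        (map ι (y ∷ σ))) π
      -- In front, `Standard` asks that `ι x` exceed all values that follow, which is the condition
      -- under which `T` inserts there.
      ≈⟨ +-cong (*-congʳ (indicator-* (standard? ι (x ∷ y ∷ π)) (standard? ι (y ∷ π)) (All.all? (ℕ._<? ι x) (map ι (y ∷ π)))
                  (λ { (x> ∷ std) → std , All.map⁺ (All.zipWith (λ (f , (z<x , _)) → f z<x) (x> , bounds)) })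
                  (λ std lt → All.map (λ z< _ → z<) (All.map⁻ lt) ∷ std)))
                -- Behind `y` the new `x` is not constrained by `y`, because y < x; so the condition
                -- at `y` can be taken out of the sum.
                (I-cong x π (λ σ p → trans (*-congʳ (indicator-* (standard? ι (y ∷ σ)) (Ry? π) (standard? ι σ)
                  (λ { (y> ∷ std) → All.tail (All-resp-↭ p y>) , std })
                  (λ y> std → All-resp-↭ (↭-sym p) ((λ x<y → contradiction x<y (ℕ.<⇒≯ y<x)) ∷ y>) ∷ std))) (*-assoc _ _ _))) ⟩
    indicator (standard? ι (y ∷ π)) * indicator (All.all? (ℕ._<? ι x) (map ι (y ∷ π))) * φ (map ι (x ∷ y ∷ π)) +
      I x (λ σ → indicator (Ry? π) * (indicator (standard? ι σ) * φ (map ι (y ∷ σ)))) π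
      ≈⟨ +-cong (*-assoc _ _ _) (trans (I-* x π _ _) (trans (*-congˡ (I-standard ι x π (φ ∘ (ι y ∷_)) π<x))
          (sym (*-assoc _ _ _)))) ⟩
    indicator (standard? ι (y ∷ π)) * (indicator (All.all? (ℕ._<? ι x) (map ι (y ∷ π))) * φ (map ι (x ∷ y ∷ π))) +
      indicator (Ry? π) * indicator (standard? ι π) * T (ι x) (φ ∘ (ι y ∷_)) (map ι π)
      ≈⟨ +-congˡ (*-congʳ (indicator-* (standard? ι (y ∷ π)) (Ry? π) (standard? ι π)
           (λ { (y> ∷ std) → y> , std }) (λ y> std → y> ∷ std))) ⟨
    indicator (standard? ι (y ∷ π)) * (indicator (All.all? (ℕ._<? ι x) (map ι (y ∷ π))) * φ (map ι (x ∷ y ∷ π))) +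
      indicator (standard? ι (y ∷ π)) * T (ι x) (φ ∘ (ι y ∷_)) (map ι π)
      ≈⟨ distribˡ _ _ _ ⟨
    indicator (standard? ι (y ∷ π)) * T (ι x) φ (map ι (y ∷ π)) ∎
    where
    Ry? : ∀ σ → Dec (All (λ z → z < y → ι z < ι y) σ)
    Ry? = All.all? (λ z → (z ℕ.<? y) →-dec (ι z ℕ.<? ι y))

  -- `S` inserts the largest letter last, and `T*` inserts the last letter of its list last.
  -- `I-standard` trades one insertion for the other, and the induction goes on with
  -- `T (ι (suc n)) φ` in place of `φ`.
  ∑-standard : ∀ ι n → (∀ {x y} → 1 ≤ x → x ≤ y → y ≤ n → ι x ≤ ι y) → ∀ φ →
    ∑ (S n) (λ π → indicator (standard? ι π) * φ (map ι π)) ≈ T* (map ι (applyUpTo suc n)) φ []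
  ∑-standard ι zero    mono φ = trans (+-identityʳ _) (indicator-*-yes (standard? ι []) [])
  ∑-standard ι (suc n) mono φ = begin
    ∑ (S (suc n)) (λ π → indicator (standard? ι π) * φ (map ι π))
      ≈⟨ ∑-concatMap (insertions (suc n)) (S n) _ ⟩
    ∑ (S n) (λ π → ∑ (insertions (suc n) π) (λ σ → indicator (standard? ι σ) * φ (map ι σ)))
      ≈⟨ ∑-cong-∈ (S n) (λ π π∈ → trans (∑-insertions (suc n) π _) (I-standard ι (suc n) π φ
           (All.map (λ (1≤j , j≤n) → s≤s j≤n , mono 1≤j (ℕ.m≤n⇒m≤1+n j≤n) ℕ.≤-refl) (S-bounded {n} π∈)))) ⟩
    ∑ (S n) (λ π → indicator (standard? ι π) * T (ι (suc n)) φ (map ι π))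
      ≈⟨ ∑-standard ι n (λ 1≤x x≤y y≤n → mono 1≤x x≤y (ℕ.m≤n⇒m≤1+n y≤n)) (T (ι (suc n)) φ) ⟩
    T* (map ι (applyUpTo suc n)) (T (ι (suc n)) φ) []
      ≈⟨ reflexive (cong (λ f → f []) (≡.trans (≡.sym (foldr-++ T φ (map ι (applyUpTo suc n)) [ ι (suc n) ]))
           (cong (foldr T φ) (≡.trans (≡.sym (map-++ ι (applyUpTo suc n) [ suc n ])) (cong (map ι) (applyUpTo-∷ʳ suc n)))))) ⟩
    T* (map ι (applyUpTo suc (suc n))) φ [] ∎

  homogeneous : ∀ e → let n = sum e in
    ∑ (S n) (λ π → binomial (α + fromℕ n - 1# - fromℕ (des π)) n * F n (Des n (P π)) e) ≈
    indicator (n ℕ.≟ n) * ∏ e rising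
  homogeneous e = begin
    ∑ (S n) (λ π → binomial (α + fromℕ n - 1# - fromℕ (des π)) n * F n (Des n (P π)) e)
      ≈⟨ ∑-cong-∈ (S n) (λ π π∈ → trans (*-comm _ _) (trans
           (*-congʳ (indicator-⇔ ((n ℕ.≟ n) ×-dec All.all? _ (Des n (P π))) (standard? ι π)
             (Des⇒standard {n} π∈ ι ι-step ∘ proj₂) (λ std → ≡.refl , standard⇒Des {n} π∈ ι ι-step std)))
           (indicator-*-cong (standard? ι π) (λ std → reflexive (cong₂ (λ l d → binomial (α + fromℕ l - 1# - fromℕ d) l)
             {n} (≡.sym (≡.trans (length-map ι π) (S-length {n} π∈))) (≡.sym (des-map ι ι-mono (S-bounded {n} π∈) std))))))) ⟩
    ∑ (S n) (λ π → indicator (standard? ι π) * weight (map ι π))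
      ≈⟨ ∑-standard ι n ι-mono weight ⟩
    T* (map ι (applyUpTo suc n)) weight []
      ≈⟨ reflexive (cong (λ L → T* L weight []) letters) ⟩
    T* (spread 1 e) weight []
      ≈⟨ T*-spread-weight 1 e [] [] ⟩
    ∏ e rising * weight []
      ≈⟨ trans (*-congˡ weight-[]) (trans (*-identityʳ _) (sym (indicator-*-yes (n ℕ.≟ n) ≡.refl))) ⟩
    indicator (n ℕ.≟ n) * ∏ e rising ∎
    where
    n = sum e
    ι : ℕ → ℕ
    ι = entry (indices e)
    length-indices : length (indices e) ≡ sum e
    length-indices = ≡.trans (cong length (indices≡spread e)) (length-spread 1 e)
    ι-step : ∀ j → 1 ≤ j → suc j ≤ sum e → ι j ≤ ι (suc j)
    ι-step j 1≤j j<n = entry-mono (subst (AllPairs _≤_) (≡.sym (indices≡spread e)) (spread-sorted 1 e)) j 1≤j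
      (subst (suc j ≤_) (≡.sym length-indices) j<n)
    ι-mono : ∀ {x y} → 1 ≤ x → x ≤ y → y ≤ sum e → ι x ≤ ι y
    ι-mono = monotone ι ι-step
    letters : map ι (applyUpTo suc (sum e)) ≡ spread 1 e
    letters = ≡.trans (map-applyUpTo suc ι (sum e)) (≡.trans (cong (applyUpTo (ι ∘ suc)) (≡.sym length-indices))
      (≡.trans (applyUpTo-entry (indices e)) (indices≡spread e)))

  quasisymmetric-expansion : ∀ n e →
    ∑ (S n) (λ π → binomial (α + fromℕ n - 1# - fromℕ (des π)) n * F n (Des n (P π)) e) ≈
    indicator (sum e ℕ.≟ n) * ∏ e rising
  quasisymmetric-expansion n e = by-degree (sum e ℕ.≟ n)
    where
    by-degree : Dec (sum e ≡ n) → _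
    by-degree (no ∑e≢n) = trans
      (∑-0 (S n) (λ π _ → trans (*-congˡ (indicator-no ((sum e ℕ.≟ n) ×-dec All.all? _ (Des n (P π))) (∑e≢n ∘ proj₁)))
          (zeroʳ _)))
      (sym (indicator-*-no (sum e ℕ.≟ n) ∑e≢n))
    by-degree (yes ≡.refl) = homogeneous e

-- Partitions

_≟ₗ_ : (ks ls : List ℕ) → Dec (ks ≡ ls)
_≟ₗ_ = ≡-dec ℕ._≟_

parts-injective : ∀ {κ μ} → parts κ ≡ parts μ → κ ≡ μ
parts-injective {record { decreasing = d ; positive = p }} {record { decreasing = d′ ; positive = p′ }} ≡.refl =
  cong₂ (λ d p → record { decreasing = d ; positive = p })
    (Linked.irrelevant ℕ.≤-irrelevant d d′) (All.irrelevant ℕ.≤-irrelevant p p′)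

_≟ₚ_ : (κ μ : Partition) → Dec (κ ≡ μ)
κ ≟ₚ μ = map′ parts-injective (cong parts) (parts κ ≟ₗ parts μ)

open import Data.List.Membership.DecPropositional _≟ₚ_ using (_∈?_)

≥-decTotalOrder : DecTotalOrder 0ℓ 0ℓ 0ℓ
≥-decTotalOrder = Flip.decTotalOrder ℕ.≤-decTotalOrder

sort↓-↭ : ∀ ks → sort↓ ks ↭ ks
sort↓-↭ = InsertionSort.sort-↭ ≥-decTotalOrder

sort↓-decreasing : ∀ ks → Linked _≥_ (sort↓ ks)
sort↓-decreasing = InsertionSort.sort-↗ ≥-decTotalOrder

decreasing-↭⇒≡ : ∀ {ks ls} → Linked _≥_ ks → Linked _≥_ ls → ks ↭ ls → ks ≡ ls
decreasing-↭⇒≡ ks↓ ls↓ p = Pointwise-≡⇒≡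
  (Sorted.↗↭↗⇒≋ (DecTotalOrder.totalOrder ≥-decTotalOrder) ks↓ ls↓ (↭⇒↭ₛ p))

↭⇒≡ₚ : ∀ {κ μ} → parts κ ↭ parts μ → κ ≡ μ
↭⇒≡ₚ {κ} {μ} p = parts-injective (decreasing-↭⇒≡ (decreasing κ) (decreasing μ) p)

arrange : ∀ ks → All (0 <_) ks → Partition
arrange ks ks>0 = record
  { parts = sort↓ ks ; decreasing = sort↓-decreasing ks ; positive = All-resp-↭ (↭-sym (sort↓-↭ ks)) ks>0 }

infixr 5 1+_∷ₚ_
-- The new part is given by its predecessor, so that it is positive by construction.
1+_∷ₚ_ : ℕ → Partition → Partition
1+ i ∷ₚ κ = arrange (suc i ∷ parts κ) (s≤s z≤n ∷ positive κ)

∷ₚ-↭ : ∀ i κ → parts (1+ i ∷ₚ κ) ↭ suc i ∷ parts κ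
∷ₚ-↭ i κ = sort↓-↭ (suc i ∷ parts κ)

remove : ∀ {k} μ → k ∈ parts μ → Σ[ κ ∈ Partition ] parts μ ↭ k ∷ parts κ
remove {k} μ k∈ with ∈-∃++ k∈
... | p , q , eq = arrange (p ++ q) p++q>0 , ↭-trans μ↭ (prep k (↭-sym (sort↓-↭ (p ++ q))))
  where
  μ↭ : parts μ ↭ k ∷ p ++ q
  μ↭ = ↭-trans (↭-reflexive eq) (shift k p q)
  p++q>0 : All (0 <_) (p ++ q)
  p++q>0 = All.tail (All-resp-↭ μ↭ (positive μ))

-- Monomials

nonzeroExponents-positive : ∀ e → All (0 <_) (nonzeroExponents e)
nonzeroExponents-positive e = All.map ℕ.n≢0⇒n>0 (All.all-filter (λ k → ¬? (k ℕ.≟ 0)) e)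

nonzeroExponents-all : ∀ {ks} → All (0 <_) ks → nonzeroExponents ks ≡ ks
nonzeroExponents-all ks>0 = filter-all (λ k → ¬? (k ℕ.≟ 0)) (All.map ℕ.n>0⇒n≢0 ks>0)

sum-nonzeroExponents : ∀ e → sum (nonzeroExponents e) ≡ sum e
sum-nonzeroExponents []          = ≡.refl
sum-nonzeroExponents (zero ∷ e)  = sum-nonzeroExponents e
sum-nonzeroExponents (suc k ∷ e) = cong (suc k ℕ.+_) (sum-nonzeroExponents e)

-- The only `κ` for which `m[ κ ]` contains the monomial `e`.
shape : Monomial → Partition
shape e = arrange (nonzeroExponents e) (nonzeroExponents-positive e)

shape-↭ : ∀ e → parts (shape e) ↭ nonzeroExponents e
shape-↭ e = sort↓-↭ (nonzeroExponents e)

size-shape : ∀ e → size (shape e) ≡ sum e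
size-shape e = ≡.trans (sum-↭ (shape-↭ e)) (sum-nonzeroExponents e)

shape-parts : ∀ μ → shape (parts μ) ≡ μ
shape-parts μ = ↭⇒≡ₚ (↭-trans (shape-↭ (parts μ)) (↭-reflexive (nonzeroExponents-all (positive μ))))

-- The monomials e / xᵢᵏ.
lowered : ℕ → Monomial → List Monomial
lowered k []      = []
lowered k (x ∷ e) = (if does (k ℕ.≤? x) then [ (x ∸ k) ∷ e ] else []) ++ map (x ∷_) (lowered k e)

-- A lowered exponent either stays positive or was equal to `suc k` and disappears.
lowered-nonzeroExponents : ∀ k e {e′} → e′ ∈ lowered (suc k) e →
  length (nonzeroExponents e) ≡ length (nonzeroExponents e′) ⊎ nonzeroExponents e ↭ suc k ∷ nonzeroExponents e′
lowered-nonzeroExponents k (x ∷ e) {e′} e′∈ with ∈-++⁻ (if does (suc k ℕ.≤? x) then [ (x ∸ suc k) ∷ e ] else []) e′∈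
... | inj₂ e′∈tail = tail x (∈-map⁻ (x ∷_) e′∈tail)
  where
  tail : ∀ x → (∃ λ e″ → e″ ∈ lowered (suc k) e × e′ ≡ x ∷ e″) →
    length (nonzeroExponents (x ∷ e)) ≡ length (nonzeroExponents e′) ⊎ nonzeroExponents (x ∷ e) ↭ suc k ∷ nonzeroExponents e′
  tail zero    (e″ , e″∈ , ≡.refl) = lowered-nonzeroExponents k e e″∈
  tail (suc x) (e″ , e″∈ , ≡.refl) = Sum.map (cong suc) (λ p → ↭-trans (prep (suc x) p) (swap (suc x) (suc k) ↭-refl))
    (lowered-nonzeroExponents k e e″∈)
... | inj₁ e′∈head = head x (suc k ℕ.≤? x) e′∈head
  where
  head : ∀ x (≤? : Dec (suc k ≤ x)) → e′ ∈ (if does ≤? then [ (x ∸ suc k) ∷ e ] else []) →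
    length (nonzeroExponents (x ∷ e)) ≡ length (nonzeroExponents e′) ⊎ nonzeroExponents (x ∷ e) ↭ suc k ∷ nonzeroExponents e′
  head (suc x) (yes (s≤s k≤x)) (here ≡.refl) with x ∸ k in eq
  ... | suc _ = inj₁ ≡.refl
  ... | zero  = inj₂ (↭-reflexive (cong (λ y → suc y ∷ nonzeroExponents e) (ℕ.≤-antisym (ℕ.m∸n≡0⇒m≤n eq) k≤x)))
  head x (no _) ()

lowered-sum : ∀ k e {e′} → e′ ∈ lowered k e → sum e ≡ k ℕ.+ sum e′
lowered-sum k (x ∷ e) {e′} e′∈ with ∈-++⁻ (if does (k ℕ.≤? x) then [ (x ∸ k) ∷ e ] else []) e′∈
... | inj₁ e′∈head = head (k ℕ.≤? x) e′∈head
  where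
  head : (≤? : Dec (k ≤ x)) → e′ ∈ (if does ≤? then [ (x ∸ k) ∷ e ] else []) → x ℕ.+ sum e ≡ k ℕ.+ sum e′
  head (yes k≤x) (here ≡.refl) = ≡.trans (cong (ℕ._+ sum e) (≡.sym (ℕ.m+[n∸m]≡n k≤x))) (ℕ.+-assoc k (x ∸ k) (sum e))
  head (no _) ()
... | inj₂ e′∈tail with ∈-map⁻ (x ∷_) e′∈tail
...   | e″ , e″∈ , ≡.refl = ≡.trans (cong (x ℕ.+_) (lowered-sum k e e″∈)) (swap-+ x k (sum e″))
  where
  swap-+ : ∀ a b c → a ℕ.+ (b ℕ.+ c) ≡ b ℕ.+ (a ℕ.+ c)
  swap-+ = solve-∀

-- The dominance order

-- This is the statistic n(μ) = Σ (i - 1) μᵢ, as the i-th part lies in i - 1 proper tails. It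
-- decreases strictly in the dominance order.
tailSums : List ℕ → ℕ
tailSums []       = 0
tailSums (k ∷ ks) = sum ks ℕ.+ tailSums ks

tailSums-drop : ∀ ks → tailSums ks ≡ sum (drop 1 ks) ℕ.+ tailSums (drop 1 ks)
tailSums-drop []       = ≡.refl
tailSums-drop (k ∷ ks) = ≡.refl

tailSums-mono : ∀ ks ls → (∀ j → sum (drop j ls) ≤ sum (drop j ks)) → tailSums ls ≤ tailSums ks
tailSums-mono ks []       h = z≤n
tailSums-mono ks (l ∷ ls) h rewrite tailSums-drop ks = ℕ.+-mono-≤ (h 1) (tailSums-mono (drop 1 ks) ls
  (λ j → subst (λ d → sum (drop j ls) ≤ sum d) (≡.sym (drop-drop 1 j ks)) (h (suc j))))

-- `tailSums` adds up the tail sums, so equality of the totals forces equality in each of the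
-- inequalities `h`. Parts are differences of consecutive tail sums, and positivity makes the
-- lengths agree.
tailSums-≡ : ∀ {ks ls} → All (0 <_) ks → All (0 <_) ls → sum ks ≡ sum ls →
  (∀ j → sum (drop j ls) ≤ sum (drop j ks)) → tailSums ls ≡ tailSums ks → ks ≡ ls
tailSums-≡ []          []          ∑≡ h eq = ≡.refl
tailSums-≡ (s≤s _ ∷ _) []          () h eq
tailSums-≡ []          (s≤s _ ∷ _) () h eq
tailSums-≡ {k ∷ ks} {l ∷ ls} (_ ∷ ks>0) (_ ∷ ls>0) ∑≡ h eq =
  cong₂ _∷_ (ℕ.+-cancelʳ-≡ (sum ls) k l (subst (λ s → k ℕ.+ s ≡ l ℕ.+ sum ls) ∑ks≡∑ls ∑≡))
    (tailSums-≡ ks>0 ls>0 ∑ks≡∑ls (h ∘ suc)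
      (ℕ.+-cancelˡ-≡ (sum ls) (tailSums ls) (tailSums ks)
          (subst (λ s → sum ls ℕ.+ tailSums ls ≡ s ℕ.+ tailSums ks) ∑ks≡∑ls eq)))
  where
  ∑ks≡∑ls : sum ks ≡ sum ls
  ∑ks≡∑ls with ℕ.m≤n⇒m<n∨m≡n (h 1)
  ... | inj₂ ∑≡′ = ≡.sym ∑≡′
  ... | inj₁ ∑<  = contradiction eq (ℕ.<⇒≢ (ℕ.+-mono-<-≤ ∑< (tailSums-mono ks ls (h ∘ suc))))

-- A crude bound, which guarantees that the subtraction in `height` does not truncate.
tailSums-bound : ∀ {ks} → All (0 <_) ks → tailSums ks ≤ sum ks ℕ.* sum ks
tailSums-bound []                           = z≤n
tailSums-bound {suc k ∷ ks} (_ ∷ ks>0) = ℕ.≤-trans (ℕ.+-monoʳ-≤ (sum ks) (tailSums-bound ks>0))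
  (subst (sum ks ℕ.+ sum ks ℕ.* sum ks ≤_) (≡.sym (expand k (sum ks))) (ℕ.m≤m+n _ _))
  where
  expand : ∀ k s → (suc k ℕ.+ s) ℕ.* (suc k ℕ.+ s) ≡ s ℕ.+ s ℕ.* s ℕ.+ ((suc k) ℕ.* (suc k) ℕ.+ (k ℕ.+ k ℕ.+ 1) ℕ.* s)
  expand = solve-∀

-- A rank for induction along the dominance order. Comparable partitions have the same size, so
-- subtracting from the square of the size just reverses the direction of `tailSums`.
height : Partition → ℕ
height μ = size μ ℕ.* size μ ∸ tailSums (parts μ)

⊴⇒height< : ∀ {κ μ} → κ ⊴ μ → κ ≢ μ → height κ < height μ
⊴⇒height< {κ} {μ} (size≡ , takes) κ≢μ = subst (λ s → s ℕ.* s ∸ tailSums (parts κ) < height μ) (≡.sym size≡)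
  (ℕ.∸-monoʳ-< strict (subst (λ s → tailSums (parts κ) ≤ s ℕ.* s) size≡ (tailSums-bound (positive κ))))
  where
  take+drop : ∀ j ks → sum (take j ks) ℕ.+ sum (drop j ks) ≡ sum ks
  take+drop j ks = ≡.trans (≡.sym (sum-++ (take j ks) (drop j ks))) (cong sum (take++drop≡id j ks))
  -- For equal sizes, larger initial sums mean smaller tail sums.
  drops : ∀ j → sum (drop j (parts μ)) ≤ sum (drop j (parts κ))
  drops j = ℕ.+-cancelˡ-≤ (sum (take j (parts μ))) _ _ (begin
    sum (take j (parts μ)) ℕ.+ sum (drop j (parts μ)) ≡⟨ take+drop j (parts μ) ⟩
    size μ                                            ≡⟨ size≡ ⟨
    size κ                                            ≡⟨ take+drop j (parts κ) ⟨
    sum (take j (parts κ)) ℕ.+ sum (drop j (parts κ)) ≤⟨ ℕ.+-monoˡ-≤ _ (takes j) ⟩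
    sum (take j (parts μ)) ℕ.+ sum (drop j (parts κ)) ∎)
    where open ℕ.≤-Reasoning
  strict : tailSums (parts μ) < tailSums (parts κ)
  strict with ℕ.m≤n⇒m<n∨m≡n (tailSums-mono (parts κ) (parts μ) drops)
  ... | inj₁ lt = lt
  ... | inj₂ eq = contradiction (parts-injective (tailSums-≡ (positive κ) (positive μ) size≡ drops eq)) κ≢μ

-- A first part that exhausts the size leaves nothing for a second, positive part.
row-⊴⇒≡ : ∀ n 1≤n {μ} → row n 1≤n ⊴ μ → μ ≡ row n 1≤n
row-⊴⇒≡ n 1≤n {μ} (size≡ , takes) = parts-injective (first (parts μ) (positive μ) size≡ (takes 1))
  where
  first : ∀ ks → All (0 <_) ks → n ℕ.+ 0 ≡ sum ks → n ℕ.+ 0 ≤ sum (take 1 ks) → ks ≡ [ n ]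
  first []           _               eq _  = contradiction (≡.trans (≡.sym (ℕ.+-identityʳ n)) eq) (ℕ.n>0⇒n≢0 1≤n)
  first (k ∷ [])     _               eq _  = cong [_] (≡.sym (ℕ.+-cancelʳ-≡ 0 n k eq))
  first (k ∷ l ∷ ks) (_ ∷ 0<l ∷ _) eq le = contradiction (ℕ.≤-trans (ℕ.≤-reflexive (≡.sym eq)) le)
    (ℕ.<⇒≱ (ℕ.+-monoʳ-< k (ℕ.<-≤-trans 0<l (ℕ.m≤m+n l (sum ks)))))

-- The factors z

∈⇒≤sum : ∀ {k ks} → k ∈ ks → k ≤ sum ks
∈⇒≤sum {ks = k ∷ ks} (here ≡.refl) = ℕ.m≤m+n k (sum ks)
∈⇒≤sum {ks = l ∷ ks} (there k∈)    = ℕ.≤-trans (∈⇒≤sum k∈) (ℕ.m≤n+m (sum ks) l)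

occurrences-∉ : ∀ {k ks} → k ∉ ks → occurrences k ks ≡ 0
occurrences-∉ {k} {ks} k∉ = cong length (filter-none (ℕ._≟ k) (All.tabulate (λ l∈ l≡k → k∉ (subst (_∈ ks) l≡k l∈))))

product-applyUpTo-cong : ∀ {f g : ℕ → ℕ} n → (∀ i → f i ≡ g i) → product (applyUpTo f n) ≡ product (applyUpTo g n)
product-applyUpTo-cong zero    f≡g = ≡.refl
product-applyUpTo-cong (suc n) f≡g = cong₂ ℕ._*_ (f≡g 0) (product-applyUpTo-cong n (f≡g ∘ suc))

product-applyUpTo-scale : ∀ {f g : ℕ → ℕ} n j c → j < n → f j ≡ c ℕ.* g j → (∀ i → i ≢ j → f i ≡ g i) →
  product (applyUpTo f n) ≡ c ℕ.* product (applyUpTo g n)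
product-applyUpTo-scale {f} {g} (suc n) zero c _ fj f≡g = ≡.trans
  (cong₂ ℕ._*_ fj (product-applyUpTo-cong n (λ i → f≡g (suc i) (λ ())))) (ℕ.*-assoc c (g 0) _)
product-applyUpTo-scale {f} {g} (suc n) (suc j) c (s≤s j<n) fj f≡g = ≡.trans
  (cong₂ ℕ._*_ (f≡g 0 (λ ())) (product-applyUpTo-scale n j c j<n fj (λ i i≢j → f≡g (suc i) (i≢j ∘ ℕ.suc-injective))))
  (swap-* (g 0) c _)
  where
  swap-* : ∀ a b c → a ℕ.* (b ℕ.* c) ≡ b ℕ.* (a ℕ.* c)
  swap-* = solve-∀

zFactor : List ℕ → ℕ → ℕ
zFactor ks i = suc i ℕ.^ occurrences (suc i) ks ℕ.* (occurrences (suc i) ks) !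

-- `z μ` unfolds to `zUpTo (parts μ) (size μ)`. The range is a separate argument because removing a
-- part changes the size, and with it the range of the product.
zUpTo : List ℕ → ℕ → ℕ
zUpTo ks n = product (applyUpTo (zFactor ks) n)

-- No part exceeds the sum of all parts, so each further factor is k^0 0! = 1.
zUpTo-sum+ : ∀ ks d → zUpTo ks (sum ks ℕ.+ d) ≡ zUpTo ks (sum ks)
zUpTo-sum+ ks zero    = cong (zUpTo ks) (ℕ.+-identityʳ (sum ks))
zUpTo-sum+ ks (suc d) = begin
  zUpTo ks (sum ks ℕ.+ suc d)                                    ≡⟨ cong (zUpTo ks) (ℕ.+-suc (sum ks) d) ⟩
  product (applyUpTo (zFactor ks) (suc n))                       ≡⟨ cong product (applyUpTo-∷ʳ (zFactor ks) n) ⟨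
  product (applyUpTo (zFactor ks) n ++ [ zFactor ks n ])         ≡⟨ product-++ (applyUpTo (zFactor ks) n) [ zFactor ks n ] ⟩
  zUpTo ks n ℕ.* (zFactor ks n ℕ.* 1)
    ≡⟨ cong (λ o → zUpTo ks n ℕ.* (suc n ℕ.^ o ℕ.* o ! ℕ.* 1)) none ⟩
  zUpTo ks n ℕ.* 1                                               ≡⟨ ℕ.*-identityʳ _ ⟩
  zUpTo ks n                                                     ≡⟨ zUpTo-sum+ ks d ⟩
  zUpTo ks (sum ks)                                              ∎
  where
  open ≡.≡-Reasoning
  n = sum ks ℕ.+ d
  none : occurrences (suc n) ks ≡ 0
  none = occurrences-∉ {suc n} {ks} (λ n∈ → ℕ.<⇒≱ (s≤s (ℕ.m≤m+n (sum ks) d)) (∈⇒≤sum n∈))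

-- If k has multiplicity m in `μ`, its factor k^m m! loses k m, while the factors of the other part
-- sizes stay.
z-remove : ∀ {i} μ κ → parts μ ↭ suc i ∷ parts κ → z μ ≡ suc i ℕ.* occurrences (suc i) (parts μ) ℕ.* z κ
z-remove {i} μ κ p = begin
  zUpTo (parts μ) (size μ)
    ≡⟨ product-applyUpTo-cong (size μ) (λ j → cong (λ o → suc j ℕ.^ o ℕ.* o !) (occurrences-↭ (suc j) p)) ⟩
  zUpTo (suc i ∷ parts κ) (size μ)
    ≡⟨ cong (zUpTo (suc i ∷ parts κ)) (sum-↭ p) ⟩
  zUpTo (suc i ∷ parts κ) (suc i ℕ.+ size κ)
    ≡⟨ product-applyUpTo-scale (suc i ℕ.+ size κ) i (suc i ℕ.* suc m) (s≤s (ℕ.m≤m+n i (size κ))) at-i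
         (λ j j≢i → cong (λ o → suc j ℕ.^ o ℕ.* o !) (occurrences-∷-≢ (parts κ) (j≢i ∘ ≡.sym ∘ ℕ.suc-injective))) ⟩
  suc i ℕ.* suc m ℕ.* zUpTo (parts κ) (suc i ℕ.+ size κ)
    ≡⟨ cong₂ (λ o s → suc i ℕ.* o ℕ.* s) (≡.sym (≡.trans (occurrences-↭ (suc i) p) (occurrences-∷-≡ (suc i) (parts κ))))
         (≡.trans (cong (zUpTo (parts κ)) (ℕ.+-comm (suc i) (size κ))) (zUpTo-sum+ (parts κ) (suc i))) ⟩
  suc i ℕ.* occurrences (suc i) (parts μ) ℕ.* z κ ∎
  where
  open ≡.≡-Reasoning
  m = occurrences (suc i) (parts κ)
  regroup : ∀ k p m f → k ℕ.* p ℕ.* (m ℕ.* f) ≡ k ℕ.* m ℕ.* (p ℕ.* f)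
  regroup = solve-∀
  at-i : zFactor (suc i ∷ parts κ) i ≡ suc i ℕ.* suc m ℕ.* zFactor (parts κ) i
  at-i = ≡.trans (cong (λ o → suc i ℕ.^ o ℕ.* o !) (occurrences-∷-≡ (suc i) (parts κ))) (regroup (suc i) (suc i ℕ.^ m) (suc m)
      (m !))

z-positive : ∀ μ → 0 < z μ
z-positive μ = product-positive (size μ) (λ j → ℕ.*-mono-≤ (ℕ.m^n>0 (suc j) (occurrences (suc j) (parts μ)))
    (ℕ.1≤n! (occurrences (suc j) (parts μ))))
  where
  product-positive : ∀ {f : ℕ → ℕ} n → (∀ j → 0 < f j) → 0 < product (applyUpTo f n)
  product-positive zero    f>0 = s≤s z≤n
  product-positive (suc n) f>0 = ℕ.*-mono-≤ (f>0 0) (product-positive n (f>0 ∘ suc))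

-- Power sums, formal expansions and the scalar product.

module SymmetricFunctions (K : PositiveField) (α : PositiveField.Carrier K) where

  open FieldTheory K

  δ : List ℕ → List ℕ → Carrier
  δ xs ys = indicator (xs ≟ₗ ys)

  PowerSeries : Set
  PowerSeries = Monomial → Carrier

  infix 4 _≈ₛ_
  _≈ₛ_ : PowerSeries → PowerSeries → Set
  f ≈ₛ g = ∀ e → f e ≈ g e

  1ₛ : PowerSeries
  1ₛ e = δ (nonzeroExponents e) []

  infixl 7 _*ₛ_
  _*ₛ_ : PowerSeries → PowerSeries → PowerSeries
  (f *ₛ g) e = ∑ (factorisations e) (λ (a , b) → f a * g b)

  powerSum : ℕ → PowerSeries
  powerSum k e = δ (nonzeroExponents e) [ k ]

  powerSums : List ℕ → PowerSeries
  powerSums = foldr (λ k f → powerSum k *ₛ f) 1ₛ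

  p[_] m[_] : Partition → PowerSeries
  p[ κ ] = powerSums (parts κ)
  m[ κ ] e = δ (sort↓ (nonzeroExponents e)) (parts κ)

  δ-sym : ∀ xs ys → δ xs ys ≈ δ ys xs
  δ-sym xs ys = indicator-⇔ (xs ≟ₗ ys) (ys ≟ₗ xs) ≡.sym ≡.sym

  δ-parts : ∀ κ μ → δ (parts κ) (parts μ) ≈ indicator (κ ≟ₚ μ)
  δ-parts κ μ = indicator-⇔ (parts κ ≟ₗ parts μ) (κ ≟ₚ μ) parts-injective (cong parts)

  -- Products with power sums

  ∑-factorisations-∷ : ∀ x e (h : Monomial × Monomial → Carrier) →
    ∑ (factorisations (x ∷ e)) h ≈
    ∑ (factorisations e) (λ (a , b) → h (0 ∷ a , x ∷ b)) +
    ∑ (upTo x) (λ j → ∑ (factorisations e) (λ (a , b) → h (suc j ∷ a , (x ∸ suc j) ∷ b)))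
  ∑-factorisations-∷ x e h = trans
    (∑-concatMap (λ i → map (λ (a , b) → i ∷ a , (x ∸ i) ∷ b) (factorisations e)) (upTo (suc x)) h)
    (+-cong (reflexive (∑-map _ (factorisations e) h))
      (trans (reflexive (cong (λ l → ∑ l (λ i → ∑ (map (λ (a , b) → i ∷ a , (x ∸ i) ∷ b) (factorisations e)) h))
          (≡.sym (map-upTo suc x))))
        (trans (reflexive (∑-map suc (upTo x) _)) (∑-cong (upTo x) (λ j → reflexive (∑-map _ (factorisations e) h))))))

  1ₛ-* : ∀ (f : PowerSeries) → 1ₛ *ₛ f ≈ₛ f
  1ₛ-* f []      = trans (+-identityʳ _) (*-identityˡ _)
  1ₛ-* f (x ∷ e) = begin
    (1ₛ *ₛ f) (x ∷ e)
      ≈⟨ ∑-factorisations-∷ x e _ ⟩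
    (1ₛ *ₛ (f ∘ (x ∷_))) e + ∑ (upTo x) (λ j → ∑ (factorisations e) (λ (a , b) → 0# * f ((x ∸ suc j) ∷ b)))
      ≈⟨ +-cong (1ₛ-* (f ∘ (x ∷_)) e) (∑-0 (upTo x) (λ j _ → ∑-0 (factorisations e) (λ _ _ → zeroˡ _))) ⟩
    f (x ∷ e) + 0#
      ≈⟨ +-identityʳ _ ⟩
    f (x ∷ e) ∎

  -- For k > 0 this is multiplication by p_k, as `powerSum-*` shows: a factor xᵢ^k is split off in
  -- all possible ways.
  lower : ℕ → PowerSeries → PowerSeries
  lower k f e = ∑ (lowered k e) f

  lower-∷ : ∀ k f x e → lower k f (x ∷ e) ≈ indicator (k ℕ.≤? x) * f ((x ∸ k) ∷ e) + lower k (f ∘ (x ∷_)) e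
  lower-∷ k f x e = trans (∑-++ (if does (k ℕ.≤? x) then [ (x ∸ k) ∷ e ] else []) (map (x ∷_) (lowered k e)) f)
    (+-cong (head (k ℕ.≤? x)) (reflexive (∑-map (x ∷_) (lowered k e) f)))
    where
    head : (≤? : Dec (k ≤ x)) → ∑ (if does ≤? then [ (x ∸ k) ∷ e ] else []) f ≈ indicator ≤? * f ((x ∸ k) ∷ e)
    head (yes _) = trans (+-identityʳ _) (sym (*-identityˡ _))
    head (no _)  = sym (zeroˡ _)

  lower-cong : ∀ k e {f g} → (∀ e′ → e′ ∈ lowered k e → f e′ ≈ g e′) → lower k f e ≈ lower k g e
  lower-cong k e = ∑-cong-∈ (lowered k e)

  powerSum-* : ∀ k f → powerSum (suc k) *ₛ f ≈ₛ lower (suc k) f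
  powerSum-* k f []      = trans (+-identityʳ _) (zeroˡ _)
  powerSum-* k f (x ∷ e) = begin
    (powerSum (suc k) *ₛ f) (x ∷ e)
      ≈⟨ ∑-factorisations-∷ x e _ ⟩
    (powerSum (suc k) *ₛ (f ∘ (x ∷_))) e +
      ∑ (upTo x) (λ j → ∑ (factorisations e) (λ (a , b) → δ (suc j ∷ nonzeroExponents a) [ suc k ] * f ((x ∸ suc j) ∷ b)))
      -- A monomial of p_(k+1) whose first exponent is suc j has no other variable; so j = k, and on
      -- the remaining variables the factor acts as `1ₛ`.
      ≈⟨ +-cong (powerSum-* k (f ∘ (x ∷_)) e) (trans (∑-cong (upTo x) (λ j →
           trans (∑-cong (factorisations e) (λ (a , b) → trans (*-congʳ (indicator-*
                   ((suc j ∷ nonzeroExponents a) ≟ₗ [ suc k ]) (k ℕ.≟ j) (nonzeroExponents a ≟ₗ [])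
                   (λ eq → ≡.sym (ℕ.suc-injective (∷-injectiveˡ eq)) , ∷-injectiveʳ eq) (λ k≡j → cong₂ (λ l → suc l ∷_)
                       (≡.sym k≡j)))) (*-assoc _ _ _)))
             (trans (∑-*ˡ _ (factorisations e) _) (*-congˡ (1ₛ-* (f ∘ ((x ∸ suc j) ∷_)) e))))) (single (suc k ℕ.≤? x))) ⟩
    lower (suc k) (f ∘ (x ∷_)) e + indicator (suc k ℕ.≤? x) * f ((x ∸ suc k) ∷ e)
      ≈⟨ +-comm _ _ ⟩
    indicator (suc k ℕ.≤? x) * f ((x ∸ suc k) ∷ e) + lower (suc k) (f ∘ (x ∷_)) e
      ≈⟨ lower-∷ (suc k) f x e ⟨
    lower (suc k) f (x ∷ e) ∎
    where
    single : (k<x? : Dec (k < x)) → ∑ (upTo x) (λ j → indicator (k ℕ.≟ j) * f ((x ∸ suc j) ∷ e)) ≈ indicator k<x? * f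
        ((x ∸ suc k) ∷ e)
    single (yes k<x) = trans (∑-indicator-∈ ℕ._≟_ (λ j → f ((x ∸ suc j) ∷ e)) (Unique.upTo⁺ x) (∈-upTo⁺ k<x))
        (sym (*-identityˡ _))
    single (no k≮x)  = trans (∑-indicator-∉ ℕ._≟_ (upTo x) k _ (k≮x ∘ ∈-upTo⁻)) (sym (zeroˡ _))

  powerSums-∷ : ∀ k ks → powerSums (suc k ∷ ks) ≈ₛ lower (suc k) (powerSums ks)
  powerSums-∷ k ks = powerSum-* k (powerSums ks)

  lower-+ : ∀ k f g e → lower k (λ e′ → f e′ + g e′) e ≈ lower k f e + lower k g e
  lower-+ k f g e = ∑-+ (lowered k e) f g

  -- Multiplications by p_k and p_l commute. At the first variable both, one or none of the two
  -- lowerings take place, and each of these cases is symmetric.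
  lower-swap : ∀ k l f → lower k (lower l f) ≈ₛ lower l (lower k f)
  lower-swap k l f []      = refl
  lower-swap k l f (x ∷ e) = begin
    lower k (lower l f) (x ∷ e)
      ≈⟨ expand k l ⟩
    twice k l + (once k l + once l k) + lower k (lower l (f ∘ (x ∷_))) e
      ≈⟨ +-cong (+-cong twice-swap (+-comm _ _)) (lower-swap k l (f ∘ (x ∷_)) e) ⟩
    twice l k + (once l k + once k l) + lower l (lower k (f ∘ (x ∷_))) e
      ≈⟨ expand l k ⟨
    lower l (lower k f) (x ∷ e) ∎
    where
    once twice : ℕ → ℕ → Carrier
    once k l = indicator (k ℕ.≤? x) * lower l (f ∘ ((x ∸ k) ∷_)) e
    twice k l = indicator (k ℕ.≤? x) * (indicator (l ℕ.≤? x ∸ k) * f ((x ∸ k ∸ l) ∷ e))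
    expand : ∀ k l → lower k (lower l f) (x ∷ e) ≈ twice k l + (once k l + once l k) + lower k (lower l (f ∘ (x ∷_))) e
    expand k l = begin
      lower k (lower l f) (x ∷ e)
        ≈⟨ lower-∷ k (lower l f) x e ⟩
      indicator (k ℕ.≤? x) * lower l f ((x ∸ k) ∷ e) + lower k (lower l f ∘ (x ∷_)) e
        ≈⟨ +-cong (trans (*-congˡ (lower-∷ l f (x ∸ k) e)) (distribˡ _ _ _))
             (trans (lower-cong k e (λ e′ _ → lower-∷ l f x e′)) (trans (lower-+ k _ _ e) (+-congʳ (∑-*ˡ _ (lowered k e) _)))) ⟩
      twice k l + once k l + (once l k + lower k (lower l (f ∘ (x ∷_))) e)
        ≈⟨ solve 4 (λ a b c d → a :+ b :+ (c :+ d) := a :+ (b :+ c) :+ d) refl _ _ _ _ ⟩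
      twice k l + (once k l + once l k) + lower k (lower l (f ∘ (x ∷_))) e ∎
    -- Lowering the same exponent twice depends only on k + l, whence the symmetry.
    twice-≈ : ∀ k l → twice k l ≈ indicator (l ℕ.+ k ℕ.≤? x) * f ((x ∸ (k ℕ.+ l)) ∷ e)
    twice-≈ k l = trans (sym (*-assoc _ _ _)) (*-cong
      (sym (indicator-* (l ℕ.+ k ℕ.≤? x) (k ℕ.≤? x) (l ℕ.≤? x ∸ k)
        (λ l+k≤x → ℕ.≤-trans (ℕ.m≤n+m k l) l+k≤x , ℕ.m+n≤o⇒m≤o∸n l l+k≤x) ((λ k≤x → ℕ.m≤o∸n⇒m+n≤o l k≤x))))
      (reflexive (cong (λ y → f (y ∷ e)) (ℕ.∸-+-assoc x k l))))
    twice-swap : twice k l ≈ twice l k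
    twice-swap = trans (twice-≈ k l) (trans
      (reflexive (cong₂ (λ a b → indicator (a ℕ.≤? x) * f ((x ∸ b) ∷ e)) (ℕ.+-comm l k) (ℕ.+-comm k l))) (sym (twice-≈ l k)))

  powerSums-↭ : ∀ {ks ls} → ks ↭ ls → All (0 <_) ks → powerSums ks ≈ₛ powerSums ls
  powerSums-↭ ↭.refl ks>0 e = refl
  powerSums-↭ {suc k ∷ ks} {_ ∷ ls} (↭.prep _ p) (_ ∷ ks>0) e = trans (powerSums-∷ k ks e)
    (trans (lower-cong (suc k) e (λ e′ _ → powerSums-↭ p ks>0 e′)) (sym (powerSums-∷ k ls e)))
  powerSums-↭ {suc k ∷ suc l ∷ ks} {_ ∷ _ ∷ ls} (↭.swap _ _ p) (_ ∷ _ ∷ ks>0) e = begin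
    powerSums (suc k ∷ suc l ∷ ks) e
      ≈⟨ trans (powerSums-∷ k (suc l ∷ ks) e) (lower-cong (suc k) e (λ e′ _ → powerSums-∷ l ks e′)) ⟩
    lower (suc k) (lower (suc l) (powerSums ks)) e
      ≈⟨ lower-swap (suc k) (suc l) (powerSums ks) e ⟩
    lower (suc l) (lower (suc k) (powerSums ks)) e
      ≈⟨ lower-cong (suc l) e (λ e′ _ → trans (lower-cong (suc k) e′ (λ e″ _ → powerSums-↭ p ks>0 e″))
          (sym (powerSums-∷ k ls e′))) ⟩
    lower (suc l) (powerSums (suc k ∷ ls)) e
      ≈⟨ powerSums-∷ l (suc k ∷ ls) e ⟨
    powerSums (suc l ∷ suc k ∷ ls) e ∎
  powerSums-↭ (↭.trans p q) ks>0 e = trans (powerSums-↭ p ks>0 e) (powerSums-↭ q (All-resp-↭ p ks>0) e)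

  -- Each factor contributes its part to a single variable. If two factors choose the same variable,
  -- fewer than `length ks` exponents are nonzero; otherwise the exponents are the parts themselves.
  powerSums-support : ∀ ks → All (0 <_) ks → ∀ e →
    powerSums ks e ≈ 0# ⊎ (length (nonzeroExponents e) < length ks ⊎ nonzeroExponents e ↭ ks)
  powerSums-support []           []         e with nonzeroExponents e ≟ₗ []
  ... | yes eq = inj₂ (inj₂ (↭-reflexive eq))
  ... | no _   = inj₁ refl
  powerSums-support (suc k ∷ ks) (_ ∷ ks>0) e = Sum.map (trans (powerSums-∷ k ks e)) id
    (∑-≈0-or (lowered (suc k) e) (λ e′ e′∈ → Sum.map id (raise e′ e′∈) (powerSums-support ks ks>0 e′)))
    where
    raise : ∀ e′ → e′ ∈ lowered (suc k) e → length (nonzeroExponents e′) < length ks ⊎ nonzeroExponents e′ ↭ ks →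
      length (nonzeroExponents e) < suc (length ks) ⊎ nonzeroExponents e ↭ suc k ∷ ks
    raise e′ e′∈ h with lowered-nonzeroExponents k e e′∈ | h
    ... | inj₁ len | inj₁ lt = inj₁ (ℕ.m<n⇒m<1+n (subst (_< length ks) (≡.sym len) lt))
    ... | inj₁ len | inj₂ p  = inj₁ (s≤s (ℕ.≤-reflexive (≡.trans len (↭-length p))))
    ... | inj₂ q   | inj₁ lt = inj₁ (subst (_< suc (length ks)) (≡.sym (↭-length q)) (s≤s lt))
    ... | inj₂ q   | inj₂ p  = inj₂ (↭-trans q (prep (suc k) p))

  indicator-nonNegative : {Q : Set} (Q? : Dec Q) → NonNegative (indicator Q?)
  indicator-nonNegative (yes _) = inj₂ positive-1
  indicator-nonNegative (no _)  = inj₁ refl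

  nonNegative-resp : ∀ {x y} → x ≈ y → NonNegative x → NonNegative y
  nonNegative-resp x≈y = Sum.map (trans (sym x≈y)) (positive-resp x≈y)

  powerSums-nonNegative : ∀ ks → All (0 <_) ks → ∀ e → NonNegative (powerSums ks e)
  powerSums-nonNegative []           []         e = indicator-nonNegative (nonzeroExponents e ≟ₗ [])
  powerSums-nonNegative (suc k ∷ ks) (_ ∷ ks>0) e = nonNegative-resp (sym (powerSums-∷ k ks e))
    (∑-nonNegative (lowered (suc k) e) (powerSums-nonNegative ks ks>0))

  powerSums-0∷ : ∀ ks → All (0 <_) ks → ∀ e → powerSums ks (0 ∷ e) ≈ powerSums ks e
  powerSums-0∷ []           []         e = refl
  powerSums-0∷ (suc k ∷ ks) (_ ∷ ks>0) e = begin
    powerSums (suc k ∷ ks) (0 ∷ e)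
      ≈⟨ trans (powerSums-∷ k ks (0 ∷ e)) (lower-∷ (suc k) (powerSums ks) 0 e) ⟩
    0# * powerSums ks (0 ∷ e) + lower (suc k) (powerSums ks ∘ (0 ∷_)) e
      ≈⟨ trans (+-congʳ (zeroˡ _)) (+-identityˡ _) ⟩
    lower (suc k) (powerSums ks ∘ (0 ∷_)) e
      ≈⟨ lower-cong (suc k) e (λ e′ _ → powerSums-0∷ ks ks>0 e′) ⟩
    lower (suc k) (powerSums ks) e
      ≈⟨ powerSums-∷ k ks e ⟨
    powerSums (suc k ∷ ks) e ∎

  -- Positivity stands in for the exact value, the product of the factorials of the multiplicities:
  -- one term is positive by induction and the others are nonnegative.
  powerSums-diagonal : ∀ ks → All (0 <_) ks → Positive (powerSums ks ks)
  powerSums-diagonal []           []         = positive-1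
  powerSums-diagonal (suc k ∷ ks) (_ ∷ ks>0) = positive-resp
    (sym (trans (powerSums-∷ k ks (suc k ∷ ks)) (lower-∷ (suc k) (powerSums ks) (suc k) ks)))
    (positive-+-nonNegative
      (positive-resp (sym (trans (indicator-*-yes (suc k ℕ.≤? suc k) ℕ.≤-refl)
        (trans (reflexive (cong (λ y → powerSums ks (y ∷ ks)) (ℕ.n∸n≡0 k))) (powerSums-0∷ ks ks>0 ks))))
            (powerSums-diagonal ks ks>0))
      (∑-nonNegative (lowered (suc k) ks) (λ e′ → powerSums-nonNegative ks ks>0 (suc k ∷ e′))))

  -- In a single variable x every p_k becomes x^k, so the product is x to the power of the size.
  powerSums-[n] : ∀ ks → All (0 <_) ks → ∀ n → powerSums ks [ n ] ≈ indicator (sum ks ℕ.≟ n)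
  powerSums-[n] []           []         zero    = refl
  powerSums-[n] []           []         (suc n) = refl
  powerSums-[n] (suc k ∷ ks) (_ ∷ ks>0) n = begin
    powerSums (suc k ∷ ks) [ n ]
      ≈⟨ trans (powerSums-∷ k ks [ n ]) (lower-∷ (suc k) (powerSums ks) n []) ⟩
    indicator (suc k ℕ.≤? n) * powerSums ks [ n ∸ suc k ] + 0#
      ≈⟨ trans (+-identityʳ _) (*-congˡ (powerSums-[n] ks ks>0 (n ∸ suc k))) ⟩
    indicator (suc k ℕ.≤? n) * indicator (sum ks ℕ.≟ n ∸ suc k)
      ≈⟨ indicator-* (sum (suc k ∷ ks) ℕ.≟ n) (suc k ℕ.≤? n) (sum ks ℕ.≟ n ∸ suc k)
           (λ { ≡.refl → ℕ.m≤m+n (suc k) (sum ks) , ≡.sym (ℕ.m+n∸m≡n (suc k) (sum ks)) })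
           (λ k<n eq → ≡.trans (cong (suc k ℕ.+_) eq) (ℕ.m+[n∸m]≡n k<n)) ⟨
    indicator (sum (suc k ∷ ks) ℕ.≟ n) ∎

  -- Formal linear combinations of partitions

  Combination : Set
  Combination = List (Carrier × Partition)

  evaluate : (Partition → Carrier) → Combination → Carrier
  evaluate φ c = ∑ c (λ (a , κ) → a * φ κ)

  coefficient : Combination → List ℕ → Carrier
  coefficient c xs = ∑ c (λ (a , κ) → a * δ (parts κ) xs)

  expand : (Partition → PowerSeries) → Combination → PowerSeries
  expand basis c e = evaluate (λ κ → basis κ e) c

  infixr 7 _⊛_
  _⊛_ : Carrier → Combination → Combination
  s ⊛ c = map (λ (a , κ) → s * a , κ) c

  substitute : (Partition → Combination) → Combination → Combination
  substitute σ c = concatMap (λ (a , κ) → a ⊛ σ κ) c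

  evaluate-cong : ∀ c {φ ψ} → (∀ κ → φ κ ≈ ψ κ) → evaluate φ c ≈ evaluate ψ c
  evaluate-cong c φ≈ψ = ∑-cong c (λ (a , κ) → *-congˡ (φ≈ψ κ))

  evaluate-++ : ∀ φ c d → evaluate φ (c ++ d) ≈ evaluate φ c + evaluate φ d
  evaluate-++ φ c d = ∑-++ c d _

  evaluate-⊛ : ∀ φ s c → evaluate φ (s ⊛ c) ≈ s * evaluate φ c
  evaluate-⊛ φ s c = trans (reflexive (∑-map _ c _)) (trans (∑-cong c (λ _ → *-assoc _ _ _)) (∑-*ˡ s c _))

  evaluate-substitute : ∀ φ σ c → evaluate φ (substitute σ c) ≈ evaluate (λ κ → evaluate φ (σ κ)) c
  evaluate-substitute φ σ c = trans (∑-concatMap (λ (a , κ) → a ⊛ σ κ) c _) (∑-cong c (λ (a , κ) → evaluate-⊛ φ a (σ κ)))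

  evaluate-* : ∀ φ s c → evaluate (λ κ → s * φ κ) c ≈ s * evaluate φ c
  evaluate-* φ s c = trans (∑-cong c (λ (a , κ) → solve 3 (λ a s f → a :* (s :* f) := s :* (a :* f)) refl a s (φ κ)))
      (∑-*ˡ s c _)

  support : Combination → List Partition
  support c = map proj₂ c

  evaluate-∉ : ∀ φ c → (∀ {κ} → κ ∈ support c → φ κ ≈ 0#) → evaluate φ c ≈ 0#
  evaluate-∉ φ c φ≈0 = ∑-0 c (λ x x∈ → trans (*-congˡ (φ≈0 (∈-map⁺ proj₂ x∈))) (zeroʳ _))

  coefficient-∉ : ∀ c μ → μ ∉ support c → coefficient c (parts μ) ≈ 0#
  coefficient-∉ c μ μ∉ = evaluate-∉ (λ κ → δ (parts κ) (parts μ)) c (λ {κ} κ∈ → trans (δ-parts κ μ)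
    (indicator-no (κ ≟ₚ μ) (λ κ≡μ → μ∉ (subst (_∈ support c) κ≡μ κ∈))))

  keys : Combination → List Partition
  keys c = deduplicate _≟ₚ_ (support c)

  keys-unique : ∀ c → Unique (keys c)
  keys-unique c = UniqueDec.deduplicate-! _≟ₚ_ (support c)

  keys-∈⁺ : ∀ c {κ} → κ ∈ support c → κ ∈ keys c
  keys-∈⁺ c = ∈-deduplicate⁺ _≟ₚ_

  keys-∉ : ∀ c {μ} → μ ∉ keys c → coefficient c (parts μ) ≈ 0#
  keys-∉ c {μ} μ∉ = coefficient-∉ c μ (μ∉ ∘ keys-∈⁺ c)

  -- A formal combination may repeat a partition, and only its total coefficients have a meaning.
  -- Here they are made visible by summing over distinct partitions.
  collect : ∀ φ c → evaluate φ c ≈ ∑ (keys c) (λ κ → coefficient c (parts κ) * φ κ)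
  collect φ c = collect-in c (keys-∈⁺ c)
    where
    -- The index set `keys c` stays fixed while the combination shrinks.
    collect-in : ∀ d → (∀ {κ} → κ ∈ support d → κ ∈ keys c) →
      evaluate φ d ≈ ∑ (keys c) (λ κ → coefficient d (parts κ) * φ κ)
    collect-in []            incl = sym (∑-0 (keys c) (λ _ _ → zeroˡ _))
    collect-in ((a , κ) ∷ d) incl = begin
      a * φ κ + evaluate φ d
        ≈⟨ +-cong (*-congˡ (sym (∑-indicator-∈ _≟ₚ_ φ (keys-unique c) (incl (here ≡.refl))))) (collect-in d (incl ∘ there)) ⟩
      a * ∑ (keys c) (λ μ → indicator (κ ≟ₚ μ) * φ μ) + ∑ (keys c) (λ μ → coefficient d (parts μ) * φ μ)
        ≈⟨ +-congʳ (∑-*ˡ a (keys c) _) ⟨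
      ∑ (keys c) (λ μ → a * (indicator (κ ≟ₚ μ) * φ μ)) + ∑ (keys c) (λ μ → coefficient d (parts μ) * φ μ)
        ≈⟨ ∑-+ (keys c) _ _ ⟨
      ∑ (keys c) (λ μ → a * (indicator (κ ≟ₚ μ) * φ μ) + coefficient d (parts μ) * φ μ)
        ≈⟨ ∑-cong (keys c) (λ μ → trans (+-congʳ (trans (sym (*-assoc _ _ _)) (*-congʳ (*-congˡ (sym (δ-parts κ μ))))))
            (sym (distribʳ _ _ _))) ⟩
      ∑ (keys c) (λ μ → coefficient ((a , κ) ∷ d) (parts μ) * φ μ) ∎

  evaluate-coefficient≈0 : ∀ φ c → (∀ μ → coefficient c (parts μ) ≈ 0#) → evaluate φ c ≈ 0#
  evaluate-coefficient≈0 φ c c≈0 = trans (collect φ c) (∑-0 (keys c) (λ κ _ → trans (*-congʳ (c≈0 κ)) (zeroˡ _)))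

  -- Linear independence of the power sums: p[ κ ] contains the monomial of
  -- shape μ only if κ = μ or κ has more parts than μ.
  powerSums-independent : ∀ c → (∀ e → expand p[_] c e ≈ 0#) → ∀ μ → coefficient c (parts μ) ≈ 0#
  powerSums-independent c c≈0 μ = induct bound μ (ℕ.m≤n+m bound _)
    where
    len : Partition → ℕ
    len κ = length (parts κ)
    -- The induction descends on the number of parts: no partition in `c` has `bound` or more parts,
    -- and `d` measures how many parts μ lacks.
    bound = suc (sum (map len (support c)))
    induct : ∀ d μ → bound ≤ len μ ℕ.+ d → coefficient c (parts μ) ≈ 0#
    induct zero μ bound≤ = coefficient-∉ c μ (λ μ∈ → ℕ.<⇒≱ (s≤s (∈⇒≤sum (∈-map⁺ len μ∈)))
      (subst (bound ≤_) (ℕ.+-identityʳ (len μ)) bound≤))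
    induct (suc d) μ bound≤ with μ ∈? keys c
    ... | no μ∉  = keys-∉ c μ∉
    ... | yes μ∈ = x*y≈0⇒y≈0 (p[ μ ] (parts μ)) (positive⇒≉0 (powerSums-diagonal (parts μ) (positive μ))) (begin
      p[ μ ] (parts μ) * coefficient c (parts μ)
        ≈⟨ *-comm _ _ ⟩
      coefficient c (parts μ) * p[ μ ] (parts μ)
        ≈⟨ ∑-indicator-∈ _≟ₚ_ (λ κ → coefficient c (parts κ) * p[ κ ] (parts μ)) (keys-unique c) μ∈ ⟨
      ∑ (keys c) (λ κ → indicator (μ ≟ₚ κ) * (coefficient c (parts κ) * p[ κ ] (parts μ)))
        ≈⟨ ∑-cong (keys c) (λ κ → off-diagonal κ (μ ≟ₚ κ)) ⟩
      ∑ (keys c) (λ κ → coefficient c (parts κ) * p[ κ ] (parts μ))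
        ≈⟨ collect (λ κ → p[ κ ] (parts μ)) c ⟨
      expand p[_] c (parts μ)
        ≈⟨ c≈0 (parts μ) ⟩
      0# ∎)
      where
      off-diagonal : ∀ κ (μ≟κ : Dec (μ ≡ κ)) →
        indicator μ≟κ * (coefficient c (parts κ) * p[ κ ] (parts μ)) ≈ coefficient c (parts κ) * p[ κ ] (parts μ)
      off-diagonal κ (yes _)  = *-identityˡ _
      off-diagonal κ (no μ≢κ) = trans (zeroˡ _) (sym vanishes)
        where
        vanishes : coefficient c (parts κ) * p[ κ ] (parts μ) ≈ 0#
        vanishes with powerSums-support (parts κ) (positive κ) (parts μ)
        ... | inj₁ p≈0 = trans (*-congˡ p≈0) (zeroʳ _)
        ... | inj₂ h rewrite nonzeroExponents-all (positive μ) with h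
        ...   | inj₂ p  = contradiction (↭⇒≡ₚ p) μ≢κ
        ...   | inj₁ lt = trans (*-congʳ (induct d κ (ℕ.≤-trans bound≤ (ℕ.≤-trans (ℕ.≤-reflexive (ℕ.+-suc (len μ) d))
                            (ℕ.+-monoˡ-≤ d lt))))) (zeroˡ _)

  powerSums-injective : ∀ c d → expand p[_] c ≈ₛ expand p[_] d → ∀ μ → coefficient c (parts μ) ≈ coefficient d (parts μ)
  powerSums-injective c d c≈d μ = begin
    coefficient c (parts μ)
      ≈⟨ +-identityʳ _ ⟨
    coefficient c (parts μ) + 0#
      ≈⟨ +-congˡ (trans (+-comm _ _) (-‿inverseʳ _)) ⟨
    coefficient c (parts μ) + (- coefficient d (parts μ) + coefficient d (parts μ))
      ≈⟨ +-assoc _ _ _ ⟨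
    coefficient c (parts μ) + - coefficient d (parts μ) + coefficient d (parts μ)
      ≈⟨ +-congʳ (difference (λ κ → δ (parts κ) (parts μ))) ⟨
    coefficient (c ++ (- 1#) ⊛ d) (parts μ) + coefficient d (parts μ)
      ≈⟨ +-congʳ (powerSums-independent (c ++ (- 1#) ⊛ d)
           (λ e → trans (difference (λ κ → p[ κ ] e)) (trans (+-congʳ (c≈d e)) (-‿inverseʳ _))) μ) ⟩
    0# + coefficient d (parts μ)
      ≈⟨ +-identityˡ _ ⟩
    coefficient d (parts μ) ∎
    where
    difference : ∀ φ → evaluate φ (c ++ (- 1#) ⊛ d) ≈ evaluate φ c - evaluate φ d
    difference φ = trans (evaluate-++ φ c _) (+-congˡ (trans (evaluate-⊛ φ (- 1#) d)
      (trans (sym (-‿distribˡ-* 1# _)) (-‿cong (*-identityˡ _)))))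

  -- The scalar product

  norm : Partition → Carrier
  norm κ = fromℕ (z κ) * α ^ length (parts κ)

  ⟨p[_],p[_]⟩ : Partition → Partition → Carrier
  ⟨p[ κ ],p[ μ ]⟩ = δ (parts κ) (parts μ) * norm κ

  ⟨_,_⟩ : Combination → Combination → Carrier
  ⟨ c , d ⟩ = ∑ c (λ (s , κ) → ∑ d (λ (t , μ) → s * t * ⟨p[ κ ],p[ μ ]⟩))

  -- Orthogonality of the power sums collapses the inner sum. The form thus sees `d` only through
  -- its total coefficients.
  ⟨⟩-evaluate : ∀ c d → ⟨ c , d ⟩ ≈ evaluate (λ κ → norm κ * coefficient d (parts κ)) c
  ⟨⟩-evaluate c d = ∑-cong c (λ (s , κ) → begin
    ∑ d (λ (t , μ) → s * t * (δ (parts κ) (parts μ) * norm κ))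
      ≈⟨ ∑-cong d (λ (t , μ) → trans (*-congˡ (*-congʳ (δ-sym (parts κ) (parts μ))))
           (solve 4 (λ s t e n → s :* t :* (e :* n) := s :* n :* (t :* e)) refl s t (δ (parts μ) (parts κ)) (norm κ))) ⟩
    ∑ d (λ (t , μ) → s * norm κ * (t * δ (parts μ) (parts κ)))
      ≈⟨ ∑-*ˡ (s * norm κ) d _ ⟩
    s * norm κ * coefficient d (parts κ)
      ≈⟨ *-assoc _ _ _ ⟩
    s * (norm κ * coefficient d (parts κ)) ∎)

  ⟨p,p⟩-sym : ∀ κ μ → ⟨p[ κ ],p[ μ ]⟩ ≈ ⟨p[ μ ],p[ κ ]⟩
  ⟨p,p⟩-sym κ μ = trans (*-congʳ (δ-parts κ μ)) (trans
    (indicator-*-cong (κ ≟ₚ μ) (λ κ≡μ → reflexive (cong norm κ≡μ)))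
    (*-congʳ (trans (sym (δ-parts κ μ)) (δ-sym (parts κ) (parts μ)))))

  ⟨⟩-sym : ∀ c d → ⟨ c , d ⟩ ≈ ⟨ d , c ⟩
  ⟨⟩-sym c d = trans (∑-swap c d _) (∑-cong d (λ (t , μ) → ∑-cong c (λ (s , κ) → *-cong (*-comm s t) (⟨p,p⟩-sym κ μ))))

  -- By independence of the power sums the form depends only on the series. This reconciles the
  -- different expansions that `orthogonal` supplies for different pairs.
  ⟨⟩-cong : ∀ c c′ d d′ → expand p[_] c ≈ₛ expand p[_] c′ → expand p[_] d ≈ₛ expand p[_] d′ → ⟨ c , d ⟩ ≈ ⟨ c′ , d′ ⟩
  ⟨⟩-cong c c′ d d′ c≈c′ d≈d′ = trans (congʳ c d d′ d≈d′) (trans (⟨⟩-sym c d′) (trans (congʳ d′ c c′ c≈c′) (⟨⟩-sym d′ c′)))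
    where
    congʳ : ∀ c d d′ → expand p[_] d ≈ₛ expand p[_] d′ → ⟨ c , d ⟩ ≈ ⟨ c , d′ ⟩
    congʳ c d d′ d≈d′ = trans (⟨⟩-evaluate c d) (trans
      (evaluate-cong c (λ κ → *-congˡ (powerSums-injective d d′ d≈d′ κ))) (sym (⟨⟩-evaluate c d′)))

  ⟨⟩-substitute : ∀ c σ d → ⟨ c , substitute σ d ⟩ ≈ evaluate (λ κ → ⟨ c , σ κ ⟩) d
  ⟨⟩-substitute c σ d = begin
    ⟨ c , substitute σ d ⟩
      ≈⟨ ⟨⟩-sym c (substitute σ d) ⟩
    ⟨ substitute σ d , c ⟩
      ≈⟨ ⟨⟩-evaluate (substitute σ d) c ⟩
    evaluate (λ κ → norm κ * coefficient c (parts κ)) (substitute σ d)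
      ≈⟨ evaluate-substitute _ σ d ⟩
    evaluate (λ κ → evaluate (λ μ → norm μ * coefficient c (parts μ)) (σ κ)) d
      ≈⟨ evaluate-cong d (λ κ → trans (sym (⟨⟩-evaluate (σ κ) c)) (⟨⟩-sym (σ κ) c)) ⟩
    evaluate (λ κ → ⟨ c , σ κ ⟩) d ∎

  module _ (α>0 : Positive α) where

    norm-positive : ∀ κ → Positive (norm κ)
    norm-positive κ with z κ | z-positive κ
    ... | suc k | _ = positive-* (positive-fromℕ k) (positive-^ (length (parts κ)) α>0)

    -- ⟨c , c⟩ is the sum of norm κ times the square of the coefficient at κ; all norms are
    -- positive, so no terms cancel.
    anisotropic : ∀ c → ⟨ c , c ⟩ ≈ 0# → ∀ μ → coefficient c (parts μ) ≈ 0#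
    anisotropic c ⟨c,c⟩≈0 μ with zero? (coefficient c (parts μ))
    ... | yes c≈0 = c≈0
    ... | no  c≉0 = contradiction
      (∑-nonNegative-≈0 (keys c) nonNegative (trans (sym (trans (⟨⟩-evaluate c c) (collect _ c))) ⟨c,c⟩≈0) μ∈)
      (positive⇒≉0 (positive-term μ c≉0))
      where
      positive-term : ∀ κ → ¬ coefficient c (parts κ) ≈ 0# →
          Positive (coefficient c (parts κ) * (norm κ * coefficient c (parts κ)))
      positive-term κ c≉0 = positive-resp (solve 2 (λ c n → n :* (c :* c) := c :* (n :* c)) refl _ _)
        (positive-* (norm-positive κ) (positive-square c≉0))
      nonNegative : ∀ κ → NonNegative (coefficient c (parts κ) * (norm κ * coefficient c (parts κ)))
      nonNegative κ with zero? (coefficient c (parts κ))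
      ... | yes c≈0 = inj₁ (trans (*-congʳ c≈0) (zeroˡ _))
      ... | no c≉0  = inj₂ (positive-term κ c≉0)
      μ∈ : μ ∈ keys c
      μ∈ with μ ∈? keys c
      ... | yes μ∈ = μ∈
      ... | no μ∉  = contradiction (keys-∉ c μ∉) c≉0

∅ : Partition
∅ = record { parts = [] ; decreasing = [] ; positive = [] }

ones : ℕ → Partition
ones n = record { parts = replicate n 1 ; decreasing = dec n ; positive = All.replicate⁺ n (s≤s z≤n) }
  where
  dec : ∀ n → Linked _≥_ (replicate n 1)
  dec zero          = []
  dec (suc zero)    = [-]
  dec (suc (suc n)) = ℕ.≤-refl ∷ dec (suc n)

size-ones : ∀ n → size (ones n) ≡ n
size-ones zero    = ≡.refl
size-ones (suc n) = cong suc (size-ones n)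

sum≡0⇒[] : ∀ {ks} → All (0 <_) ks → sum ks ≡ 0 → ks ≡ []
sum≡0⇒[] []          _  = ≡.refl
sum≡0⇒[] (s≤s _ ∷ _) ()

-- The series g_n and its expansion in power sums.

module OneRow (K : PositiveField) (α : PositiveField.Carrier K) where

  open FieldTheory K
  open SymmetricFunctions K α

  -- α^m times the coefficient of t^m in (1 - t)^(-1/α).
  u : ℕ → Carrier
  u zero    = 1#
  u (suc m) = (fromℕ (suc m)) ⁻¹ * ((1# + fromℕ m * α) * u m)

  u-suc : ∀ m → fromℕ (suc m) * u (suc m) ≈ (1# + fromℕ m * α) * u m
  u-suc m = trans (sym (*-assoc _ _ _)) (trans (*-congʳ (⁻¹-inverseʳ _ (fromℕ≉0 (suc m) (s≤s z≤n)))) (*-identityˡ _))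

  u-1 : u 1 ≈ 1#
  u-1 = begin
    u 1                        ≈⟨ *-identityˡ _ ⟨
    1# * u 1                   ≈⟨ *-congʳ fromℕ-1 ⟨
    fromℕ 1 * u 1              ≈⟨ u-suc 0 ⟩
    (1# + 0# * α) * 1#         ≈⟨ trans (*-identityʳ _) (trans (+-congˡ (zeroˡ α)) (+-identityʳ _)) ⟩
    1#                         ∎

  -- This is g_n: α^n times the degree n part of ∏ (1 - xᵢ)^(-1/α).
  oneRow : ℕ → PowerSeries
  oneRow n e = indicator (sum e ℕ.≟ n) * ∏ e u

  ∏-nonzeroExponents : ∀ e → ∏ e u ≈ ∏ (nonzeroExponents e) u
  ∏-nonzeroExponents []          = refl
  ∏-nonzeroExponents (zero ∷ e)  = trans (*-identityˡ _) (∏-nonzeroExponents e)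
  ∏-nonzeroExponents (suc k ∷ e) = *-congˡ (∏-nonzeroExponents e)

  oneRow-shape : ∀ n e → oneRow n (parts (shape e)) ≈ oneRow n e
  oneRow-shape n e = *-cong (reflexive (cong (λ s → indicator (s ℕ.≟ n)) (size-shape e)))
    (trans (∏-↭ u (shape-↭ e)) (sym (∏-nonzeroExponents e)))

  upTo-suc : ∀ n (f : ℕ → Carrier) → ∑ (upTo (suc n)) f ≈ f 0 + ∑ (upTo n) (f ∘ suc)
  upTo-suc n f = +-congˡ (trans (reflexive (cong (λ l → ∑ l f) (≡.sym (map-upTo suc n)))) (reflexive (∑-map suc (upTo n) f)))

  -- The series U(t) = Σ u m t^m = (1 - α t)^(-1/α) satisfies U′ = U / (1 - α t). Here the
  -- coefficients of t^x in t U′ are compared, with the geometric series expanded.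
  ∑-u : ∀ n x → x ≤ n → ∑ (upTo n) (λ i → α ^ i * (indicator (suc i ℕ.≤? x) * u (x ∸ suc i))) ≈ fromℕ x * u x
  ∑-u n       zero    x≤n       = trans (∑-0 (upTo n) (λ i _ → trans (*-congˡ (zeroˡ _)) (zeroʳ _))) (sym (zeroˡ _))
  ∑-u (suc n) (suc x) (s≤s x≤n) = begin
    ∑ (upTo (suc n)) (λ i → α ^ i * (indicator (suc i ℕ.≤? suc x) * u (suc x ∸ suc i)))
      ≈⟨ upTo-suc n _ ⟩
    1# * (1# * u x) + ∑ (upTo n) (λ i → α * α ^ i * (indicator (suc (suc i) ℕ.≤? suc x) * u (x ∸ suc i)))
      ≈⟨ +-cong (trans (*-identityˡ _) (*-identityˡ _))
          (trans (∑-cong (upTo n) (λ i → trans (*-assoc _ _ _) (*-congˡ (*-congˡ (*-congʳ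
           (indicator-⇔ (suc (suc i) ℕ.≤? suc x) (suc i ℕ.≤? x) ℕ.≤-pred s≤s)))))) (∑-*ˡ α (upTo n) _)) ⟩
    u x + α * ∑ (upTo n) (λ i → α ^ i * (indicator (suc i ℕ.≤? x) * u (x ∸ suc i)))
      ≈⟨ +-cong (sym (*-identityˡ _)) (*-congˡ (∑-u n x x≤n)) ⟩
    1# * u x + α * (fromℕ x * u x)
      ≈⟨ solve 4 (λ o a x u → o :* u :+ a :* (x :* u) := (o :+ x :* a) :* u) refl 1# α (fromℕ x) (u x) ⟩
    (1# + fromℕ x * α) * u x
      ≈⟨ u-suc x ⟨
    fromℕ (suc x) * u (suc x) ∎

  -- The product rule: each variable contributes its own instance of `∑-u`, and the exponents add up
  -- to the degree.
  ∑-lower-∏ : ∀ n e → sum e ≤ n →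
    ∑ (upTo n) (λ i → α ^ i * lower (suc i) (λ e′ → ∏ e′ u) e) ≈ fromℕ (sum e) * ∏ e u
  ∑-lower-∏ n []      ∑≤n = trans (∑-0 (upTo n) (λ _ _ → zeroʳ _)) (sym (zeroˡ _))
  ∑-lower-∏ n (x ∷ e) ∑≤n = begin
    ∑ (upTo n) (λ i → α ^ i * lower (suc i) (λ e′ → ∏ e′ u) (x ∷ e))
      ≈⟨ ∑-cong (upTo n) (λ i → trans (*-congˡ (trans (lower-∷ (suc i) (λ e′ → ∏ e′ u) x e)
          (+-congˡ (∑-*ˡ (u x) (lowered (suc i) e) _))))
           (solve 6 (λ a d v p x l → a :* (d :* (v :* p) :+ x :* l) := a :* (d :* v) :* p :+ x :* (a :* l)) refl
             (α ^ i) (indicator (suc i ℕ.≤? x)) (u (x ∸ suc i)) (∏ e u) (u x) _)) ⟩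
    ∑ (upTo n) (λ i → α ^ i * (indicator (suc i ℕ.≤? x) * u (x ∸ suc i)) * ∏ e u +
                      u x * (α ^ i * lower (suc i) (λ e′ → ∏ e′ u) e))
      ≈⟨ trans (∑-+ (upTo n) _ _) (+-cong (∑-*ʳ (∏ e u) (upTo n) _) (∑-*ˡ (u x) (upTo n) _)) ⟩
    ∑ (upTo n) (λ i → α ^ i * (indicator (suc i ℕ.≤? x) * u (x ∸ suc i))) * ∏ e u +
      u x * ∑ (upTo n) (λ i → α ^ i * lower (suc i) (λ e′ → ∏ e′ u) e)
      ≈⟨ +-cong (*-congʳ (∑-u n x (ℕ.≤-trans (ℕ.m≤m+n x (sum e)) ∑≤n)))
          (*-congˡ (∑-lower-∏ n e (ℕ.≤-trans (ℕ.m≤n+m (sum e) x) ∑≤n))) ⟩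
    fromℕ x * u x * ∏ e u + u x * (fromℕ (sum e) * ∏ e u)
      ≈⟨ solve 4 (λ x u p s → x :* u :* p :+ u :* (s :* p) := (x :+ s) :* (u :* p)) refl (fromℕ x) (u x) (∏ e u)
          (fromℕ (sum e)) ⟩
    (fromℕ x + fromℕ (sum e)) * ∏ (x ∷ e) u
      ≈⟨ *-congʳ (fromℕ-+ x (sum e)) ⟨
    fromℕ (sum (x ∷ e)) * ∏ (x ∷ e) u ∎

  degree-shift : ∀ {m i s t} → i ≤ m → s ≡ suc i ℕ.+ t → indicator (t ℕ.≟ m ∸ i) ≈ indicator (s ℕ.≟ suc m)
  degree-shift {m} {i} {s} {t} i≤m s≡ = indicator-⇔ (t ℕ.≟ m ∸ i) (s ℕ.≟ suc m)
    (λ t≡ → ≡.trans s≡ (≡.trans (cong (suc i ℕ.+_) t≡) (cong suc (ℕ.m+[n∸m]≡n i≤m))))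
    (λ s≡′ → ≡.trans (≡.sym (ℕ.m+n∸m≡n (suc i) t)) (cong (_∸ suc i) (≡.trans (≡.sym s≡) s≡′)))

  -- Newton's identity for the complete symmetric functions, in disguise.
  oneRow-recursion : ∀ m e →
    ∑ (upTo (suc m)) (λ i → α ^ i * lower (suc i) (oneRow (m ∸ i)) e) ≈ fromℕ (suc m) * oneRow (suc m) e
  oneRow-recursion m e = begin
    ∑ (upTo (suc m)) (λ i → α ^ i * lower (suc i) (oneRow (m ∸ i)) e)
      ≈⟨ ∑-cong-∈ (upTo (suc m)) (λ i i∈ → trans (*-congˡ (trans (lower-cong (suc i) e (λ e′ e′∈ →
             *-congʳ (degree-shift (ℕ.≤-pred (∈-upTo⁻ i∈)) (lowered-sum (suc i) e e′∈)))) (∑-*ˡ _ (lowered (suc i) e) _)))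
           (solve 3 (λ a d l → a :* (d :* l) := d :* (a :* l)) refl (α ^ i) (indicator (sum e ℕ.≟ suc m)) _)) ⟩
    ∑ (upTo (suc m)) (λ i → indicator (sum e ℕ.≟ suc m) * (α ^ i * lower (suc i) (λ e′ → ∏ e′ u) e))
      ≈⟨ ∑-*ˡ _ (upTo (suc m)) _ ⟩
    indicator (sum e ℕ.≟ suc m) * ∑ (upTo (suc m)) (λ i → α ^ i * lower (suc i) (λ e′ → ∏ e′ u) e)
      ≈⟨ indicator-*-cong (sum e ℕ.≟ suc m) (λ ∑≡ → trans (∑-lower-∏ (suc m) e (ℕ.≤-reflexive ∑≡)) (*-congʳ (fromℕ-cong ∑≡))) ⟩
    indicator (sum e ℕ.≟ suc m) * (fromℕ (suc m) * ∏ e u)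
      ≈⟨ solve 3 (λ d n p → d :* (n :* p) := n :* (d :* p)) refl _ _ _ ⟩
    fromℕ (suc m) * oneRow (suc m) e ∎

  adjoin : ℕ → Combination → Combination
  adjoin i c = map (λ (s , κ) → s , 1+ i ∷ₚ κ) c

  evaluate-adjoin : ∀ φ i c → evaluate φ (adjoin i c) ≈ evaluate (λ κ → φ (1+ i ∷ₚ κ)) c
  evaluate-adjoin φ i c = reflexive (∑-map _ c _)

  expand-adjoin : ∀ i c e → expand p[_] (adjoin i c) e ≈ lower (suc i) (expand p[_] c) e
  expand-adjoin i c e = begin
    expand p[_] (adjoin i c) e
      ≈⟨ evaluate-adjoin (λ κ → p[ κ ] e) i c ⟩
    evaluate (λ κ → p[ 1+ i ∷ₚ κ ] e) c
      ≈⟨ evaluate-cong c (λ κ → trans (powerSums-↭ (∷ₚ-↭ i κ) (positive (1+ i ∷ₚ κ)) e) (powerSums-∷ i (parts κ) e)) ⟩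
    evaluate (λ κ → lower (suc i) p[ κ ] e) c
      ≈⟨ ∑-cong c (λ (s , κ) → sym (∑-*ˡ s (lowered (suc i) e) p[ κ ])) ⟩
    ∑ c (λ (s , κ) → ∑ (lowered (suc i) e) (λ e′ → s * p[ κ ] e′))
      ≈⟨ ∑-swap c (lowered (suc i) e) _ ⟩
    lower (suc i) (expand p[_] c) e ∎

  norm-remove : ∀ {i} μ κ → parts μ ↭ suc i ∷ parts κ →
    norm μ ≈ fromℕ (suc i ℕ.* occurrences (suc i) (parts μ)) * α * norm κ
  norm-remove {i} μ κ p = begin
    fromℕ (z μ) * α ^ length (parts μ)
      ≈⟨ *-cong (trans (fromℕ-cong (z-remove μ κ p)) (fromℕ-* (suc i ℕ.* occurrences (suc i) (parts μ)) (z κ)))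
          (reflexive (cong (α ^_) (↭-length p))) ⟩
    fromℕ (suc i ℕ.* occurrences (suc i) (parts μ)) * fromℕ (z κ) * (α * α ^ length (parts κ))
      ≈⟨ solve 4 (λ a b c d → a :* b :* (c :* d) := a :* c :* (b :* d)) refl _ _ _ _ ⟩
    fromℕ (suc i ℕ.* occurrences (suc i) (parts μ)) * α * norm κ ∎

  coefficient-adjoin : ∀ {i} μ κ → parts μ ↭ suc i ∷ parts κ → ∀ c →
    coefficient (adjoin i c) (parts μ) ≈ coefficient c (parts κ)
  coefficient-adjoin {i} μ κ p c = trans (evaluate-adjoin (λ ν → δ (parts ν) (parts μ)) i c) (evaluate-cong c (λ ν →
    indicator-⇔ ((parts (1+ i ∷ₚ ν)) ≟ₗ parts μ) (parts ν ≟ₗ parts κ)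
      (λ eq → cong parts (↭⇒≡ₚ {ν} {κ} (drop-∷ (↭-trans (↭-sym (∷ₚ-↭ i ν)) (↭-trans (↭-reflexive eq) p)))))
      (λ eq → cong parts (↭⇒≡ₚ {1+ i ∷ₚ ν} {μ} (↭-trans (∷ₚ-↭ i ν) (↭-trans (prep (suc i) (↭-reflexive eq)) (↭-sym p)))))))

  coefficient-adjoin-∉ : ∀ {i} μ → suc i ∉ parts μ → ∀ c → coefficient (adjoin i c) (parts μ) ≈ 0#
  coefficient-adjoin-∉ {i} μ i∉ c = trans (evaluate-adjoin (λ ν → δ (parts ν) (parts μ)) i c) (evaluate-∉ _ c (λ {ν} _ →
    indicator-no ((parts (1+ i ∷ₚ ν)) ≟ₗ parts μ)
        (λ eq → i∉ (subst (suc i ∈_) eq (∈-resp-↭ (↭-sym (∷ₚ-↭ i ν)) (here ≡.refl))))))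

  -- The identity Σ k m_k(μ) = |μ|, with `n` large enough for all part sizes to be met. It makes the
  -- recursion for the coefficients of g_n close.
  ∑-occurrences : ∀ n ks → All (λ k → 0 < k × k ≤ n) ks →
    ∑ (upTo n) (λ i → fromℕ (suc i ℕ.* occurrences (suc i) ks)) ≈ fromℕ (sum ks)
  ∑-occurrences n []           []            = ∑-0 (upTo n) (λ i _ → fromℕ-cong (ℕ.*-zeroʳ (suc i)))
  ∑-occurrences n (suc k ∷ ks) ((_ , k<n) ∷ h) = begin
    ∑ (upTo n) (λ i → fromℕ (suc i ℕ.* occurrences (suc i) (suc k ∷ ks)))
      ≈⟨ ∑-cong (upTo n) (λ i → split i (k ℕ.≟ i)) ⟩
    ∑ (upTo n) (λ i → indicator (k ℕ.≟ i) * fromℕ (suc i) + fromℕ (suc i ℕ.* occurrences (suc i) ks))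
      ≈⟨ ∑-+ (upTo n) _ _ ⟩
    ∑ (upTo n) (λ i → indicator (k ℕ.≟ i) * fromℕ (suc i)) + ∑ (upTo n) (λ i → fromℕ (suc i ℕ.* occurrences (suc i) ks))
      ≈⟨ +-cong (∑-indicator-∈ ℕ._≟_ (λ i → fromℕ (suc i)) (Unique.upTo⁺ n) (∈-upTo⁺ k<n)) (∑-occurrences n ks h) ⟩
    fromℕ (suc k) + fromℕ (sum ks)
      ≈⟨ fromℕ-+ (suc k) (sum ks) ⟨
    fromℕ (sum (suc k ∷ ks)) ∎
    where
    split : ∀ i (k≟i : Dec (k ≡ i)) → fromℕ (suc i ℕ.* occurrences (suc i) (suc k ∷ ks)) ≈
      indicator k≟i * fromℕ (suc i) + fromℕ (suc i ℕ.* occurrences (suc i) ks)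
    split i (yes ≡.refl) = trans (fromℕ-cong (≡.trans (cong (suc k ℕ.*_) (occurrences-∷-≡ (suc k) ks)) (ℕ.*-suc (suc k) _)))
      (trans (fromℕ-+ (suc k) _) (+-congʳ (sym (*-identityˡ _))))
    split i (no k≢i) = trans (fromℕ-cong (cong (suc i ℕ.*_) (occurrences-∷-≢ ks (k≢i ∘ ℕ.suc-injective))))
      (sym (trans (+-congʳ (zeroˡ _)) (+-identityˡ _)))

  -- The coefficients of the expansion are α^(n - ℓ(μ)) / z_μ.
  IsExpansion : ℕ → Combination → Set
  IsExpansion n c = expand p[_] c ≈ₛ oneRow n ×
    (∀ μ → norm μ * coefficient c (parts μ) ≈ indicator (size μ ℕ.≟ n) * α ^ n)

  expansion-zero : IsExpansion 0 [ 1# , ∅ ]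
  expansion-zero = series , coefficients
    where
    series : ∀ e → 1# * 1ₛ e + 0# ≈ oneRow 0 e
    series e = trans (+-identityʳ _) (trans (*-identityˡ _) (trans
      (indicator-⇔ (nonzeroExponents e ≟ₗ []) (sum e ℕ.≟ 0)
        (λ eq → ≡.trans (≡.sym (sum-nonzeroExponents e)) (cong sum eq)) nil)
      (trans (sym (*-identityʳ _)) (indicator-*-cong (sum e ℕ.≟ 0) (λ ∑≡0 →
        sym (trans (∏-nonzeroExponents e) (reflexive (cong (λ l → ∏ l u) (nil ∑≡0)))))))))
      where
      nil : sum e ≡ 0 → nonzeroExponents e ≡ []
      nil ∑≡0 = sum≡0⇒[] (nonzeroExponents-positive e) (≡.trans (sum-nonzeroExponents e) ∑≡0)
    coefficients : ∀ μ → norm μ * (1# * δ [] (parts μ) + 0#) ≈ indicator (size μ ℕ.≟ 0) * α ^ 0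
    coefficients μ = trans (*-congˡ (trans (+-identityʳ _) (trans (*-identityˡ _)
        (indicator-⇔ ([] ≟ₗ parts μ) (size μ ℕ.≟ 0) (cong sum ∘ ≡.sym) (≡.sym ∘ sum≡0⇒[] (positive μ))))))
      (trans (*-comm _ _) (indicator-*-cong (size μ ℕ.≟ 0) (λ size≡0 →
        trans (reflexive (cong norm (parts-injective {μ} {∅} (sum≡0⇒[] (positive μ) size≡0))))
            (trans (*-identityʳ _) fromℕ-1))))

  -- `oneRow-recursion` expresses (m + 1) g_(m+1) by products p_(i+1) g_(m-i). By `z-remove` the
  -- i-th product contributes to the normalised coefficient at μ the multiple (i + 1) times the
  -- multiplicity of i + 1 in μ; these multiples sum to |μ| = m + 1, which the division removes.
  expansion-suc : ∀ m (c : ℕ → Combination) → (∀ i → IsExpansion (m ∸ i) (c i)) →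
    Σ[ d ∈ Combination ] IsExpansion (suc m) d
  expansion-suc m c h = n ⁻¹ ⊛ d , series , coefficients
    where
    d : Combination
    d = concatMap (λ i → α ^ i ⊛ adjoin i (c i)) (upTo (suc m))
    n = fromℕ (suc m)
    n≉0 = fromℕ≉0 (suc m) (s≤s z≤n)
    evaluate-sum : ∀ φ → evaluate φ (n ⁻¹ ⊛ d) ≈
      n ⁻¹ * ∑ (upTo (suc m)) (λ i → α ^ i * evaluate φ (adjoin i (c i)))
    evaluate-sum φ = trans (evaluate-⊛ φ (n ⁻¹) d) (*-congˡ (trans
      (∑-concatMap (λ i → α ^ i ⊛ adjoin i (c i)) (upTo (suc m)) _) (∑-cong (upTo (suc m)) (λ i → evaluate-⊛ φ (α ^ i)
          (adjoin i (c i))))))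
    cancel : ∀ x → n ⁻¹ * (n * x) ≈ x
    cancel x = trans (sym (*-assoc _ _ _)) (trans (*-congʳ (⁻¹-inverseˡ n n≉0)) (*-identityˡ x))
    series : expand p[_] (n ⁻¹ ⊛ d) ≈ₛ oneRow (suc m)
    series e = trans (evaluate-sum (λ κ → p[ κ ] e)) (trans
      (*-congˡ (trans (∑-cong (upTo (suc m)) (λ i → *-congˡ (trans (expand-adjoin i (c i) e)
          (lower-cong (suc i) e (λ e′ _ → proj₁ (h i) e′)))))
        (oneRow-recursion m e))) (cancel _))
    term : ∀ μ i → i ≤ m → norm μ * (α ^ i * coefficient (adjoin i (c i)) (parts μ)) ≈
      indicator (size μ ℕ.≟ suc m) * (α ^ suc m * fromℕ (suc i ℕ.* occurrences (suc i) (parts μ)))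
    term μ i i≤m with suc i ∈ℕ? parts μ
    ... | no i∉ = trans (trans (*-congˡ (trans (*-congˡ (coefficient-adjoin-∉ μ i∉ (c i))) (zeroʳ _))) (zeroʳ _))
      (sym (trans (*-congˡ (trans (*-congˡ (fromℕ-cong (≡.trans (cong (suc i ℕ.*_) (occurrences-∉ i∉)) (ℕ.*-zeroʳ (suc i)))))
          (zeroʳ _))) (zeroʳ _)))
    ... | yes i∈ with remove μ i∈
    ...   | κ , p = begin
      norm μ * (α ^ i * coefficient (adjoin i (c i)) (parts μ))
        ≈⟨ *-cong (norm-remove μ κ p) (*-congˡ (coefficient-adjoin μ κ p (c i))) ⟩
      N * α * norm κ * (α ^ i * coefficient (c i) (parts κ))
        ≈⟨ solve 5 (λ n a k i c → n :* a :* k :* (i :* c) := n :* (a :* i) :* (k :* c)) refl N α (norm κ) (α ^ i) _ ⟩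
      N * (α * α ^ i) * (norm κ * coefficient (c i) (parts κ))
        ≈⟨ *-congˡ (proj₂ (h i) κ) ⟩
      N * (α * α ^ i) * (indicator (size κ ℕ.≟ m ∸ i) * α ^ (m ∸ i))
        ≈⟨ *-congˡ (*-congʳ (degree-shift i≤m (sum-↭ p))) ⟩
      N * (α * α ^ i) * (indicator (size μ ℕ.≟ suc m) * α ^ (m ∸ i))
        ≈⟨ solve 4 (λ n a d b → n :* a :* (d :* b) := d :* (a :* b :* n)) refl N (α * α ^ i) _ _ ⟩
      indicator (size μ ℕ.≟ suc m) * (α ^ suc i * α ^ (m ∸ i) * N)
        ≈⟨ *-congˡ (*-congʳ (trans (sym (^-homo-* α (suc i) (m ∸ i))) (reflexive (cong (λ j → α ^ suc j) (ℕ.m+[n∸m]≡n i≤m))))) ⟩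
      indicator (size μ ℕ.≟ suc m) * (α ^ suc m * N) ∎
      where
      N = fromℕ (suc i ℕ.* occurrences (suc i) (parts μ))
    coefficients : ∀ μ → norm μ * coefficient (n ⁻¹ ⊛ d) (parts μ) ≈ indicator (size μ ℕ.≟ suc m) * α ^ suc m
    coefficients μ = begin
      norm μ * coefficient (n ⁻¹ ⊛ d) (parts μ)
        ≈⟨ *-congˡ (evaluate-sum (λ κ → δ (parts κ) (parts μ))) ⟩
      norm μ * (n ⁻¹ * ∑ (upTo (suc m)) (λ i → α ^ i * coefficient (adjoin i (c i)) (parts μ)))
        ≈⟨ solve 3 (λ a b c → a :* (b :* c) := b :* (a :* c)) refl _ _ _ ⟩
      n ⁻¹ * (norm μ * ∑ (upTo (suc m)) (λ i → α ^ i * coefficient (adjoin i (c i)) (parts μ)))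
        ≈⟨ *-congˡ (∑-*ˡ (norm μ) (upTo (suc m)) _) ⟨
      n ⁻¹ * ∑ (upTo (suc m)) (λ i → norm μ * (α ^ i * coefficient (adjoin i (c i)) (parts μ)))
        ≈⟨ *-congˡ (trans (∑-cong-∈ (upTo (suc m)) (λ i i∈ → term μ i (ℕ.≤-pred (∈-upTo⁻ i∈))))
             (trans (∑-*ˡ _ (upTo (suc m)) _) (*-congˡ (∑-*ˡ _ (upTo (suc m)) _)))) ⟩
      n ⁻¹ * (indicator (size μ ℕ.≟ suc m) * (α ^ suc m * ∑ (upTo (suc m))
          (λ i → fromℕ (suc i ℕ.* occurrences (suc i) (parts μ)))))
        ≈⟨ *-congˡ (indicator-*-cong (size μ ℕ.≟ suc m) (λ size≡ → *-congˡ (trans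
             (∑-occurrences (suc m) (parts μ) (All.tabulate (λ {k} k∈ → All.lookup (positive μ) k∈ , subst (k ≤_) size≡
                 (∈⇒≤sum k∈))))
             (fromℕ-cong size≡)))) ⟩
      n ⁻¹ * (indicator (size μ ℕ.≟ suc m) * (α ^ suc m * n))
        ≈⟨ *-congˡ (solve 3 (λ d a n → d :* (a :* n) := n :* (d :* a)) refl _ _ _) ⟩
      n ⁻¹ * (n * (indicator (size μ ℕ.≟ suc m) * α ^ suc m))
        ≈⟨ cancel _ ⟩
      indicator (size μ ℕ.≟ suc m) * α ^ suc m ∎

  expansion : ∀ n → Σ[ c ∈ Combination ] IsExpansion n c
  expansion = <-rec _ λ where
    zero    rec → [ 1# , ∅ ] , expansion-zero
    (suc m) rec → expansion-suc m (λ i → proj₁ (rec (s≤s (ℕ.m∸n≤m m i)))) (λ i → proj₂ (rec (s≤s (ℕ.m∸n≤m m i))))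

-- Identification of the one-row Jack function with a multiple of g_n.

module OneRowJack (K : PositiveField) (α : PositiveField.Carrier K) (α>0 : PositiveField.Positive K α) where

  open FieldTheory K
  open SymmetricFunctions K α
  open OneRow K α

  module _
    (J : Partition → PowerSeries)
    (monomials : Partition → Combination)
    (expands : ∀ μ → J μ ≈ₛ expand m[_] (monomials μ))
    (triangular : ∀ μ κ → ¬ coefficient (monomials μ) (parts κ) ≈ 0# → κ ⊴ μ)
    (normalised : ∀ μ → coefficient (monomials μ) (replicate (size μ) 1) ≈ fromℕ (size μ !))
    (orthogonal : ∀ μ ν → parts μ ≢ parts ν → Σ[ c ∈ Combination ] Σ[ d ∈ Combination ]
      J μ ≈ₛ expand p[_] c × J ν ≈ₛ expand p[_] d × ⟨ c , d ⟩ ≈ 0#)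
    where

    J-coefficient : ∀ μ ν → J μ (parts ν) ≈ coefficient (monomials μ) (parts ν)
    J-coefficient μ ν = trans (expands μ (parts ν)) (evaluate-cong (monomials μ) (λ κ →
      trans (δ-sym (parts (shape (parts ν))) (parts κ)) (reflexive (cong (λ ν → δ (parts κ) (parts ν)) (shape-parts ν)))))

    J-ones : ∀ μ → J μ (replicate (size μ) 1) ≈ fromℕ (size μ !)
    J-ones μ = trans (J-coefficient μ (ones (size μ))) (normalised μ)

    J-row : ∀ n 1≤n κ → κ ≢ row n 1≤n → J κ [ n ] ≈ 0#
    J-row n 1≤n κ κ≢ with zero? (coefficient (monomials κ) [ n ])
    ... | yes c≈0 = trans (J-coefficient κ (row n 1≤n)) c≈0
    ... | no  c≉0 = contradiction (row-⊴⇒≡ n 1≤n (triangular κ (row n 1≤n) c≉0)) κ≢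

    -- `orthogonal` yields a power-sum expansion of `J μ` only together with a second partition, so
    -- one different from `μ` has to be named.
    distinct : ∀ μ → Σ[ ν ∈ Partition ] parts μ ≢ parts ν
    distinct μ with parts μ
    ... | []    = ones 1 , λ ()
    ... | _ ∷ _ = ∅ , λ ()

    powers : Partition → Combination
    powers μ = proj₁ (orthogonal μ (proj₁ (distinct μ)) (proj₂ (distinct μ)))

    J-powers : ∀ μ → J μ ≈ₛ expand p[_] (powers μ)
    J-powers μ = proj₁ (proj₂ (proj₂ (orthogonal μ (proj₁ (distinct μ)) (proj₂ (distinct μ)))))

    expand-J : ∀ d → expand J d ≈ₛ expand p[_] (substitute powers d)
    expand-J d e = trans (evaluate-cong d (λ κ → J-powers κ e)) (sym (evaluate-substitute (λ κ → p[ κ ] e) powers d))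

    powers-orthogonal : ∀ μ ν → μ ≢ ν → ⟨ powers μ , powers ν ⟩ ≈ 0#
    powers-orthogonal μ ν μ≢ν with orthogonal μ ν (μ≢ν ∘ parts-injective)
    ... | c , d , J≈c , J≈d , ⟨c,d⟩≈0 = trans (⟨⟩-cong (powers μ) c (powers ν) d
      (λ e → trans (sym (J-powers μ e)) (J≈c e)) (λ e → trans (sym (J-powers ν e)) (J≈d e))) ⟨c,d⟩≈0

    -- By anisotropy an isotropic `J μ` would be the zero series, against its normalised coefficient
    -- |μ|!.
    powers-≉0 : ∀ μ → ¬ ⟨ powers μ , powers μ ⟩ ≈ 0#
    powers-≉0 μ ⟨⟩≈0 = fromℕ≉0 (size μ !) (ℕ.1≤n! (size μ)) (begin
      fromℕ (size μ !)                                ≈⟨ J-ones μ ⟨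
      J μ (replicate (size μ) 1)                      ≈⟨ J-powers μ _ ⟩
      expand p[_] (powers μ) (replicate (size μ) 1)   ≈⟨ evaluate-coefficient≈0 _ (powers μ) (anisotropic α>0 (powers μ) ⟨⟩≈0) ⟩
      0#                                              ∎)

    -- The bound on heights keeps `μ` out of the expansions of lower terms, on which `leading-≉0`
    -- relies.
    Spanned : Partition → Set
    Spanned μ = Σ[ d ∈ Combination ] m[ μ ] ≈ₛ expand J d × All (λ κ → height κ ≤ height μ) (support d)

    support-⊛ : ∀ s c → support (s ⊛ c) ≡ support c
    support-⊛ s c = ≡.sym (map-∘ c)

    module _ (μ : Partition) (rec : ∀ {κ} → height κ < height μ → Spanned κ) where

      private
        coeff : Partition → Carrier
        coeff κ = coefficient (monomials μ) (parts κ)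

        -- One identity for three cases: κ = μ, where the term is kept; a vanishing coefficient; and
        -- κ below μ, where `m[ κ ]` is replaced by its expansion in `J`. Being uniform in κ, it can
        -- be summed over all keys.
        LowerTerms : ∀ κ → Dec (μ ≡ κ) → Set
        LowerTerms κ ≟κ = Σ[ d ∈ Combination ]
          (∀ e → coeff κ * m[ κ ] e ≈ indicator ≟κ * (coeff κ * m[ κ ] e) + coeff κ * expand J d e) ×
          All (λ ν → height ν < height μ) (support d)

        lower-terms? : ∀ κ ≟κ → LowerTerms κ ≟κ
        lower-terms? κ (yes _)  = [] , (λ e → sym (trans (+-cong (*-identityˡ _) (zeroʳ _)) (+-identityʳ _))) , []
        lower-terms? κ (no μ≢κ) with zero? (coeff κ)
        ... | yes c≈0 = [] , (λ e → trans (trans (*-congʳ c≈0) (zeroˡ _))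
            (sym (trans (+-cong (zeroˡ _) (zeroʳ _)) (+-identityʳ _)))) , []
        ... | no c≉0 with ⊴⇒height< (triangular μ κ c≉0) (μ≢κ ∘ ≡.sym)
        ...   | κ<μ with rec {κ} κ<μ
        ...     | d , m≈ , bound = d , (λ e → trans (*-congˡ (m≈ e)) (sym (trans (+-congʳ (zeroˡ _)) (+-identityˡ _)))) ,
                  All.map (λ ν≤κ → ℕ.≤-<-trans ν≤κ κ<μ) bound

        lower-terms : ∀ κ → LowerTerms κ (μ ≟ₚ κ)
        lower-terms κ = lower-terms? κ (μ ≟ₚ κ)

        rest : Combination
        rest = concatMap (λ κ → coeff κ ⊛ proj₁ (lower-terms κ)) (keys (monomials μ))

        rest-support : ∀ ks → All (λ ν → height ν < height μ) (support (concatMap (λ κ → coeff κ ⊛ proj₁ (lower-terms κ)) ks))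
        rest-support []       = []
        rest-support (κ ∷ ks) = subst (All _) (≡.sym (map-++ proj₂ (coeff κ ⊛ proj₁ (lower-terms κ)) _))
          (All.++⁺ (subst (All _) (≡.sym (support-⊛ (coeff κ) (proj₁ (lower-terms κ)))) (proj₂ (proj₂ (lower-terms κ))))
              (rest-support ks))

        leading : ∀ e → ∑ (keys (monomials μ)) (λ κ → indicator (μ ≟ₚ κ) * (coeff κ * m[ κ ] e)) ≈ coeff μ * m[ μ ] e
        leading e with μ ∈? keys (monomials μ)
        ... | yes μ∈ = ∑-indicator-∈ _≟ₚ_ (λ κ → coeff κ * m[ κ ] e) (keys-unique (monomials μ)) μ∈
        ... | no μ∉  = trans (∑-indicator-∉ _≟ₚ_ (keys (monomials μ)) μ _ μ∉)
          (sym (trans (*-congʳ (keys-∉ (monomials μ) μ∉)) (zeroˡ _)))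

        J≈ : ∀ e → J μ e ≈ coeff μ * m[ μ ] e + expand J rest e
        J≈ e = begin
          J μ e
            ≈⟨ trans (expands μ e) (collect (λ κ → m[ κ ] e) (monomials μ)) ⟩
          ∑ (keys (monomials μ)) (λ κ → coeff κ * m[ κ ] e)
            ≈⟨ trans (∑-cong (keys (monomials μ)) (λ κ → proj₁ (proj₂ (lower-terms κ)) e)) (∑-+ (keys (monomials μ)) _ _) ⟩
          ∑ (keys (monomials μ)) (λ κ → indicator (μ ≟ₚ κ) * (coeff κ * m[ κ ] e)) +
            ∑ (keys (monomials μ)) (λ κ → coeff κ * expand J (proj₁ (lower-terms κ)) e)
            ≈⟨ +-cong (leading e) (sym (trans (∑-concatMap _ (keys (monomials μ)) _)
                 (∑-cong (keys (monomials μ)) (λ κ → evaluate-⊛ (λ ν → J ν e) (coeff κ) (proj₁ (lower-terms κ)))))) ⟩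
          coeff μ * m[ μ ] e + expand J rest e ∎

        -- Otherwise J μ would lie in the span of the J κ with κ ≠ μ, and
        -- hence be orthogonal to itself.
        leading-≉0 : ¬ coeff μ ≈ 0#
        leading-≉0 c≈0 = powers-≉0 μ (begin
          ⟨ powers μ , powers μ ⟩
            ≈⟨ ⟨⟩-cong (powers μ) (powers μ) (powers μ) (substitute powers rest) (λ _ → refl) (λ e → trans (sym (J-powers μ e))
                 (trans (J≈ e) (trans (trans (+-congʳ (trans (*-congʳ c≈0) (zeroˡ _))) (+-identityˡ _)) (expand-J rest e)))) ⟩
          ⟨ powers μ , substitute powers rest ⟩
            ≈⟨ ⟨⟩-substitute (powers μ) powers rest ⟩
          evaluate (λ κ → ⟨ powers μ , powers κ ⟩) rest
            ≈⟨ evaluate-∉ _ rest (λ {κ} κ∈ → powers-orthogonal μ κ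
                 (λ μ≡κ → ℕ.<⇒≢ (All.lookup (rest-support (keys (monomials μ))) κ∈) (cong height (≡.sym μ≡κ)))) ⟩
          0# ∎)

      spanned-step : Spanned μ
      spanned-step = (coeff μ) ⁻¹ ⊛ ((1# , μ) ∷ (- 1#) ⊛ rest) , series ,
        subst (All _) (≡.sym (support-⊛ ((coeff μ) ⁻¹) ((1# , μ) ∷ (- 1#) ⊛ rest)))
          (ℕ.≤-refl ∷ subst (All _) (≡.sym (support-⊛ (- 1#) rest)) (All.map ℕ.<⇒≤ (rest-support (keys (monomials μ)))))
        where
        series : ∀ e → m[ μ ] e ≈ expand J ((coeff μ) ⁻¹ ⊛ ((1# , μ) ∷ (- 1#) ⊛ rest)) e
        series e = sym (begin
          expand J ((coeff μ) ⁻¹ ⊛ ((1# , μ) ∷ (- 1#) ⊛ rest)) e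
            ≈⟨ evaluate-⊛ (λ κ → J κ e) ((coeff μ) ⁻¹) ((1# , μ) ∷ (- 1#) ⊛ rest) ⟩
          (coeff μ) ⁻¹ * (1# * J μ e + expand J ((- 1#) ⊛ rest) e)
            ≈⟨ *-congˡ (+-cong (trans (*-identityˡ _) (J≈ e)) (trans (evaluate-⊛ (λ κ → J κ e) (- 1#) rest)
                 (trans (sym (-‿distribˡ-* 1# _)) (-‿cong (*-identityˡ _))))) ⟩
          (coeff μ) ⁻¹ * (coeff μ * m[ μ ] e + expand J rest e - expand J rest e)
            ≈⟨ *-congˡ (trans (+-assoc _ _ _) (trans (+-congˡ (-‿inverseʳ _)) (+-identityʳ _))) ⟩
          (coeff μ) ⁻¹ * (coeff μ * m[ μ ] e)
            ≈⟨ trans (sym (*-assoc _ _ _)) (trans (*-congʳ (⁻¹-inverseˡ _ leading-≉0)) (*-identityˡ _)) ⟩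
          m[ μ ] e ∎)

    spanned : ∀ μ → Spanned μ
    spanned μ = <-rec (λ h → ∀ μ → height μ ≡ h → Spanned μ)
      (λ { _ rec μ ≡.refl → spanned-step μ (λ {κ} κ<μ → rec κ<μ κ ≡.refl) }) (height μ) μ ≡.refl

    module _ (n : ℕ) (1≤n : 1 ≤ n) where

      private
        G : Combination
        G = proj₁ (expansion n)

        G-series : expand p[_] G ≈ₛ oneRow n
        G-series = proj₁ (proj₂ (expansion n))

        -- The norm of κ times the coefficient of `G` at κ is α^n if |κ| = n and 0 otherwise, that
        -- is, α^n times the coefficient of x₁^n in p_κ.
        ⟨_,G⟩ : ∀ c → ⟨ c , G ⟩ ≈ α ^ n * expand p[_] c [ n ]
        ⟨ c ,G⟩ = begin
          ⟨ c , G ⟩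
            ≈⟨ ⟨⟩-evaluate c G ⟩
          evaluate (λ κ → norm κ * coefficient G (parts κ)) c
            ≈⟨ evaluate-cong c (λ κ → trans (proj₂ (proj₂ (expansion n)) κ) (trans (*-comm _ _)
                 (*-congˡ (sym (powerSums-[n] (parts κ) (positive κ) n))))) ⟩
          evaluate (λ κ → α ^ n * p[ κ ] [ n ]) c
            ≈⟨ evaluate-* (λ κ → p[ κ ] [ n ]) (α ^ n) c ⟩
          α ^ n * expand p[_] c [ n ] ∎

        M : Combination
        M = map (λ κ → oneRow n (parts κ) , κ) (keys G)

        -- Every partition of n occurs in G, so the partitions occurring in G can be
        -- used to enumerate the monomials of oneRow n.
        oneRow-∉ : ∀ μ → μ ∉ keys G → oneRow n (parts μ) ≈ 0#
        oneRow-∉ μ μ∉ = indicator-*-no (size μ ℕ.≟ n) (λ size≡n → positive⇒≉0 (positive-^ n α>0) (begin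
          α ^ n                                        ≈⟨ indicator-*-yes (size μ ℕ.≟ n) size≡n ⟨
          indicator (size μ ℕ.≟ n) * α ^ n             ≈⟨ proj₂ (proj₂ (expansion n)) μ ⟨
          norm μ * coefficient G (parts μ)             ≈⟨ trans (*-congˡ (keys-∉ G μ∉)) (zeroʳ _) ⟩
          0#                                           ∎))

        oneRow-M : ∀ e → oneRow n e ≈ expand m[_] M e
        oneRow-M e = sym (begin
          expand m[_] M e
            ≈⟨ reflexive (∑-map _ (keys G) _) ⟩
          ∑ (keys G) (λ κ → oneRow n (parts κ) * m[ κ ] e)
            ≈⟨ ∑-cong (keys G) (λ κ → trans (*-comm _ _) (*-congʳ (δ-parts (shape e) κ))) ⟩
          ∑ (keys G) (λ κ → indicator (shape e ≟ₚ κ) * oneRow n (parts κ))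
            ≈⟨ select (shape e ∈? keys G) ⟩
          oneRow n (parts (shape e))
            ≈⟨ oneRow-shape n e ⟩
          oneRow n e ∎)
          where
          select : Dec (shape e ∈ keys G) → ∑ (keys G) (λ κ → indicator (shape e ≟ₚ κ) * oneRow n (parts κ)) ≈ oneRow n
              (parts (shape e))
          select (yes ∈) = ∑-indicator-∈ _≟ₚ_ (λ κ → oneRow n (parts κ)) (keys-unique G) ∈
          select (no ∉)  = trans (∑-indicator-∉ _≟ₚ_ (keys G) (shape e) _ ∉) (sym (oneRow-∉ (shape e) ∉))

        D : Combination
        D = substitute (λ κ → proj₁ (spanned κ)) M

        oneRow-D : ∀ e → oneRow n e ≈ expand J D e
        oneRow-D e = trans (oneRow-M e) (trans (evaluate-cong M (λ κ → proj₁ (proj₂ (spanned κ)) e))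
          (sym (evaluate-substitute (λ κ → J κ e) (λ κ → proj₁ (spanned κ)) M)))

        -- Pairing `J κ` with the expansion `D` leaves ⟨J κ , J κ⟩ times the coefficient in
        -- question. Pairing it with `G`, the same series, gives α^n times the coefficient of x₁^n
        -- in `J κ`, which is zero by `J-row`.
        coefficient-D : ∀ κ → κ ≢ row n 1≤n → coefficient D (parts κ) ≈ 0#
        coefficient-D κ κ≢ = x*y≈0⇒y≈0 _ (powers-≉0 κ) (begin
          ⟨ powers κ , powers κ ⟩ * coefficient D (parts κ)
            ≈⟨ evaluate-* (λ μ → δ (parts μ) (parts κ)) ⟨ powers κ , powers κ ⟩ D ⟨
          evaluate (λ μ → ⟨ powers κ , powers κ ⟩ * δ (parts μ) (parts κ)) D
            ≈⟨ evaluate-cong D (λ μ → diagonal μ (μ ≟ₚ κ)) ⟩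
          evaluate (λ μ → ⟨ powers κ , powers μ ⟩) D
            ≈⟨ ⟨⟩-substitute (powers κ) powers D ⟨
          ⟨ powers κ , substitute powers D ⟩
            ≈⟨ ⟨⟩-cong (powers κ) (powers κ) (substitute powers D) G (λ _ → refl)
                 (λ e → trans (sym (expand-J D e)) (trans (sym (oneRow-D e)) (sym (G-series e)))) ⟩
          ⟨ powers κ , G ⟩
            ≈⟨ ⟨ powers κ ,G⟩ ⟩
          α ^ n * expand p[_] (powers κ) [ n ]
            ≈⟨ *-congˡ (trans (sym (J-powers κ [ n ])) (J-row n 1≤n κ κ≢)) ⟩
          α ^ n * 0#
            ≈⟨ zeroʳ _ ⟩
          0# ∎)
          where
          diagonal : ∀ μ → Dec (μ ≡ κ) → ⟨ powers κ , powers κ ⟩ * δ (parts μ) (parts κ) ≈ ⟨ powers κ , powers μ ⟩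
          diagonal μ (yes ≡.refl) = trans (*-congˡ (indicator-yes (parts κ ≟ₗ parts κ) ≡.refl)) (*-identityʳ _)
          diagonal μ (no μ≢κ) = trans (trans (*-congˡ (indicator-no (parts μ ≟ₗ parts κ) (μ≢κ ∘ parts-injective))) (zeroʳ _))
            (sym (powers-orthogonal κ μ (μ≢κ ∘ ≡.sym)))

        c : Carrier
        c = coefficient D [ n ]

        oneRow≈c*J : ∀ e → oneRow n e ≈ c * J (row n 1≤n) e
        oneRow≈c*J e = begin
          oneRow n e
            ≈⟨ trans (oneRow-D e) (collect (λ κ → J κ e) D) ⟩
          ∑ (keys D) (λ κ → coefficient D (parts κ) * J κ e)
            ≈⟨ ∑-cong (keys D) (λ κ → off-row κ (row n 1≤n ≟ₚ κ)) ⟩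
          ∑ (keys D) (λ κ → indicator (row n 1≤n ≟ₚ κ) * (coefficient D (parts κ) * J κ e))
            ≈⟨ select (row n 1≤n ∈? keys D) ⟩
          c * J (row n 1≤n) e ∎
          where
          off-row : ∀ κ (≟κ : Dec (row n 1≤n ≡ κ)) →
            coefficient D (parts κ) * J κ e ≈ indicator ≟κ * (coefficient D (parts κ) * J κ e)
          off-row κ (yes _)  = sym (*-identityˡ _)
          off-row κ (no ≢κ) = trans (trans (*-congʳ (coefficient-D κ (≢κ ∘ ≡.sym))) (zeroˡ _)) (sym (zeroˡ _))
          select : Dec (row n 1≤n ∈ keys D) →
            ∑ (keys D) (λ κ → indicator (row n 1≤n ≟ₚ κ) * (coefficient D (parts κ) * J κ e)) ≈ c * J (row n 1≤n) e
          select (yes ∈) = ∑-indicator-∈ _≟ₚ_ (λ κ → coefficient D (parts κ) * J κ e) (keys-unique D) ∈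
          select (no ∉)  = trans (∑-indicator-∉ _≟ₚ_ (keys D) (row n 1≤n) _ ∉) (sym (trans (*-congʳ (keys-∉ D ∉)) (zeroˡ _)))

        size-row : size (row n 1≤n) ≡ n
        size-row = ℕ.+-identityʳ n

        -- Comparison at x₁⋯xₙ, where `J` has coefficient n! by normalisation and `oneRow n` has a
        -- product of n factors u 1 = 1.
        c*n!≈1 : c * fromℕ (n !) ≈ 1#
        c*n!≈1 = begin
          c * fromℕ (n !)
            ≈⟨ *-congˡ (subst (λ s → J (row n 1≤n) (replicate s 1) ≈ fromℕ (s !)) size-row (J-ones (row n 1≤n))) ⟨
          c * J (row n 1≤n) (replicate n 1)
            ≈⟨ oneRow≈c*J (replicate n 1) ⟨
          indicator (sum (replicate n 1) ℕ.≟ n) * ∏ (replicate n 1) u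
            ≈⟨ indicator-*-yes (sum (replicate n 1) ℕ.≟ n) (size-ones n) ⟩
          ∏ (replicate n 1) u
            ≈⟨ ∏-ones n ⟩
          1# ∎
          where
          ∏-ones : ∀ n → ∏ (replicate n 1) u ≈ 1#
          ∏-ones zero    = refl
          ∏-ones (suc n) = trans (*-cong u-1 (∏-ones n)) (*-identityˡ 1#)

      J-oneRow : ∀ e → J (row n 1≤n) e ≈ fromℕ (n !) * oneRow n e
      J-oneRow e = begin
        J (row n 1≤n) e                         ≈⟨ *-identityˡ _ ⟨
        1# * J (row n 1≤n) e                    ≈⟨ *-congʳ (trans (*-comm _ _) c*n!≈1) ⟨
        fromℕ (n !) * c * J (row n 1≤n) e       ≈⟨ *-assoc _ _ _ ⟩
        fromℕ (n !) * (c * J (row n 1≤n) e)     ≈⟨ *-congˡ (oneRow≈c*J e) ⟨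
        fromℕ (n !) * oneRow n e                ∎

-- The substitution of 1/α for α.

record Inversion (K : PositiveField) (α : PositiveField.Carrier K) : Set where
  open PositiveField K using (Carrier; _≈_; _+_; _*_; 1#)
  field
    φ      : Carrier → Carrier
    φ-cong : ∀ {x y} → x ≈ y → φ x ≈ φ y
    φ-+    : ∀ x y → φ (x + y) ≈ φ x + φ y
    φ-*    : ∀ x y → φ (x * y) ≈ φ x * φ y
    φ-1    : φ 1# ≈ 1#
    φ-α    : φ α * α ≈ 1#

module OneRowJackExpansion (K : PositiveField) (α : PositiveField.Carrier K) (α>0 : PositiveField.Positive K α)
  (inversion : Inversion K α) where

  open FieldTheory K
  open SymmetricFunctions K α using (PowerSeries; Combination; p[_]; m[_]; expand; coefficient; _≈ₛ_; ⟨_,_⟩)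
  open WordSums K α using (binomial; rising; rising-0; rising-suc)
  open PermutationSums K α using (F; quasisymmetric-expansion)
  open OneRow K α using (u; u-suc; oneRow)
  open OneRowJack K α α>0 using (J-oneRow)
  open Inversion inversion

  φ-0 : φ 0# ≈ 0#
  φ-0 = x+x≈x⇒x≈0 (φ 0#) (trans (sym (φ-+ 0# 0#)) (φ-cong (+-identityˡ 0#)))

  φ-fromℕ : ∀ n → φ (fromℕ n) ≈ fromℕ n
  φ-fromℕ zero    = φ-0
  φ-fromℕ (suc n) = trans (φ-+ 1# (fromℕ n)) (+-cong φ-1 (φ-fromℕ n))

  φ-indicator : {Q : Set} (Q? : Dec Q) → φ (indicator Q?) ≈ indicator Q?
  φ-indicator (yes _) = φ-1
  φ-indicator (no _)  = φ-0

  -- Each of the m factors 1 + jα becomes 1 + j/α, and one of the m factors α turns it into α + j.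
  α^m*φ-u : ∀ m → α ^ m * φ (u m) ≈ rising m
  α^m*φ-u zero    = trans (*-identityˡ _) (trans φ-1 (sym rising-0))
  α^m*φ-u (suc m) = *-cancelˡ (fromℕ (suc m)) (fromℕ≉0 (suc m) (s≤s z≤n)) (begin
    fromℕ (suc m) * (α ^ suc m * φ (u (suc m)))
      ≈⟨ solve 3 (λ n a u → n :* (a :* u) := a :* (n :* u)) refl _ _ _ ⟩
    α ^ suc m * (fromℕ (suc m) * φ (u (suc m)))
      ≈⟨ *-congˡ (trans (*-congʳ (sym (φ-fromℕ (suc m)))) (trans (sym (φ-* _ _)) (φ-cong (u-suc m)))) ⟩
    α ^ suc m * φ ((1# + fromℕ m * α) * u m)
      ≈⟨ *-congˡ (trans (φ-* _ _) (*-congʳ (trans (φ-+ _ _) (+-cong φ-1 (trans (φ-* _ _) (*-congʳ (φ-fromℕ m))))))) ⟩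
    α * α ^ m * ((1# + fromℕ m * φ α) * φ (u m))
      ≈⟨ solve 6 (λ a p o m b u → a :* p :* ((o :+ m :* b) :* u) := (a :* o :+ m :* (b :* a)) :* (p :* u)) refl α (α ^ m) 1#
          (fromℕ m) (φ α) (φ (u m)) ⟩
    (α * 1# + fromℕ m * (φ α * α)) * (α ^ m * φ (u m))
      ≈⟨ *-cong (+-cong (*-identityʳ α) (trans (*-congˡ φ-α) (*-identityʳ _))) (α^m*φ-u m) ⟩
    (α + fromℕ m) * rising m
      ≈⟨ rising-suc m ⟨
    fromℕ (suc m) * rising (suc m) ∎)

  α^sum*φ-∏-u : ∀ e → α ^ sum e * φ (∏ e u) ≈ ∏ e rising
  α^sum*φ-∏-u []      = trans (*-identityˡ _) φ-1
  α^sum*φ-∏-u (k ∷ e) = begin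
    α ^ (k ℕ.+ sum e) * φ (u k * ∏ e u)
      ≈⟨ *-cong (^-homo-* α k (sum e)) (φ-* _ _) ⟩
    α ^ k * α ^ sum e * (φ (u k) * φ (∏ e u))
      ≈⟨ solve 4 (λ a b c d → a :* b :* (c :* d) := a :* c :* (b :* d)) refl _ _ _ _ ⟩
    α ^ k * φ (u k) * (α ^ sum e * φ (∏ e u))
      ≈⟨ *-cong (α^m*φ-u k) (α^sum*φ-∏-u e) ⟩
    ∏ (k ∷ e) rising ∎

  α^n*φ-oneRow : ∀ n e → α ^ n * φ (oneRow n e) ≈ indicator (sum e ℕ.≟ n) * ∏ e rising
  α^n*φ-oneRow n e = begin
    α ^ n * φ (indicator (sum e ℕ.≟ n) * ∏ e u)
      ≈⟨ *-congˡ (trans (φ-* _ _) (*-congʳ (φ-indicator (sum e ℕ.≟ n)))) ⟩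
    α ^ n * (indicator (sum e ℕ.≟ n) * φ (∏ e u))
      ≈⟨ solve 3 (λ a d p → a :* (d :* p) := d :* (a :* p)) refl _ _ _ ⟩
    indicator (sum e ℕ.≟ n) * (α ^ n * φ (∏ e u))
      ≈⟨ indicator-*-cong (sum e ℕ.≟ n) (λ ∑≡n → trans (*-congʳ (reflexive (cong (α ^_) (≡.sym ∑≡n)))) (α^sum*φ-∏-u e)) ⟩
    indicator (sum e ℕ.≟ n) * ∏ e rising ∎

  -- The defining properties of the family are taken one by one because `IsJackFamily` is tied to
  -- ℚ⟨α⟩, while the field is still abstract here.
  oneRowJack-expansion :
    (J : Partition → PowerSeries)
    (monomials : Partition → Combination)
    (expands : ∀ μ → J μ ≈ₛ expand m[_] (monomials μ))
    (triangular : ∀ μ κ → ¬ coefficient (monomials μ) (parts κ) ≈ 0# → κ ⊴ μ)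
    (normalised : ∀ μ → coefficient (monomials μ) (replicate (size μ) 1) ≈ fromℕ (size μ !))
    (orthogonal : ∀ μ ν → parts μ ≢ parts ν → Σ[ c ∈ Combination ] Σ[ d ∈ Combination ]
      J μ ≈ₛ expand p[_] c × J ν ≈ₛ expand p[_] d × ⟨ c , d ⟩ ≈ 0#)
    (n : ℕ) (1≤n : 1 ≤ n) (e : Monomial) →
    α ^ size (row n 1≤n) * φ (J (row n 1≤n) e) ≈
    fromℕ (n !) * ∑ (S n) (λ π → binomial (α + fromℕ n - 1# - fromℕ (des π)) n * F n (Des n (P π)) e)
  oneRowJack-expansion J monomials expands triangular normalised orthogonal n 1≤n e = begin
    α ^ size (row n 1≤n) * φ (J (row n 1≤n) e)
      ≈⟨ *-cong (reflexive (cong (α ^_) (ℕ.+-identityʳ n)))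
           (trans (φ-cong (J-oneRow J monomials expands triangular normalised orthogonal n 1≤n e))
             (trans (φ-* _ _) (*-congʳ (φ-fromℕ (n !))))) ⟩
    α ^ n * (fromℕ (n !) * φ (oneRow n e))
      ≈⟨ solve 3 (λ a f g → a :* (f :* g) := f :* (a :* g)) refl _ _ _ ⟩
    fromℕ (n !) * (α ^ n * φ (oneRow n e))
      ≈⟨ *-congˡ (trans (α^n*φ-oneRow n e) (sym (quasisymmetric-expansion n e))) ⟩
    fromℕ (n !) * ∑ (S n) (λ π → binomial (α + fromℕ n - 1# - fromℕ (des π)) n * F n (Des n (P π)) e) ∎

-- Evaluation of polynomials over ℚ in an arbitrary field

record Scalars (K : PositiveField) : Set where
  open PositiveField K using (Carrier; _≈_; _+_; _*_; 0#; 1#)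
  field
    constant   : ℚ → Carrier
    constant-+ : ∀ a b → constant (a ℚ.+ b) ≈ constant a + constant b
    constant-* : ∀ a b → constant (a ℚ.* b) ≈ constant a * constant b
    constant-0 : constant 0ℚ ≈ 0#
    constant-1 : constant 1ℚ ≈ 1#

module Evaluation (K : PositiveField) (scalars : Scalars K) where

  open FieldTheory K
  open Scalars scalars

  evaluate : ℚ[α] → Carrier → Carrier
  evaluate p t = foldr (λ a r → constant a + t * r) 0# p

  evaluate-≈[] : ∀ t p → p ≈ₚ [] → evaluate p t ≈ 0#
  evaluate-≈[] t []      p≈[] = refl
  evaluate-≈[] t (a ∷ p) p≈[] = trans (+-cong (trans (reflexive (cong constant (p≈[] 0))) constant-0)
    (trans (*-congˡ (evaluate-≈[] t p (p≈[] ∘ suc))) (zeroʳ t))) (+-identityˡ 0#)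

  evaluate-cong : ∀ t p q → p ≈ₚ q → evaluate p t ≈ evaluate q t
  evaluate-cong t []      q       p≈q = sym (evaluate-≈[] t q (λ k → ≡.sym (p≈q k)))
  evaluate-cong t (a ∷ p) []      p≈q = evaluate-≈[] t (a ∷ p) p≈q
  evaluate-cong t (a ∷ p) (b ∷ q) p≈q = +-cong (reflexive (cong constant (p≈q 0))) (*-congˡ (evaluate-cong t p q (p≈q ∘ suc)))

  evaluate-+ : ∀ t p q → evaluate (p +ₚ q) t ≈ evaluate p t + evaluate q t
  evaluate-+ t []      q       = sym (+-identityˡ _)
  evaluate-+ t (a ∷ p) []      = sym (+-identityʳ _)
  evaluate-+ t (a ∷ p) (b ∷ q) = trans (+-cong (constant-+ a b) (*-congˡ (evaluate-+ t p q)))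
    (solve 5 (λ a b t p q → a :+ b :+ t :* (p :+ q) := a :+ t :* p :+ (b :+ t :* q)) refl _ _ t _ _)

  evaluate-scale : ∀ t a p → evaluate (scaleₚ a p) t ≈ constant a * evaluate p t
  evaluate-scale t a []      = sym (zeroʳ _)
  evaluate-scale t a (b ∷ p) = trans (+-cong (constant-* a b) (*-congˡ (evaluate-scale t a p)))
    (solve 4 (λ a b t p → a :* b :+ t :* (a :* p) := a :* (b :+ t :* p)) refl _ _ t _)

  evaluate-* : ∀ t p q → evaluate (p *ₚ q) t ≈ evaluate p t * evaluate q t
  evaluate-* t []      q = sym (zeroˡ _)
  evaluate-* t (a ∷ p) q = begin
    evaluate (scaleₚ a q +ₚ (0ℚ ∷ p *ₚ q)) t
      ≈⟨ evaluate-+ t (scaleₚ a q) (0ℚ ∷ p *ₚ q) ⟩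
    evaluate (scaleₚ a q) t + (constant 0ℚ + t * evaluate (p *ₚ q) t)
      ≈⟨ +-cong (evaluate-scale t a q) (trans (+-cong constant-0 (*-congˡ (evaluate-* t p q))) (+-identityˡ _)) ⟩
    constant a * evaluate q t + t * (evaluate p t * evaluate q t)
      ≈⟨ solve 4 (λ a t p q → a :* q :+ t :* (p :* q) := (a :+ t :* p) :* q) refl _ t _ _ ⟩
    evaluate (a ∷ p) t * evaluate q t ∎

  evaluate-∷ʳ : ∀ t p a → evaluate (p ++ [ a ]) t ≈ evaluate p t + constant a * t ^ length p
  evaluate-∷ʳ t []      a = trans (+-congˡ (zeroʳ t)) (trans (+-identityʳ _) (sym (trans (+-identityˡ _) (*-identityʳ _))))
  evaluate-∷ʳ t (b ∷ p) a = trans (+-congˡ (*-congˡ (evaluate-∷ʳ t p a)))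
    (solve 5 (λ b t p a n → b :+ t :* (p :+ a :* n) := b :+ t :* p :+ a :* (t :* n)) refl _ t _ _ _)

  module _ {s t} (s*t≈1 : s * t ≈ 1#) where

    -- Multiplying p(1/t) by a power of t reverses the coefficients. The exponent `length p` is one
    -- more than the formal degree, hence the extra factor t.
    evaluate-reverse : ∀ p → evaluate p s * t ^ length p ≈ t * evaluate (reverse p) t
    evaluate-reverse []      = trans (zeroˡ _) (sym (zeroʳ t))
    evaluate-reverse (a ∷ p) = begin
      (constant a + s * evaluate p s) * (t * t ^ length p)
        ≈⟨ solve 5 (λ a s p t n → (a :+ s :* p) :* (t :* n) := t :* (a :* n) :+ s :* t :* (p :* n)) refl _ s _ t _ ⟩
      t * (constant a * t ^ length p) + s * t * (evaluate p s * t ^ length p)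
        ≈⟨ +-congˡ (trans (*-congʳ s*t≈1) (trans (*-identityˡ _) (evaluate-reverse p))) ⟩
      t * (constant a * t ^ length p) + t * evaluate (reverse p) t
        ≈⟨ trans (+-comm _ _) (sym (distribˡ t _ _)) ⟩
      t * (evaluate (reverse p) t + constant a * t ^ length p)
        ≈⟨ *-congˡ (trans (evaluate-∷ʳ t (reverse p) a) (+-congˡ (*-congˡ (reflexive (cong (t ^_) (length-reverse p)))))) ⟨
      t * evaluate (reverse p ++ [ a ]) t
        ≈⟨ *-congˡ (reflexive (cong (λ q → evaluate q t) (unfold-reverse a p))) ⟨
      t * evaluate (reverse (a ∷ p)) t ∎

    -- The inverse of a transcendental element is transcendental, since reversal keeps a polynomial
    -- nonzero.
    evaluate-≉0 : ¬ t ≈ 0# → (∀ q → Nonzeroₚ q → ¬ evaluate q t ≈ 0#) → ∀ p → Nonzeroₚ p → ¬ evaluate p s ≈ 0#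
    evaluate-≉0 t≉0 transcendental p p≢0 p≈0 = transcendental (reverse p) (Any.reverse⁺ p≢0)
      (x*y≈0⇒y≈0 t t≉0 (trans (sym (evaluate-reverse p)) (trans (*-congʳ p≈0) (zeroˡ _))))

  module Quotient (t : Carrier) (regular : ∀ p → Nonzeroₚ p → ¬ evaluate p t ≈ 0#) where

    quotient : ℚ[α] → ℚ[α] → Carrier
    quotient n d = evaluate n t * (evaluate d t) ⁻¹

    -- The quotient is characterised by the equation it solves, so each law below reduces to an
    -- identity between values of polynomials.
    quotient-unique : ∀ n d x → Nonzeroₚ d → evaluate d t * x ≈ evaluate n t → quotient n d ≈ x
    quotient-unique n d x d≢0 eq = *-cancelˡ (evaluate d t) (regular d d≢0) (begin
      evaluate d t * (evaluate n t * (evaluate d t) ⁻¹)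
        ≈⟨ solve 3 (λ d n i → d :* (n :* i) := d :* i :* n) refl _ _ _ ⟩
      evaluate d t * (evaluate d t) ⁻¹ * evaluate n t
        ≈⟨ trans (*-congʳ (⁻¹-inverseʳ _ (regular d d≢0))) (*-identityˡ _) ⟩
      evaluate n t
        ≈⟨ eq ⟨
      evaluate d t * x ∎)

    quotient-* : ∀ n d → Nonzeroₚ d → evaluate d t * quotient n d ≈ evaluate n t
    quotient-* n d d≢0 = begin
      evaluate d t * (evaluate n t * (evaluate d t) ⁻¹)
        ≈⟨ solve 3 (λ d n i → d :* (n :* i) := d :* i :* n) refl _ _ _ ⟩
      evaluate d t * (evaluate d t) ⁻¹ * evaluate n t
        ≈⟨ trans (*-congʳ (⁻¹-inverseʳ _ (regular d d≢0))) (*-identityˡ _) ⟩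
      evaluate n t ∎

    quotient-cong : ∀ n d n′ d′ → Nonzeroₚ d → Nonzeroₚ d′ → n *ₚ d′ ≈ₚ n′ *ₚ d → quotient n d ≈ quotient n′ d′
    quotient-cong n d n′ d′ d≢0 d′≢0 eq = quotient-unique n d _ d≢0 (*-cancelˡ (evaluate d′ t) (regular d′ d′≢0) (begin
      evaluate d′ t * (evaluate d t * quotient n′ d′)
        ≈⟨ solve 3 (λ a b c → a :* (b :* c) := a :* c :* b) refl _ _ _ ⟩
      evaluate d′ t * quotient n′ d′ * evaluate d t
        ≈⟨ *-congʳ (quotient-* n′ d′ d′≢0) ⟩
      evaluate n′ t * evaluate d t
        ≈⟨ trans (sym (evaluate-* t n′ d)) (sym (evaluate-cong t (n *ₚ d′) (n′ *ₚ d) eq)) ⟩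
      evaluate (n *ₚ d′) t
        ≈⟨ trans (evaluate-* t n d′) (*-comm _ _) ⟩
      evaluate d′ t * evaluate n t ∎))

    quotient-+ : ∀ n d n′ d′ → Nonzeroₚ d → Nonzeroₚ d′ → Nonzeroₚ (d *ₚ d′) →
      quotient (n *ₚ d′ +ₚ n′ *ₚ d) (d *ₚ d′) ≈ quotient n d + quotient n′ d′
    quotient-+ n d n′ d′ d≢0 d′≢0 dd′≢0 = quotient-unique (n *ₚ d′ +ₚ n′ *ₚ d) (d *ₚ d′) _ dd′≢0 (begin
      evaluate (d *ₚ d′) t * (quotient n d + quotient n′ d′)
        ≈⟨ *-congʳ (evaluate-* t d d′) ⟩
      evaluate d t * evaluate d′ t * (quotient n d + quotient n′ d′)
        ≈⟨ solve 4 (λ a b x y → a :* b :* (x :+ y) := a :* x :* b :+ b :* y :* a) refl _ _ _ _ ⟩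
      evaluate d t * quotient n d * evaluate d′ t + evaluate d′ t * quotient n′ d′ * evaluate d t
        ≈⟨ +-cong (*-congʳ (quotient-* n d d≢0)) (*-congʳ (quotient-* n′ d′ d′≢0)) ⟩
      evaluate n t * evaluate d′ t + evaluate n′ t * evaluate d t
        ≈⟨ trans (evaluate-+ t (n *ₚ d′) (n′ *ₚ d)) (+-cong (evaluate-* t n d′) (evaluate-* t n′ d)) ⟨
      evaluate (n *ₚ d′ +ₚ n′ *ₚ d) t ∎)

    quotient-*-homo : ∀ n d n′ d′ → Nonzeroₚ d → Nonzeroₚ d′ → Nonzeroₚ (d *ₚ d′) →
      quotient (n *ₚ n′) (d *ₚ d′) ≈ quotient n d * quotient n′ d′
    quotient-*-homo n d n′ d′ d≢0 d′≢0 dd′≢0 = quotient-unique (n *ₚ n′) (d *ₚ d′) _ dd′≢0 (begin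
      evaluate (d *ₚ d′) t * (quotient n d * quotient n′ d′)
        ≈⟨ *-congʳ (evaluate-* t d d′) ⟩
      evaluate d t * evaluate d′ t * (quotient n d * quotient n′ d′)
        ≈⟨ solve 4 (λ a b x y → a :* b :* (x :* y) := a :* x :* (b :* y)) refl _ _ _ _ ⟩
      evaluate d t * quotient n d * (evaluate d′ t * quotient n′ d′)
        ≈⟨ *-cong (quotient-* n d d≢0) (quotient-* n′ d′ d′≢0) ⟩
      evaluate n t * evaluate n′ t
        ≈⟨ evaluate-* t n n′ ⟨
      evaluate (n *ₚ n′) t ∎)

    quotient-1 : Nonzeroₚ [ 1ℚ ] → quotient [ 1ℚ ] [ 1ℚ ] ≈ 1#
    quotient-1 1≢0 = ⁻¹-inverseʳ _ (regular [ 1ℚ ] 1≢0)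

    quotient-α : Nonzeroₚ [ 1ℚ ] → quotient (0ℚ ∷ 1ℚ ∷ []) [ 1ℚ ] ≈ t
    quotient-α 1≢0 = quotient-unique (0ℚ ∷ 1ℚ ∷ []) [ 1ℚ ] t 1≢0 (begin
      (constant 1ℚ + t * 0#) * t         ≈⟨ *-comm _ _ ⟩
      t * (constant 1ℚ + t * 0#)         ≈⟨ trans (+-congʳ constant-0) (+-identityˡ _) ⟨
      constant 0ℚ + t * (constant 1ℚ + t * 0#) ∎)

-- The ring ℚ[α]

coeff-+ : ∀ p q k → coeffₚ (p +ₚ q) k ≡ coeffₚ p k ℚ.+ coeffₚ q k
coeff-+ []      q       k       = ≡.sym (ℚ.+-identityˡ _)
coeff-+ (a ∷ p) []      k       = ≡.sym (ℚ.+-identityʳ _)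
coeff-+ (a ∷ p) (b ∷ q) zero    = ≡.refl
coeff-+ (a ∷ p) (b ∷ q) (suc k) = coeff-+ p q k

coeff-scale : ∀ a q k → coeffₚ (scaleₚ a q) k ≡ a ℚ.* coeffₚ q k
coeff-scale a []      k       = ≡.sym (ℚ.*-zeroʳ a)
coeff-scale a (b ∷ q) zero    = ≡.refl
coeff-scale a (b ∷ q) (suc k) = coeff-scale a q k

coeff-∷-* : ∀ a p q k → coeffₚ ((a ∷ p) *ₚ q) k ≡ a ℚ.* coeffₚ q k ℚ.+ coeffₚ (0ℚ ∷ p *ₚ q) k
coeff-∷-* a p q k = ≡.trans (coeff-+ (scaleₚ a q) (0ℚ ∷ p *ₚ q) k) (cong (ℚ._+ coeffₚ (0ℚ ∷ p *ₚ q) k) (coeff-scale a q k))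

≈ₚ-trans : ∀ p q r → p ≈ₚ q → q ≈ₚ r → p ≈ₚ r
≈ₚ-trans p q r p≈q q≈r k = ≡.trans (p≈q k) (q≈r k)

∷-cong : ∀ a p q → p ≈ₚ q → (a ∷ p) ≈ₚ (a ∷ q)
∷-cong a p q p≈q zero    = ≡.refl
∷-cong a p q p≈q (suc k) = p≈q k

+ₚ-cong : ∀ p p′ q q′ → p ≈ₚ p′ → q ≈ₚ q′ → p +ₚ q ≈ₚ p′ +ₚ q′
+ₚ-cong p p′ q q′ p≈p′ q≈q′ k = ≡.trans (coeff-+ p q k) (≡.trans (cong₂ ℚ._+_ (p≈p′ k) (q≈q′ k)) (≡.sym (coeff-+ p′ q′ k)))

scaleₚ-cong : ∀ a p p′ → p ≈ₚ p′ → scaleₚ a p ≈ₚ scaleₚ a p′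
scaleₚ-cong a p p′ p≈p′ k = ≡.trans (coeff-scale a p k) (≡.trans (cong (a ℚ.*_) (p≈p′ k)) (≡.sym (coeff-scale a p′ k)))

+ₚ-assoc : ∀ p q r → (p +ₚ q) +ₚ r ≈ₚ p +ₚ (q +ₚ r)
+ₚ-assoc p q r k = begin
  coeffₚ (p +ₚ q +ₚ r) k                          ≡⟨ ≡.trans (coeff-+ (p +ₚ q) r k) (cong (ℚ._+ coeffₚ r k) (coeff-+ p q k)) ⟩
  coeffₚ p k ℚ.+ coeffₚ q k ℚ.+ coeffₚ r k         ≡⟨ ℚ.+-assoc (coeffₚ p k) (coeffₚ q k) (coeffₚ r k) ⟩
  coeffₚ p k ℚ.+ (coeffₚ q k ℚ.+ coeffₚ r k)       ≡⟨ ≡.trans (coeff-+ p (q +ₚ r) k) (cong (coeffₚ p k ℚ.+_) (coeff-+ q r k)) ⟨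
  coeffₚ (p +ₚ (q +ₚ r)) k                        ∎
  where open ≡.≡-Reasoning

+ₚ-comm : ∀ p q → p +ₚ q ≈ₚ q +ₚ p
+ₚ-comm p q k = ≡.trans (coeff-+ p q k) (≡.trans (ℚ.+-comm (coeffₚ p k) (coeffₚ q k)) (≡.sym (coeff-+ q p k)))

-ₚ_ : ℚ[α] → ℚ[α]
-ₚ_ = scaleₚ (ℚ.- 1ℚ)

-ₚ-inverseˡ : ∀ p → (-ₚ p) +ₚ p ≈ₚ []
-ₚ-inverseˡ p k = ≡.trans (coeff-+ (-ₚ p) p k) (≡.trans (cong (ℚ._+ coeffₚ p k) (coeff-scale (ℚ.- 1ℚ) p k))
    (cancel (coeffₚ p k)))
  where
  open +-*-Solver
  cancel : ∀ a → ℚ.- 1ℚ ℚ.* a ℚ.+ a ≡ 0ℚ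
  cancel = solve 1 (λ a → :- con 1ℚ :* a :+ a := con 0ℚ) ≡.refl

*ₚ-congˡ : ∀ p q q′ → q ≈ₚ q′ → p *ₚ q ≈ₚ p *ₚ q′
*ₚ-congˡ []      q q′ q≈q′ k = ≡.refl
*ₚ-congˡ (a ∷ p) q q′ q≈q′   = +ₚ-cong (scaleₚ a q) (scaleₚ a q′) (0ℚ ∷ p *ₚ q) (0ℚ ∷ p *ₚ q′)
  (scaleₚ-cong a q q′ q≈q′) (∷-cong 0ℚ (p *ₚ q) (p *ₚ q′) (*ₚ-congˡ p q q′ q≈q′))

*ₚ-zeroʳ : ∀ p → p *ₚ [] ≈ₚ []
*ₚ-zeroʳ []      k       = ≡.refl
*ₚ-zeroʳ (a ∷ p) zero    = ≡.refl
*ₚ-zeroʳ (a ∷ p) (suc k) = *ₚ-zeroʳ p k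

-- The recursion that defines `_*ₚ_`, transferred to the second factor; commutativity is then an
-- induction.
*ₚ-∷ : ∀ q a p → q *ₚ (a ∷ p) ≈ₚ scaleₚ a q +ₚ (0ℚ ∷ q *ₚ p)
*ₚ-∷ []      a p zero    = ≡.refl
*ₚ-∷ []      a p (suc k) = ≡.refl
*ₚ-∷ (b ∷ q) a p zero    = cong (ℚ._+ 0ℚ) (ℚ.*-comm b a)
*ₚ-∷ (b ∷ q) a p (suc k) = begin
  coeffₚ (scaleₚ b p +ₚ q *ₚ (a ∷ p)) k
    ≡⟨ coeff-+ (scaleₚ b p) (q *ₚ (a ∷ p)) k ⟩
  coeffₚ (scaleₚ b p) k ℚ.+ coeffₚ (q *ₚ (a ∷ p)) k
    ≡⟨ cong (coeffₚ (scaleₚ b p) k ℚ.+_) (≡.trans (*ₚ-∷ q a p k) (coeff-+ (scaleₚ a q) (0ℚ ∷ q *ₚ p) k)) ⟩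
  coeffₚ (scaleₚ b p) k ℚ.+ (coeffₚ (scaleₚ a q) k ℚ.+ coeffₚ (0ℚ ∷ q *ₚ p) k)
    ≡⟨ solve 3 (λ x y z → x :+ (y :+ z) := y :+ (x :+ z)) ≡.refl (coeffₚ (scaleₚ b p) k) (coeffₚ (scaleₚ a q) k)
        (coeffₚ (0ℚ ∷ q *ₚ p) k) ⟩
  coeffₚ (scaleₚ a q) k ℚ.+ (coeffₚ (scaleₚ b p) k ℚ.+ coeffₚ (0ℚ ∷ q *ₚ p) k)
    ≡⟨ ≡.trans (coeff-+ (scaleₚ a q) ((b ∷ q) *ₚ p) k) (cong (coeffₚ (scaleₚ a q) k ℚ.+_)
        (coeff-+ (scaleₚ b p) (0ℚ ∷ q *ₚ p) k)) ⟨
  coeffₚ (scaleₚ a q +ₚ (b ∷ q) *ₚ p) k ∎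
  where
  open ≡.≡-Reasoning
  open +-*-Solver

*ₚ-comm : ∀ p q → p *ₚ q ≈ₚ q *ₚ p
*ₚ-comm []      q k = ≡.sym (*ₚ-zeroʳ q k)
*ₚ-comm (a ∷ p) q   = ≈ₚ-trans ((a ∷ p) *ₚ q) (scaleₚ a q +ₚ (0ℚ ∷ q *ₚ p)) (q *ₚ (a ∷ p))
  (+ₚ-cong (scaleₚ a q) (scaleₚ a q) (0ℚ ∷ p *ₚ q) (0ℚ ∷ q *ₚ p) (λ _ → ≡.refl) (∷-cong 0ℚ (p *ₚ q) (q *ₚ p) (*ₚ-comm p q)))
  (λ k → ≡.sym (*ₚ-∷ q a p k))

*ₚ-cong : ∀ p p′ q q′ → p ≈ₚ p′ → q ≈ₚ q′ → p *ₚ q ≈ₚ p′ *ₚ q′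
*ₚ-cong p p′ q q′ p≈p′ q≈q′ k = begin
  coeffₚ (p *ₚ q) k    ≡⟨ *ₚ-congˡ p q q′ q≈q′ k ⟩
  coeffₚ (p *ₚ q′) k   ≡⟨ *ₚ-comm p q′ k ⟩
  coeffₚ (q′ *ₚ p) k   ≡⟨ *ₚ-congˡ q′ p p′ p≈p′ k ⟩
  coeffₚ (q′ *ₚ p′) k  ≡⟨ *ₚ-comm q′ p′ k ⟩
  coeffₚ (p′ *ₚ q′) k  ∎
  where open ≡.≡-Reasoning

*ₚ-distribˡ : ∀ p q r → p *ₚ (q +ₚ r) ≈ₚ p *ₚ q +ₚ p *ₚ r
*ₚ-distribˡ []      q r k = ≡.refl
*ₚ-distribˡ (a ∷ p) q r k = begin
  coeffₚ ((a ∷ p) *ₚ (q +ₚ r)) k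
    ≡⟨ coeff-∷-* a p (q +ₚ r) k ⟩
  a ℚ.* coeffₚ (q +ₚ r) k ℚ.+ coeffₚ (0ℚ ∷ p *ₚ (q +ₚ r)) k
    ≡⟨ cong₂ (λ x y → a ℚ.* x ℚ.+ y) (coeff-+ q r k) (tail k) ⟩
  a ℚ.* (coeffₚ q k ℚ.+ coeffₚ r k) ℚ.+ (coeffₚ (0ℚ ∷ p *ₚ q) k ℚ.+ coeffₚ (0ℚ ∷ p *ₚ r) k)
    ≡⟨ solve 5 (λ a x y u v → a :* (x :+ y) :+ (u :+ v) := (a :* x :+ u) :+ (a :* y :+ v)) ≡.refl a (coeffₚ q k)
        (coeffₚ r k) _ _ ⟩
  (a ℚ.* coeffₚ q k ℚ.+ coeffₚ (0ℚ ∷ p *ₚ q) k) ℚ.+ (a ℚ.* coeffₚ r k ℚ.+ coeffₚ (0ℚ ∷ p *ₚ r) k)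
    ≡⟨ ≡.trans (coeff-+ ((a ∷ p) *ₚ q) ((a ∷ p) *ₚ r) k) (cong₂ ℚ._+_ (coeff-∷-* a p q k) (coeff-∷-* a p r k)) ⟨
  coeffₚ ((a ∷ p) *ₚ q +ₚ (a ∷ p) *ₚ r) k ∎
  where
  open ≡.≡-Reasoning
  open +-*-Solver
  tail : ∀ k → coeffₚ (0ℚ ∷ p *ₚ (q +ₚ r)) k ≡ coeffₚ (0ℚ ∷ p *ₚ q) k ℚ.+ coeffₚ (0ℚ ∷ p *ₚ r) k
  tail zero    = ≡.refl
  tail (suc k) = ≡.trans (*ₚ-distribˡ p q r k) (coeff-+ (p *ₚ q) (p *ₚ r) k)

*ₚ-distribʳ : ∀ r p q → (p +ₚ q) *ₚ r ≈ₚ p *ₚ r +ₚ q *ₚ r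
*ₚ-distribʳ r p q k = ≡.trans (*ₚ-comm (p +ₚ q) r k) (≡.trans (*ₚ-distribˡ r p q k)
  (+ₚ-cong (r *ₚ p) (p *ₚ r) (r *ₚ q) (q *ₚ r) (*ₚ-comm r p) (*ₚ-comm r q) k))

0∷-* : ∀ p r → (0ℚ ∷ p) *ₚ r ≈ₚ (0ℚ ∷ p *ₚ r)
0∷-* p r k = ≡.trans (coeff-∷-* 0ℚ p r k) (≡.trans (cong (ℚ._+ coeffₚ (0ℚ ∷ p *ₚ r) k) (ℚ.*-zeroˡ (coeffₚ r k)))
    (ℚ.+-identityˡ (coeffₚ (0ℚ ∷ p *ₚ r) k)))

scaleₚ-* : ∀ a q r → scaleₚ a q *ₚ r ≈ₚ scaleₚ a (q *ₚ r)
scaleₚ-* a []      r k = ≡.refl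
scaleₚ-* a (b ∷ q) r k = begin
  coeffₚ ((a ℚ.* b ∷ scaleₚ a q) *ₚ r) k
    ≡⟨ coeff-∷-* (a ℚ.* b) (scaleₚ a q) r k ⟩
  a ℚ.* b ℚ.* coeffₚ r k ℚ.+ coeffₚ (0ℚ ∷ scaleₚ a q *ₚ r) k
    ≡⟨ cong (a ℚ.* b ℚ.* coeffₚ r k ℚ.+_) (tail k) ⟩
  a ℚ.* b ℚ.* coeffₚ r k ℚ.+ a ℚ.* coeffₚ (0ℚ ∷ q *ₚ r) k
    ≡⟨ solve 4 (λ a b x y → a :* b :* x :+ a :* y := a :* (b :* x :+ y)) ≡.refl a b (coeffₚ r k) _ ⟩
  a ℚ.* (b ℚ.* coeffₚ r k ℚ.+ coeffₚ (0ℚ ∷ q *ₚ r) k)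
    ≡⟨ ≡.trans (coeff-scale a ((b ∷ q) *ₚ r) k) (cong (a ℚ.*_) (coeff-∷-* b q r k)) ⟨
  coeffₚ (scaleₚ a ((b ∷ q) *ₚ r)) k ∎
  where
  open ≡.≡-Reasoning
  open +-*-Solver
  tail : ∀ k → coeffₚ (0ℚ ∷ scaleₚ a q *ₚ r) k ≡ a ℚ.* coeffₚ (0ℚ ∷ q *ₚ r) k
  tail zero    = ≡.sym (ℚ.*-zeroʳ a)
  tail (suc k) = ≡.trans (scaleₚ-* a q r k) (coeff-scale a (q *ₚ r) k)

*ₚ-assoc : ∀ p q r → (p *ₚ q) *ₚ r ≈ₚ p *ₚ (q *ₚ r)
*ₚ-assoc []      q r k = ≡.refl
*ₚ-assoc (a ∷ p) q r k = ≡.trans (*ₚ-distribʳ r (scaleₚ a q) (0ℚ ∷ p *ₚ q) k)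
  (+ₚ-cong (scaleₚ a q *ₚ r) (scaleₚ a (q *ₚ r)) ((0ℚ ∷ p *ₚ q) *ₚ r) (0ℚ ∷ p *ₚ (q *ₚ r)) (scaleₚ-* a q r)
    (≈ₚ-trans ((0ℚ ∷ p *ₚ q) *ₚ r) (0ℚ ∷ (p *ₚ q) *ₚ r) (0ℚ ∷ p *ₚ (q *ₚ r)) (0∷-* (p *ₚ q) r)
      (∷-cong 0ℚ ((p *ₚ q) *ₚ r) (p *ₚ (q *ₚ r)) (*ₚ-assoc p q r))) k)

*ₚ-identityˡ : ∀ p → [ 1ℚ ] *ₚ p ≈ₚ p
*ₚ-identityˡ p k = ≡.trans (coeff-∷-* 1ℚ [] p k) (≡.trans (cong₂ ℚ._+_ (ℚ.*-identityˡ (coeffₚ p k)) (zeros k))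
    (ℚ.+-identityʳ _))
  where
  zeros : ∀ k → coeffₚ [ 0ℚ ] k ≡ 0ℚ
  zeros zero    = ≡.refl
  zeros (suc k) = ≡.refl

polynomialRing : CommutativeRing 0ℓ 0ℓ
polynomialRing = record
  { Carrier = ℚ[α] ; _≈_ = _≈ₚ_ ; _+_ = _+ₚ_ ; _*_ = _*ₚ_ ; -_ = -ₚ_ ; 0# = [] ; 1# = [ 1ℚ ]
  ; isCommutativeRing = record
    { isRing = record
      { +-isAbelianGroup = record
        { isGroup = record
          { isMonoid = record
            { isSemigroup = record
              { isMagma = record
                { isEquivalence = record
                  { refl  = λ k → ≡.refl
                  ; sym   = λ p≈q k → ≡.sym (p≈q k)
                  ; trans = λ p≈q q≈r k → ≡.trans (p≈q k) (q≈r k) }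
                ; ∙-cong = λ {p} {p′} {q} {q′} → +ₚ-cong p p′ q q′ }
              ; assoc = +ₚ-assoc }
            ; identity = (λ p k → ≡.refl) , (λ p k → +ₚ-comm p [] k) }
          ; inverse = -ₚ-inverseˡ , (λ p k → ≡.trans (+ₚ-comm p (-ₚ p) k) (-ₚ-inverseˡ p k))
          ; ⁻¹-cong = λ {p} {q} → scaleₚ-cong (ℚ.- 1ℚ) p q }
        ; comm = +ₚ-comm }
      ; *-cong = λ {p} {p′} {q} {q′} → *ₚ-cong p p′ q q′
      ; *-assoc = *ₚ-assoc
      ; *-identity = *ₚ-identityˡ , (λ p k → ≡.trans (*ₚ-comm p [ 1ℚ ] k) (*ₚ-identityˡ p k))
      ; distrib = *ₚ-distribˡ , *ₚ-distribʳ }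
    ; *-comm = *ₚ-comm } }

nonzero⇒≉[] : ∀ {p} → Nonzeroₚ p → ¬ p ≈ₚ []
nonzero⇒≉[] (here a≢0)  p≈[] = a≢0 (p≈[] 0)
nonzero⇒≉[] (there p≢0) p≈[] = nonzero⇒≉[] p≢0 (p≈[] ∘ suc)

¬nonzero⇒≈[] : ∀ p → ¬ Nonzeroₚ p → p ≈ₚ []
¬nonzero⇒≈[] []      p≡0 k = ≡.refl
¬nonzero⇒≈[] (a ∷ p) p≡0 zero with a ℚ.≟ 0ℚ
... | yes a≡0 = a≡0
... | no a≢0  = contradiction (here a≢0) p≡0
¬nonzero⇒≈[] (a ∷ p) p≡0 (suc k) = ¬nonzero⇒≈[] p (p≡0 ∘ there) k

≉[]⇒nonzero : ∀ p → ¬ p ≈ₚ [] → Nonzeroₚ p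
≉[]⇒nonzero p p≉[] with nonzeroₚ? p
... | yes p≢0 = p≢0
... | no ¬p≢0 = contradiction (¬nonzero⇒≈[] p ¬p≢0) p≉[]

-- Polynomials which are positive for all small α > 0

data Positiveₚ : ℚ[α] → Set where
  here  : ∀ {a p} → 0ℚ ℚ.< a → Positiveₚ (a ∷ p)
  there : ∀ {a p} → a ≡ 0ℚ → Positiveₚ p → Positiveₚ (a ∷ p)

positiveₚ-resp : ∀ {p} q → p ≈ₚ q → Positiveₚ p → Positiveₚ q
positiveₚ-resp []      p≈q (here 0<a)    = contradiction (subst (0ℚ ℚ.<_) (p≈q 0) 0<a) (ℚ.<-irrefl ≡.refl)
positiveₚ-resp []      p≈q (there _ p>0) with positiveₚ-resp [] (p≈q ∘ suc) p>0
... | ()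
positiveₚ-resp (b ∷ q) p≈q (here 0<a)      = here (subst (0ℚ ℚ.<_) (p≈q 0) 0<a)
positiveₚ-resp (b ∷ q) p≈q (there a≡0 p>0) = there (≡.trans (≡.sym (p≈q 0)) a≡0) (positiveₚ-resp q (p≈q ∘ suc) p>0)

positiveₚ⇒≉[] : ∀ {p} → Positiveₚ p → ¬ p ≈ₚ []
positiveₚ⇒≉[] p>0 p≈[] with positiveₚ-resp [] p≈[] p>0
... | ()

positiveₚ-+ : ∀ {p q} → Positiveₚ p → Positiveₚ q → Positiveₚ (p +ₚ q)
positiveₚ-+ (here 0<a)         (here 0<b)         = here (ℚ.+-mono-< 0<a 0<b)
positiveₚ-+ (here {a} 0<a)     (there ≡.refl q>0) = here (subst (0ℚ ℚ.<_) (≡.sym (ℚ.+-identityʳ a)) 0<a)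
positiveₚ-+ (there ≡.refl p>0) (here {b} 0<b)     = here (subst (0ℚ ℚ.<_) (≡.sym (ℚ.+-identityˡ b)) 0<b)
positiveₚ-+ (there ≡.refl p>0) (there ≡.refl q>0) = there ≡.refl (positiveₚ-+ p>0 q>0)

0<a*b : ∀ {a b} → 0ℚ ℚ.< a → 0ℚ ℚ.< b → 0ℚ ℚ.< a ℚ.* b
0<a*b {a} {b} 0<a 0<b = ℚ.positive⁻¹ (a ℚ.* b) {{ℚ.pos*pos⇒pos a {{ℚ.positive 0<a}} b {{ℚ.positive 0<b}}}}

positiveₚ-* : ∀ {p q} → Positiveₚ p → Positiveₚ q → Positiveₚ (p *ₚ q)
positiveₚ-* {a ∷ p} {b ∷ q} (here 0<a) (here 0<b) = here (subst (0ℚ ℚ.<_) (≡.sym (ℚ.+-identityʳ (a ℚ.* b))) (0<a*b 0<a 0<b))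
positiveₚ-* {a ∷ p} {_ ∷ q} (here 0<a) (there ≡.refl q>0) = positiveₚ-resp ((a ∷ p) *ₚ (0ℚ ∷ q))
  (λ k → ≡.sym (≡.trans (*ₚ-comm (a ∷ p) (0ℚ ∷ q) k) (≡.trans (0∷-* q (a ∷ p) k) (∷-cong 0ℚ (q *ₚ (a ∷ p)) ((a ∷ p) *ₚ q)
      (*ₚ-comm q (a ∷ p)) k))))
  (there ≡.refl (positiveₚ-* {a ∷ p} {q} (here 0<a) q>0))
positiveₚ-* {_ ∷ p} {q} (there ≡.refl p>0) q>0 = positiveₚ-resp ((0ℚ ∷ p) *ₚ q) (λ k → ≡.sym (0∷-* p q k))
  (there ≡.refl (positiveₚ-* {p} {q} p>0 q>0))

positive-or-negative : ∀ {p} → Nonzeroₚ p → Positiveₚ p ⊎ Positiveₚ (-ₚ p)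
positive-or-negative {a ∷ p} p≢0 with ℚ.<-cmp 0ℚ a
... | tri< 0<a _ _ = inj₁ (here 0<a)
... | tri> _ _ a<0 = inj₂ (here (subst (0ℚ ℚ.<_) (ℚ.neg-distribˡ-* 1ℚ a) (subst (λ b → 0ℚ ℚ.< ℚ.- b) (≡.sym (ℚ.*-identityˡ a))
    (ℚ.neg-antimono-< a<0))))
... | tri≈ _ 0≡a _ with p≢0
...   | here a≢0 = contradiction (≡.sym 0≡a) a≢0
...   | there p≢0′ with positive-or-negative p≢0′
...     | inj₁ p>0 = inj₁ (there (≡.sym 0≡a) p>0)
...     | inj₂ p<0 = inj₂ (there (≡.trans (cong (ℚ.- 1ℚ ℚ.*_) (≡.sym 0≡a)) (ℚ.*-zeroʳ (ℚ.- 1ℚ))) p<0)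

module Polynomials = CommutativeRing polynomialRing

-- Identities between numerators and denominators

module Identities (R : CommutativeRing 0ℓ 0ℓ) where
  open CommutativeRing R
  open RingProperties ring using (-‿distribˡ-*; -‿distribʳ-*; -‿involutive)
  open RingSolver commutativeSemiring
  open SetoidReasoning setoid

  -- Transitivity of cross-multiplied equality, up to the middle denominator d, which `*ₚ-cancelʳ`
  -- removes.
  trans-identity : ∀ a b c d e k → a * d ≈ c * b → c * k ≈ e * d → (a * k) * d ≈ (e * b) * d
  trans-identity a b c d e k ad≈cb ck≈ed = begin
    (a * k) * d  ≈⟨ solve 3 (λ a k d → (a :* k) :* d := (a :* d) :* k) refl a k d ⟩
    (a * d) * k  ≈⟨ *-congʳ ad≈cb ⟩
    (c * b) * k  ≈⟨ solve 3 (λ c b k → (c :* b) :* k := (c :* k) :* b) refl c b k ⟩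
    (c * k) * b  ≈⟨ *-congʳ ck≈ed ⟩
    (e * d) * b  ≈⟨ solve 3 (λ e d b → (e :* d) :* b := (e :* b) :* d) refl e d b ⟩
    (e * b) * d  ∎

  difference : ∀ x y d → x * d ≈ y * d → (x - y) * d ≈ 0#
  difference x y d xd≈yd = trans (distribʳ d x (- y)) (trans (+-congˡ (sym (-‿distribˡ-* y d)))
      (trans (+-congʳ xd≈yd) (-‿inverseʳ (y * d))))

  difference⇒≈ : ∀ x y → x - y ≈ 0# → x ≈ y
  difference⇒≈ x y x-y≈0 = begin
    x              ≈⟨ +-identityʳ x ⟨
    x + 0#         ≈⟨ +-congˡ (-‿inverseˡ y) ⟨
    x + (- y + y)  ≈⟨ +-assoc x (- y) y ⟨
    x - y + y      ≈⟨ +-congʳ x-y≈0 ⟩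
    0# + y         ≈⟨ +-identityˡ y ⟩
    y              ∎

  +-cong-identity : ∀ a b a′ b′ c d c′ d′ → a * b′ ≈ a′ * b → c * d′ ≈ c′ * d →
    (a * d + c * b) * (b′ * d′) ≈ (a′ * d′ + c′ * b′) * (b * d)
  +-cong-identity a b a′ b′ c d c′ d′ ab′≈a′b cd′≈c′d = begin
    (a * d + c * b) * (b′ * d′)
      ≈⟨ solve 6 (λ a b b′ c d d′ → (a :* d :+ c :* b) :* (b′ :* d′) := (a :* b′) :* (d :* d′) :+ (c :* d′) :*
          (b :* b′)) refl a b b′ c d d′ ⟩
    (a * b′) * (d * d′) + (c * d′) * (b * b′)
      ≈⟨ +-cong (*-congʳ ab′≈a′b) (*-congʳ cd′≈c′d) ⟩
    (a′ * b) * (d * d′) + (c′ * d) * (b * b′)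
      ≈⟨ solve 6 (λ a′ b b′ c′ d d′ → (a′ :* b) :* (d :* d′) :+ (c′ :* d) :* (b :* b′) := (a′ :* d′ :+ c′ :* b′) :*
          (b :* d)) refl a′ b b′ c′ d d′ ⟩
    (a′ * d′ + c′ * b′) * (b * d) ∎

  *-cong-identity : ∀ a b a′ b′ c d c′ d′ → a * b′ ≈ a′ * b → c * d′ ≈ c′ * d → (a * c) * (b′ * d′) ≈ (a′ * c′) * (b * d)
  *-cong-identity a b a′ b′ c d c′ d′ ab′≈a′b cd′≈c′d = begin
    (a * c) * (b′ * d′)  ≈⟨ solve 4 (λ a c b′ d′ → (a :* c) :* (b′ :* d′) := (a :* b′) :* (c :* d′)) refl a c b′ d′ ⟩
    (a * b′) * (c * d′)  ≈⟨ *-cong ab′≈a′b cd′≈c′d ⟩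
    (a′ * b) * (c′ * d)  ≈⟨ solve 4 (λ a′ b c′ d → (a′ :* b) :* (c′ :* d) := (a′ :* c′) :* (b :* d)) refl a′ b c′ d ⟩
    (a′ * c′) * (b * d)  ∎

  +-assoc-identity : ∀ a b c d e k → ((a * d + c * b) * k + e * (b * d)) * (b * (d * k)) ≈ (a * (d * k) + (c * k + e * d) *
      b) * (b * d * k)
  +-assoc-identity = solve 6 (λ a b c d e k → ((a :* d :+ c :* b) :* k :+ e :* (b :* d)) :* (b :* (d :* k)) :=
    (a :* (d :* k) :+ (c :* k :+ e :* d) :* b) :* (b :* d :* k)) refl

  +-comm-identity : ∀ a b c d → (a * d + c * b) * (d * b) ≈ (c * b + a * d) * (b * d)
  +-comm-identity = solve 4 (λ a b c d → (a :* d :+ c :* b) :* (d :* b) := (c :* b :+ a :* d) :* (b :* d)) refl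

  +-identityˡ-identity : ∀ a b → (0# * b + a * 1#) * b ≈ a * (1# * b)
  +-identityˡ-identity a b = trans (*-congʳ (trans (+-cong (zeroˡ b) (*-identityʳ a)) (+-identityˡ a)))
      (*-congˡ (sym (*-identityˡ b)))

  +-inverseˡ-identity : ∀ a b → ((- a) * b + a * b) * 1# ≈ 0# * (b * b)
  +-inverseˡ-identity a b = trans (*-identityʳ _)
      (trans (trans (sym (distribʳ b (- a) a)) (trans (*-congʳ (-‿inverseˡ a)) (zeroˡ b))) (sym (zeroˡ _)))

  -‿cong-identity : ∀ a b c d → a * d ≈ c * b → (- a) * d ≈ (- c) * b
  -‿cong-identity a b c d ad≈cb = trans (sym (-‿distribˡ-* a d)) (trans (-‿cong ad≈cb) (-‿distribˡ-* c b))

  *-assoc-identity : ∀ a b c d e k → ((a * c) * e) * (b * (d * k)) ≈ (a * (c * e)) * ((b * d) * k)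
  *-assoc-identity = solve 6 (λ a b c d e k → ((a :* c) :* e) :* (b :* (d :* k)) := (a :* (c :* e)) :* ((b :* d) :* k)) refl

  *-comm-identity : ∀ a b c d → (a * c) * (d * b) ≈ (c * a) * (b * d)
  *-comm-identity = solve 4 (λ a b c d → (a :* c) :* (d :* b) := (c :* a) :* (b :* d)) refl

  *-identityˡ-identity : ∀ a b → (1# * a) * b ≈ a * (1# * b)
  *-identityˡ-identity a b = trans (*-congʳ (*-identityˡ a)) (*-congˡ (sym (*-identityˡ b)))

  distribˡ-identity : ∀ a b c d e k → (a * (c * k + e * d)) * ((b * d) * (b * k)) ≈ ((a * c) * (b * k) + (a * e) * (b * d)) *
      (b * (d * k))
  distribˡ-identity = solve 6 (λ a b c d e k → (a :* (c :* k :+ e :* d)) :* ((b :* d) :* (b :* k)) :=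
    ((a :* c) :* (b :* k) :+ (a :* e) :* (b :* d)) :* (b :* (d :* k))) refl

  inverse-identity : ∀ a b → (b * a) * 1# ≈ 1# * (a * b)
  inverse-identity a b = trans (*-identityʳ _) (trans (*-comm b a) (sym (*-identityˡ _)))

  neg-square : ∀ a → (- a) * (- a) ≈ a * a
  neg-square a = trans (sym (-‿distribˡ-* a (- a))) (trans (-‿cong (sym (-‿distribʳ-* a a))) (-‿involutive (a * a)))

  positive-+-identity : ∀ a b c d → (a * b) * (d * d) + (c * d) * (b * b) ≈ (a * d + c * b) * (b * d)
  positive-+-identity = solve 4 (λ a b c d → (a :* b) :* (d :* d) :+ (c :* d) :* (b :* b) := (a :* d :+ c :* b) :*
      (b :* d)) refl

  positive-*-identity : ∀ a b c d → (a * b) * (c * d) ≈ (a * c) * (b * d)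
  positive-*-identity = solve 4 (λ a b c d → (a :* b) :* (c :* d) := (a :* c) :* (b :* d)) refl

  positive-resp-identity : ∀ a b c d → a * d ≈ c * b → (a * b) * (d * d) ≈ (c * d) * (b * b)
  positive-resp-identity a b c d ad≈cb = begin
    (a * b) * (d * d)  ≈⟨ solve 3 (λ a b d → (a :* b) :* (d :* d) := (a :* d) :* (b :* d)) refl a b d ⟩
    (a * d) * (b * d)  ≈⟨ *-congʳ ad≈cb ⟩
    (c * b) * (b * d)  ≈⟨ solve 3 (λ c b d → (c :* b) :* (b :* d) := (c :* d) :* (b :* b)) refl c b d ⟩
    (c * d) * (b * b)  ∎

  neg-cancel : ∀ x s → (- x) * s + x * s ≈ 0#
  neg-cancel x s = trans (sym (distribʳ s (- x) x)) (trans (*-congʳ (-‿inverseˡ x)) (zeroˡ s))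

  constant-+-identity : ∀ a b → (a + b) * (1# * 1#) ≈ (a * 1# + b * 1#) * 1#
  constant-+-identity = solve 2 (λ a b → (a :+ b) :* (con 1 :* con 1) := (a :* con 1 :+ b :* con 1) :* con 1) refl

  constant-*-identity : ∀ a b → (a * b) * (1# * 1#) ≈ (a * b) * 1#
  constant-*-identity = solve 2 (λ a b → (a :* b) :* (con 1 :* con 1) := (a :* b) :* con 1) refl

  evaluate-α-identity : ∀ a t q → (a * (1# * 1#) + (t * q) * 1#) * 1# ≈ (a + t * q) * (1# * (1# * 1#))
  evaluate-α-identity = solve 3 (λ a t q → (a :* (con 1 :* con 1) :+ (t :* q) :* con 1) :* con 1 := (a :+ t :* q) :*
      (con 1 :* (con 1 :* con 1))) refl

open Identities polynomialRing
open import Defs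

*ₚ-cancelʳ : ∀ x y d → Nonzeroₚ d → x *ₚ d ≈ₚ y *ₚ d → x ≈ₚ y
*ₚ-cancelʳ x y d d≢0 xd≈yd with nonzeroₚ? (x +ₚ (-ₚ y))
... | yes x-y≢0 = contradiction (difference x y d xd≈yd) (nonzero⇒≉[] (*ₚ-nonzero x-y≢0 d≢0))
... | no ¬x-y≢0 = difference⇒≈ x y (¬nonzero⇒≈[] (x +ₚ (-ₚ y)) ¬x-y≢0)

square-positive : ∀ {p} → Nonzeroₚ p → Positiveₚ (p *ₚ p)
square-positive {p} p≢0 with positive-or-negative p≢0
... | inj₁ p>0 = positiveₚ-* p>0 p>0
... | inj₂ p<0 = positiveₚ-resp (p *ₚ p) (neg-square p) (positiveₚ-* p<0 p<0)

-- Passing to another representative of a fraction changes numerator times denominator by squares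
-- only. If -x were positive, x b² and its negative would both be positive.
square-cancel : ∀ x b → Nonzeroₚ b → Positiveₚ (x *ₚ (b *ₚ b)) → Positiveₚ x
square-cancel x b b≢0 xbb>0 with nonzeroₚ? x
... | no ¬x≢0 = contradiction (*ₚ-cong x [] (b *ₚ b) (b *ₚ b) (¬nonzero⇒≈[] x ¬x≢0) (λ _ → ≡.refl)) (positiveₚ⇒≉[] xbb>0)
... | yes x≢0 with positive-or-negative x≢0
...   | inj₁ x>0 = x>0
...   | inj₂ x<0 = contradiction (neg-cancel x (b *ₚ b))
    (positiveₚ⇒≉[] (positiveₚ-+ (positiveₚ-* x<0 (square-positive b≢0)) xbb>0))

-- The field ℚ(α)

≈0⇒num≈[] : ∀ f → f ≈ 0# → num f ≈ₚ []
≈0⇒num≈[] f f≈0 = ≈ₚ-trans (num f) (num f *ₚ [ 1ℚ ]) [] (λ k → ≡.sym (Polynomials.*-identityʳ (num f) k)) f≈0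

num≈[]⇒≈0 : ∀ f → num f ≈ₚ [] → f ≈ 0#
num≈[]⇒≈0 f n≈[] = ≈ₚ-trans (num f *ₚ [ 1ℚ ]) (num f) [] (Polynomials.*-identityʳ (num f)) n≈[]

-- The sign of n / d is that of n d, so denominators may have either sign.
Positive : ℚ⟨α⟩ → Set
Positive f = Positiveₚ (num f *ₚ den f)

rationalFunctionRing : CommutativeRing 0ℓ 0ℓ
rationalFunctionRing = record
  { Carrier = ℚ⟨α⟩ ; _≈_ = _≈_ ; _+_ = _+_ ; _*_ = _*_ ; -_ = -_ ; 0# = 0# ; 1# = 1#
  ; isCommutativeRing = record
    { isRing = record
      { +-isAbelianGroup = record
        { isGroup = record
          { isMonoid = record
            { isSemigroup = record
              { isMagma = record
                { isEquivalence = record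
                  { refl  = λ k → ≡.refl
                  ; sym   = λ f≈g k → ≡.sym (f≈g k)
                  ; trans = λ {f} {g} {h} f≈g g≈h → *ₚ-cancelʳ (num f *ₚ den h) (num h *ₚ den f) (den g) (den≢0 g)
                      (trans-identity (num f) (den f) (num g) (den g) (num h) (den h) f≈g g≈h) }
                ; ∙-cong = λ {f} {f′} {g} {g′} → +-cong-identity (num f) (den f) (num f′) (den f′) (num g) (den g) (num g′)
                    (den g′) }
              ; assoc = λ f g h → +-assoc-identity (num f) (den f) (num g) (den g) (num h) (den h) }
            ; identity = +-identityˡ , λ f → swap-trans (f + 0#) (0# + f) f (+-comm f 0#) (+-identityˡ f) }
          ; inverse = +-inverseˡ , λ f → swap-trans (f + (- f)) ((- f) + f) 0# (+-comm f (- f)) (+-inverseˡ f)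
          ; ⁻¹-cong = λ {f} {g} → -‿cong-identity (num f) (den f) (num g) (den g) }
        ; comm = +-comm }
      ; *-cong = λ {f} {f′} {g} {g′} → *-cong-identity (num f) (den f) (num f′) (den f′) (num g) (den g) (num g′) (den g′)
      ; *-assoc = λ f g h → *-assoc-identity (num f) (den f) (num g) (den g) (num h) (den h)
      ; *-identity = *-identityˡ , λ f → swap-trans (f * 1#) (1# * f) f (*-comm f 1#) (*-identityˡ f)
      ; distrib = distribˡ , λ h f g → swap-trans ((f + g) * h) (h * (f + g)) (f * h + g * h) (*-comm (f + g) h)
          (swap-trans (h * (f + g)) (h * f + h * g) (f * h + g * h) (distribˡ h f g)
            (+-cong-identity (num (h * f)) (den (h * f)) (num (f * h)) (den (f * h)) (num (h * g)) (den (h * g)) (num (g * h))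
                (den (g * h))
              (*-comm h f) (*-comm h g))) }
    ; *-comm = *-comm } }
  where
  swap-trans : ∀ f g h → f ≈ g → g ≈ h → f ≈ h
  swap-trans f g h f≈g g≈h = *ₚ-cancelʳ (num f *ₚ den h) (num h *ₚ den f) (den g) (den≢0 g)
    (trans-identity (num f) (den f) (num g) (den g) (num h) (den h) f≈g g≈h)
  +-comm : ∀ f g → f + g ≈ g + f
  +-comm f g = +-comm-identity (num f) (den f) (num g) (den g)
  +-identityˡ : ∀ f → 0# + f ≈ f
  +-identityˡ f = +-identityˡ-identity (num f) (den f)
  +-inverseˡ : ∀ f → (- f) + f ≈ 0#
  +-inverseˡ f = +-inverseˡ-identity (num f) (den f)
  *-comm : ∀ f g → f * g ≈ g * f
  *-comm f g = *-comm-identity (num f) (den f) (num g) (den g)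
  *-identityˡ : ∀ f → 1# * f ≈ f
  *-identityˡ f = *-identityˡ-identity (num f) (den f)
  distribˡ : ∀ f g h → f * (g + h) ≈ f * g + f * h
  distribˡ f g h = distribˡ-identity (num f) (den f) (num g) (den g) (num h) (den h)

rationalFunctions : PositiveField
rationalFunctions = record
  { commutativeRing = rationalFunctionRing
  ; _⁻¹ = _⁻¹
  ; ⁻¹-inverseˡ = inverse
  ; zero? = λ f → zero?′ f (nonzeroₚ? (num f))
  ; Positive = Positive
  ; positive-resp = λ {f} {g} f≈g f>0 → square-cancel (num g *ₚ den g) (den f) (den≢0 f)
      (positiveₚ-resp _ (positive-resp-identity (num f) (den f) (num g) (den g) f≈g)
          (positiveₚ-* f>0 (square-positive (den≢0 g))))
  ; positive-+ = λ {f} {g} f>0 g>0 → positiveₚ-resp (num (f + g) *ₚ den (f + g))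
      (positive-+-identity (num f) (den f) (num g) (den g))
      (positiveₚ-+ (positiveₚ-* f>0 (square-positive (den≢0 g))) (positiveₚ-* g>0 (square-positive (den≢0 f))))
  ; positive-* = λ {f} {g} f>0 g>0 → positiveₚ-resp (num (f * g) *ₚ den (f * g))
      (positive-*-identity (num f) (den f) (num g) (den g)) (positiveₚ-* f>0 g>0)
  ; positive-square = λ {f} f≉0 → positiveₚ-* (square-positive (≉[]⇒nonzero (num f) (f≉0 ∘ num≈[]⇒≈0 f)))
      (square-positive (den≢0 f))
  ; positive⇒≉0 = λ {f} f>0 f≈0 → positiveₚ⇒≉[] f>0 (*ₚ-cong (num f) [] (den f) (den f) (≈0⇒num≈[] f f≈0) (λ _ → ≡.refl))
  ; 1≉0 = λ 1≈0 → nonzero⇒≉[] 1≢0ₚ (≈0⇒num≈[] 1# 1≈0)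
  }
  where
  inverse : ∀ f → ¬ f ≈ 0# → f ⁻¹ * f ≈ 1#
  inverse f f≉0 with nonzeroₚ? (num f)
  ... | yes _   = inverse-identity (num f) (den f)
  ... | no ¬n≢0 = contradiction (num≈[]⇒≈0 f (¬nonzero⇒≈[] (num f) ¬n≢0)) f≉0
  zero?′ : ∀ f → Dec (Nonzeroₚ (num f)) → Dec (f ≈ 0#)
  zero?′ f (yes n≢0) = no (nonzero⇒≉[] n≢0 ∘ ≈0⇒num≈[] f)
  zero?′ f (no ¬n≢0) = yes (num≈[]⇒≈0 f (¬nonzero⇒≈[] (num f) ¬n≢0))

module ℚ⟨α⟩ᶠ = PositiveField rationalFunctions

0<1 : 0ℚ ℚ.< 1ℚ
0<1 = ℚ.positive⁻¹ 1ℚ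

α-positive : Positive α
α-positive = positiveₚ-* {num α} {den α} (there ≡.refl (here 0<1)) (here 0<1)

α≉0 : ¬ α ≈ 0#
α≉0 = ℚ⟨α⟩ᶠ.positive⇒≉0 {α} α-positive

fraction : ℚ[α] → ℚ⟨α⟩
fraction p = frac p [ 1ℚ ] 1≢0ₚ

fraction-cong : ∀ p q → p ≈ₚ q → fraction p ≈ fraction q
fraction-cong p q p≈q = *ₚ-cong p q [ 1ℚ ] [ 1ℚ ] p≈q (λ _ → ≡.refl)

scalars : Scalars rationalFunctions
scalars = record
  { constant   = constant
  ; constant-+ = λ a b → constant-+-identity [ a ] [ b ]
  ; constant-* = λ a b → ≈ₚ-trans ([ a ℚ.* b ] *ₚ ([ 1ℚ ] *ₚ [ 1ℚ ])) (([ a ] *ₚ [ b ]) *ₚ ([ 1ℚ ] *ₚ [ 1ℚ ]))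
      (([ a ] *ₚ [ b ]) *ₚ [ 1ℚ ])
      (*ₚ-cong [ a ℚ.* b ] ([ a ] *ₚ [ b ]) ([ 1ℚ ] *ₚ [ 1ℚ ]) ([ 1ℚ ] *ₚ [ 1ℚ ])
        (λ { zero → ≡.sym (ℚ.+-identityʳ (a ℚ.* b)) ; (suc k) → ≡.refl }) (λ _ → ≡.refl))
      (constant-*-identity [ a ] [ b ])
  ; constant-0 = num≈[]⇒≈0 (constant 0ℚ) (λ { zero → ≡.refl ; (suc k) → ≡.refl })
  ; constant-1 = λ k → ≡.refl
  }

-- Horner's scheme at α rebuilds the polynomial as a fraction; hence `transcendental`.
evaluate-α : ∀ p → evaluate p α ≈ fraction p
evaluate-α []      = λ _ → ≡.refl
evaluate-α (a ∷ p) = ℚ⟨α⟩ᶠ.trans {evaluate (a ∷ p) α} {constant a + α * fraction p} {fraction (a ∷ p)}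
  (ℚ⟨α⟩ᶠ.+-congˡ {constant a} {α * evaluate p α} {α * fraction p} (ℚ⟨α⟩ᶠ.*-congˡ {α} {evaluate p α} {fraction p}
      (evaluate-α p)))
  (ℚ⟨α⟩ᶠ.trans {constant a + α * fraction p} {fraction ([ a ] +ₚ num α *ₚ p)} {fraction (a ∷ p)}
    (evaluate-α-identity [ a ] (num α) p)
    (fraction-cong ([ a ] +ₚ num α *ₚ p) (a ∷ p) horner))
  where
  horner : [ a ] +ₚ num α *ₚ p ≈ₚ (a ∷ p)
  horner k = ≡.trans (+ₚ-cong [ a ] [ a ] (num α *ₚ p) (0ℚ ∷ p) (λ _ → ≡.refl)
    (≈ₚ-trans (num α *ₚ p) (0ℚ ∷ [ 1ℚ ] *ₚ p) (0ℚ ∷ p) (0∷-* [ 1ℚ ] p) (∷-cong 0ℚ ([ 1ℚ ] *ₚ p) p (*ₚ-identityˡ p))) k)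
        (drop-0 k)
    where
    drop-0 : ([ a ] +ₚ (0ℚ ∷ p)) ≈ₚ (a ∷ p)
    drop-0 zero    = ℚ.+-identityʳ a
    drop-0 (suc k) = ≡.refl

transcendental : ∀ p → Nonzeroₚ p → ¬ evaluate p α ≈ 0#
transcendental p p≢0 p≈0 = nonzero⇒≉[] p≢0 (≈0⇒num≈[] (fraction p)
  (ℚ⟨α⟩ᶠ.trans {fraction p} {evaluate p α} {0#} (ℚ⟨α⟩ᶠ.sym {evaluate p α} {fraction p} (evaluate-α p)) p≈0))

α⁻¹*α≈1 : α ⁻¹ * α ≈ 1#
α⁻¹*α≈1 = ℚ⟨α⟩ᶠ.⁻¹-inverseˡ α α≉0

module At-1/α = Evaluation.Quotient rationalFunctions scalars (α ⁻¹)
  (Evaluation.evaluate-≉0 rationalFunctions scalars {α ⁻¹} {α} α⁻¹*α≈1 α≉0 transcendental)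

inversion : Inversion rationalFunctions α
inversion = record
  { φ      = _[1/α]
  ; φ-cong = λ {f} {g} → At-1/α.quotient-cong (num f) (den f) (num g) (den g) (den≢0 f) (den≢0 g)
  ; φ-+    = λ f g → At-1/α.quotient-+ (num f) (den f) (num g) (den g) (den≢0 f) (den≢0 g) (den≢0 (f + g))
  ; φ-*    = λ f g → At-1/α.quotient-*-homo (num f) (den f) (num g) (den g) (den≢0 f) (den≢0 g) (den≢0 (f * g))
  ; φ-1    = At-1/α.quotient-1 1≢0ₚ
  ; φ-α    = ℚ⟨α⟩ᶠ.trans {α [1/α] * α} {α ⁻¹ * α} {1#}
      (ℚ⟨α⟩ᶠ.*-congʳ {α} {α [1/α]} {α ⁻¹} (At-1/α.quotient-α 1≢0ₚ)) α⁻¹*α≈1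
  }

corollary3p9 : (J : Partition → SymmetricFunction) → IsJackFamily J →
    (n : ℕ) (1≤n : 1 ≤ n) →
    J̃ J (row n 1≤n) ≈ₛ
    fromℕ (n !) • ∑ₛ (S n) (λ π →
    binomial (α + fromℕ n - 1# - fromℕ (des π)) n • F n (Des n (P π)))
corollary3p9 J isJack = oneRowJack-expansion (λ μ → series (J μ)) monomialExpansion expands triangular normalised orthogonal
  where
  open IsJackFamily isJack
  open OneRowJackExpansion rationalFunctions α α-positive inversion
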